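{- There exists a $25.12$-approximation algorithm for UFPP with running time $O(n^4\log n)$, where $n$ is the number of tasks.
   Context: UFPP (Unsplittable Flow Problem on a Path): an instance consists of a path $P=(V,E)$ with $V=\{0,\ldots,m\}$, $E=\{\{i,i+1\}\mid 0\le i\le m-1\}$, a positive integer capacity $u_e$ for each edge $e\in E$, and a set $T=\{1,\ldots,n\}$ of tasks, where task $i$ has a start vertex $s_i\in V$ and end vertex $t_i\in V$ with $s_i<t_i$, a positive integer demand $d_i$, and a positive integer profit $w_i$. Task $i$ uses edge $e$ if $e$ lies on the subpath from $s_i$ to $t_i$; $T_e$ is the set of tasks using $e$. A set $F\subseteq T$ is feasible if $\sum_{i\in F\cap T_e}d_i\le u_e$ for every $e\in E$. The goal is to find a feasible $F$ maximizing the profit $w(F)=\sum_{i\in F}w_i$. It is assumed that every vertex of $P$ is a start or end vertex of some task, so $m<2n$. An $\alpha$-approximation algorithm is an algorithm that computes, for every given instance, a feasible solution whose profit is at least $\frac1\alpha$ times the optimal profit. -}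

module Defs where

open import Algebra.Properties.CommutativeMonoid.Sum using (sum)
open import Data.Bool.Base using (if_then_else_; not; _∧_)
open import Data.Fin.Base using (Fin; toℕ; fromℕ<)
open import Data.Fin.Subset using (Subset; _∩_)
open import Data.Integer.Base using (+_)
open import Data.Nat.Base
  using (ℕ; zero; suc; _+_; _*_; _∸_; _^_; _≤_; _<_; _≡ᵇ_; _≤ᵇ_; _<ᵇ_)
import Data.Nat.Base as ℕ
open import Data.Nat.Logarithm using (⌊log₂_⌋)
open import Data.Nat.Properties using (_<?_; +-0-commutativeMonoid)
open import Data.Product.Base using (_×_; ∃-syntax; Σ-syntax)
open import Data.Rational.Base using (ℚ; 1/_)
import Data.Rational.Base as ℚ
open import Data.Sum.Base using (_⊎_)
open import Data.Unit.Base using (⊤)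
open import Data.Vec.Base using (lookup; tabulate)
open import Relation.Binary.PropositionalEquality.Core using (_≡_; _≢_)
open import Relation.Nullary.Decidable.Core using (yes; no)

------------------------------------------------------------------------
-- Unsplittable flow on a path

∑ : ∀ {k} → (Fin k → ℕ) → ℕ
∑ = sum +-0-commutativeMonoid

∑[_] : ∀ {k} → Subset k → (Fin k → ℕ) → ℕ
∑[ F ] f = ∑ (λ i → if lookup F i then f i else 0)

-- The vertices are 0 , … , m, and e : Fin m stands for the edge {e , e + 1}.
record UFPP : Set where
  field
    m n        : ℕ
    capacity   : Fin m → ℕ
    start end  : Fin n → Fin (suc m)
    demand     : Fin n → ℕ
    profit     : Fin n → ℕ
    start<end  : ∀ i → toℕ (start i) < toℕ (end i)
    capacity>0 : ∀ e → 0 < capacity e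
    demand>0   : ∀ i → 0 < demand i
    profit>0   : ∀ i → 0 < profit i
    endpoints  : ∀ v → ∃[ i ] (start i ≡ v ⊎ end i ≡ v)

  -- T_e
  tasksUsing : Fin m → Subset n
  tasksUsing e = tabulate λ i →
    (toℕ (start i) ≤ᵇ toℕ e) ∧ (toℕ e <ᵇ toℕ (end i))

  Feasible : Subset n → Set
  Feasible F = ∀ e → ∑[ F ∩ tasksUsing e ] demand ≤ capacity e

  w : Subset n → ℕ
  w F = ∑[ F ] profit

  Optimal : Subset n → Set
  Optimal F = Feasible F × (∀ G → Feasible G → w G ≤ w F)

------------------------------------------------------------------------
-- Programs of a random access machine
--
-- The memory is organised as a family of arrays of natural numbers.  A
-- program mentions only finitely many array names, so that these arrays
-- can be interleaved in the single memory of a RAM with constant overhead;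
-- scalar variables are arrays of which only cell 0 is used.

State : Set
State = ℕ → ℕ → ℕ

data Op : Set where
  plus monus times quot : Op

infix 9 _at_

data Expr : Set where
  const : ℕ → Expr
  _at_  : ℕ → Expr → Expr
  op    : Op → Expr → Expr → Expr

infix  6 _at_≔_
infixr 5 _⨾_

data Cmd : Set where
  skip    : Cmd
  _at_≔_  : ℕ → Expr → Expr → Cmd
  _⨾_     : Cmd → Cmd → Cmd
  if      : Expr → Cmd → Cmd → Cmd
  while   : Expr → Cmd → Cmd

-- Subtraction is truncated at 0 and division rounds down, with x / 0 = 0.
⟦_⟧op : Op → ℕ → ℕ → ℕ
⟦ plus  ⟧op x y       = x + y
⟦ monus ⟧op x y       = x ∸ y
⟦ times ⟧op x y       = x * y
⟦ quot  ⟧op x zero    = 0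
⟦ quot  ⟧op x (suc y) = x ℕ./ suc y

⟦_⟧ : Expr → State → ℕ
⟦ const x  ⟧ σ = x
⟦ a at e   ⟧ σ = σ a (⟦ e ⟧ σ)
⟦ op o e f ⟧ σ = ⟦ o ⟧op (⟦ e ⟧ σ) (⟦ f ⟧ σ)

cost : Expr → ℕ
cost (const x)  = 1
cost (a at e)   = 1 + cost e
cost (op o e f) = 1 + cost e + cost f

-- No overflow: all values in the evaluation of the expression, including
-- addresses and intermediate results, fit into a word of b bits.
Fits : ℕ → Expr → State → Set
FitsSub : ℕ → Expr → State → Set
Fits b e σ = ⟦ e ⟧ σ < 2 ^ b × FitsSub b e σ
FitsSub b (const x)  σ = ⊤
FitsSub b (a at e)   σ = Fits b e σ
FitsSub b (op o e f) σ = Fits b e σ × Fits b f σ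

_[_at_≔_] : State → ℕ → ℕ → ℕ → State
(σ [ a at i ≔ x ]) a′ i′ = if (a′ ≡ᵇ a) ∧ (i′ ≡ᵇ i) then x else σ a′ i′

-- b ⊢⟨ c , σ ⟩⇓⟨ σ′ , t ⟩ : on a machine with words of b bits, c started
-- in σ halts in σ′ after t unit-cost steps.  Overflow leaves the machine
-- stuck.  A test succeeds iff its value is not 0.  The program c is
-- independent of b, and execution is deterministic: σ′ and t depend only
-- on c and σ.
infix 4 _⊢⟨_,_⟩⇓⟨_,_⟩

data _⊢⟨_,_⟩⇓⟨_,_⟩ (b : ℕ) : Cmd → State → State → ℕ → Set where
  skip⇓ : ∀ {σ} → b ⊢⟨ skip , σ ⟩⇓⟨ σ , 1 ⟩

  store⇓ : ∀ {a e f σ} → Fits b e σ → Fits b f σ →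
           b ⊢⟨ a at e ≔ f , σ ⟩⇓⟨ σ [ a at ⟦ e ⟧ σ ≔ ⟦ f ⟧ σ ]
                                 , 1 + cost e + cost f ⟩

  seq⇓ : ∀ {c₁ c₂ σ σ₁ σ₂ t₁ t₂} →
         b ⊢⟨ c₁ , σ ⟩⇓⟨ σ₁ , t₁ ⟩ → b ⊢⟨ c₂ , σ₁ ⟩⇓⟨ σ₂ , t₂ ⟩ →
         b ⊢⟨ c₁ ⨾ c₂ , σ ⟩⇓⟨ σ₂ , t₁ + t₂ ⟩

  if⇓true : ∀ {e c₁ c₂ σ σ₁ t} → Fits b e σ → ⟦ e ⟧ σ ≢ 0 →
            b ⊢⟨ c₁ , σ ⟩⇓⟨ σ₁ , t ⟩ →
            b ⊢⟨ if e c₁ c₂ , σ ⟩⇓⟨ σ₁ , 1 + cost e + t ⟩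

  if⇓false : ∀ {e c₁ c₂ σ σ₁ t} → Fits b e σ → ⟦ e ⟧ σ ≡ 0 →
             b ⊢⟨ c₂ , σ ⟩⇓⟨ σ₁ , t ⟩ →
             b ⊢⟨ if e c₁ c₂ , σ ⟩⇓⟨ σ₁ , 1 + cost e + t ⟩

  while⇓true : ∀ {e c σ σ₁ σ₂ t₁ t₂} → Fits b e σ → ⟦ e ⟧ σ ≢ 0 →
               b ⊢⟨ c , σ ⟩⇓⟨ σ₁ , t₁ ⟩ → b ⊢⟨ while e c , σ₁ ⟩⇓⟨ σ₂ , t₂ ⟩ →
               b ⊢⟨ while e c , σ ⟩⇓⟨ σ₂ , 1 + cost e + t₁ + t₂ ⟩

  while⇓false : ∀ {e c σ} → Fits b e σ → ⟦ e ⟧ σ ≡ 0 →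
                b ⊢⟨ while e c , σ ⟩⇓⟨ σ , 1 + cost e ⟩

------------------------------------------------------------------------
-- Input and output

array : ∀ {k} → (Fin k → ℕ) → ℕ → ℕ
array {k} f j with j <? k
... | yes j<k = f (fromℕ< j<k)
... | no  _   = 0

bits : ℕ → ℕ
bits x = suc ⌊log₂ x ⌋

module _ (I : UFPP) where
  open UFPP I

  initial : State
  initial 0 0 = n
  initial 0 1 = m
  initial 1   = array capacity
  initial 2   = array (λ i → toℕ (start i))
  initial 3   = array (λ i → toℕ (end i))
  initial 4   = array demand
  initial 5   = array profit
  initial _ _ = 0

  -- Task i is selected iff cell i of array 6 is not 0.
  output : State → Subset n
  output σ = tabulate λ i → not (σ 6 (toℕ i) ≡ᵇ 0)

  -- Number of bits in the binary encoding of the instance.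
  inputLength : ℕ
  inputLength = bits n + bits m + ∑ (λ e → bits (capacity e))
    + ∑ (λ i → bits (toℕ (start i)) + bits (toℕ (end i))
             + bits (demand i) + bits (profit i))

record Run (c : Cmd) (I : UFPP) : Set where
  field
    wordLength : ℕ
    final      : State
    time       : ℕ
    execution  : wordLength ⊢⟨ c , initial I ⟩⇓⟨ final , time ⟩

------------------------------------------------------------------------
-- Approximation guarantee and running time

IsApproximationAlgorithm : (α : ℚ) .{{_ : ℚ.NonZero α}} → Cmd → Set
IsApproximationAlgorithm α c = ∀ I → let open UFPP I in
  Σ[ r ∈ Run c I ] let F = output I (Run.final r) in
    Feasible F ×
    (∀ G → Optimal G → 1/ α ℚ.* (+ w G ℚ./ 1) ℚ.≤ + w F ℚ./ 1)

_∈O_ : (ℕ → ℕ) → (ℕ → ℕ) → Set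
f ∈O g = ∃[ C ] ∃[ n₀ ] ∀ n → n₀ ≤ n → f n ≤ C * g n

-- The running time is measured in the number n of tasks only, whatever the
-- magnitude of the capacities, demands and profits.  As usual for such
-- strongly polynomial bounds, every arithmetic operation takes one step,
-- and the numbers that occur must have length polynomial in the length of
-- the input; otherwise unit-cost multiplication would be unrealistically
-- powerful.
HasRunningTimeO : (ℕ → ℕ) → Cmd → Set
HasRunningTimeO g c = ∃[ T ] ∃[ k ] T ∈O g ×
  (∀ I → Σ[ r ∈ Run c I ]
    Run.time r ≤ T (UFPP.n I) ×
    Run.wordLength r ≤ k * inputLength I ^ k)

{-# OPTIONS --safe #-}
-- Call a task small if its demand is at most half of its bottleneck
-- capacity, and large otherwise.
--
-- Small tasks: local ratio.  Process the tasks by decreasing bottleneck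
-- capacity; processing j lowers the weight of every overlapping task i by
-- w j * d i / (b j − d j).  The remaining tasks of a feasible set that
-- overlap j all use one of three edges of capacity at most b j, namely the
-- bottleneck of j and the nearest bottlenecks on its two sides, so the set
-- loses at most 6 w j; a set of remaining tasks that blocks j loses at
-- least w j.  Adding the tasks greedily in reverse order is thus a
-- 6-approximation.
--
-- Large tasks: draw task i as a rectangle of height d i hanging from its
-- bottleneck edge at height b i.  A feasible set of large tasks is a union
-- of 10 sets of disjoint rectangles, and disjoint rectangles are feasible.
-- In such a set the rectangle with the lowest bottom is the only one
-- crossing its bottleneck edge, and every rectangle outside that crosses
-- this edge lies entirely below the others.  Hence a heaviest disjoint set
-- is found by a dynamic program over pairs of rectangles which splits at
-- the lowest bottom.  The better of the two solutions is within a factor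
-- 16 of the optimum.
module Submission where

open import Defs
open import Data.Bool.Base using (Bool; true; false; T; _∧_; _∨_; not; if_then_else_)
open import Data.Bool.Properties using (∧-comm; ∧-identityʳ; ∧-zeroʳ; ∨-comm; ∨-identityʳ)
open import Data.Fin.Base using (Fin; toℕ; fromℕ<)
import Data.Fin.Base as Fin
open import Data.Fin.Properties using (toℕ<n; toℕ-fromℕ<; fromℕ<-toℕ; injective⇒≤; splitAt-join)
open import Data.Fin.Subset using (Subset)
import Data.Fin.Subset as Subset
import Data.Integer.Base as ℤ
import Data.Integer.Properties as ℤ
open import Data.List.Base using (List; []; _∷_)
open import Data.List.Relation.Unary.All using (All; []; _∷_)
open import Data.Nat.Base hiding (_/_)
open import Data.Nat.DivMod using (m/n≤m)
open import Data.Nat.Logarithm using (⌊log₂_⌋; ⌈log₂_⌉; ⌊log₂⌋-mono-≤; ⌊log₂[2^n]⌋≡n; ⌈log₂⌉-mono-≤; ⌈log₂2^n⌉≡n)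
open import Data.Nat.Properties
open import Algebra.Properties.CommutativeSemigroup +-commutativeSemigroup using (interchange)
open import Data.Nat.Solver using (module +-*-Solver)
open import Data.Product.Base using (Σ-syntax; ∃-syntax; _×_; _,_; proj₁; proj₂)
open import Data.Rational.Base using (_/_)
import Data.Rational.Base as ℚ
import Data.Rational.Properties as ℚ
import Data.Rational.Unnormalised.Base as ℚᵘ
import Data.Rational.Unnormalised.Properties as ℚᵘ
open import Data.Sum.Base using (_⊎_; inj₁; inj₂)
open import Data.Unit.Base using (tt)
open import Data.Vec.Base using (lookup)
open import Data.Vec.Properties using (lookup-zipWith; lookup∘tabulate)
open import Function.Base using (_∘_; flip; case_of_)
open import Relation.Binary.Definitions using (Total; Transitive; tri<; tri≈; tri>)
open import Relation.Binary.PropositionalEquality hiding ([_])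
open import Relation.Nullary.Decidable.Core using (yes; no)
open import Relation.Nullary.Negation using (¬_; contradiction)

-- The bounds concern an explicit machine program with bounded words, and this shapes the proof in
-- three ways. Programs are built from loops whose limits are read from the input, so they denote
-- total functions on memories. Correctness is shown for these functions, and one generic argument
-- turns every well-formed program into a machine run whose time and word length are bounded through
-- the loop limits. The division by `b j − d j` in the local ratio would leave the integers; each
-- reducing round multiplies all weights by `b j − d j` instead, so a number gains one input factor
-- per round and its length stays polynomial. Finally, the subproblems of the dynamic program are
-- not put in any order: the whole table is swept n times, and r sweeps settle all sets of at most r
-- rectangles. With about n² pairs and n candidate splits per pair this gives the fourth power. The
-- constant 16 is 6 + 2 · 5: within a feasible set of large tasks the conflicts are the union of a
-- graph that needs 2 colours and one that needs 5.

-- Booleans and comparisons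

∧-split : ∀ {x y} → x ∧ y ≡ true → x ≡ true × y ≡ true
∧-split {true} {true} _ = refl , refl

∧-join : ∀ {x y} → x ≡ true → y ≡ true → x ∧ y ≡ true
∧-join refl refl = refl

∨-false : ∀ {x y} → x ∨ y ≡ false → x ≡ false × y ≡ false
∨-false {false} {false} _ = refl , refl

clash : ∀ {A : Set} {b} → b ≡ false → b ≡ true → A
clash refl ()

∨-elim : ∀ x {y} → x ∨ y ≡ true → x ≡ true ⊎ y ≡ true
∨-elim true  _ = inj₁ refl
∨-elim false h = inj₂ h

∨-introˡ : ∀ {x y} → x ≡ true → x ∨ y ≡ true
∨-introˡ refl = refl

∨-introʳ : ∀ x {y} → y ≡ true → x ∨ y ≡ true
∨-introʳ true  refl = refl
∨-introʳ false refl = refl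

not-true : ∀ {x} → not x ≡ true → x ≡ false
not-true {false} _ = refl

≤ᵇ-sound : ∀ {x y} → (x ≤ᵇ y) ≡ true → x ≤ y
≤ᵇ-sound {x} {y} h = ≤ᵇ⇒≤ x y (subst T (sym h) tt)

<ᵇ-sound : ∀ {x y} → (x <ᵇ y) ≡ true → x < y
<ᵇ-sound {x} {y} h = <ᵇ⇒< x y (subst T (sym h) tt)

T-true : ∀ {x} → T x → x ≡ true
T-true {true} _ = refl

≤ᵇ-complete : ∀ {x y} → x ≤ y → (x ≤ᵇ y) ≡ true
≤ᵇ-complete = T-true ∘ ≤⇒≤ᵇ

<ᵇ-complete : ∀ {x y} → x < y → (x <ᵇ y) ≡ true
<ᵇ-complete = T-true ∘ <⇒<ᵇ

≡ᵇ-sound : ∀ {x y} → (x ≡ᵇ y) ≡ true → x ≡ y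
≡ᵇ-sound {x} {y} h = ≡ᵇ⇒≡ x y (subst T (sym h) tt)

≡ᵇ-refl : ∀ x → (x ≡ᵇ x) ≡ true
≡ᵇ-refl x = T-true (≡⇒≡ᵇ x x refl)

≡ᵇ-≢ : ∀ {x y} → x ≢ y → (x ≡ᵇ y) ≡ false
≡ᵇ-≢ {x} {y} x≢y with x ≡ᵇ y in eq
... | true  = contradiction (≡ᵇ-sound eq) x≢y
... | false = refl

-- Structured programs

infix  6 _[_]≔_
infixr 5 _⨟_

-- for v i c p runs p with v = x ∸ 1 , … , 1 , 0, where x is c plus the
-- content of cell i of array 0.
data Prog : Set where
  _[_]≔_ : ℕ → Expr → Expr → Prog
  _⨟_    : Prog → Prog → Prog
  when   : Expr → Prog → Prog
  for    : ℕ → ℕ → ℕ → Prog → Prog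

limit : ℕ → ℕ → Expr
limit i c = op plus (0 at const i) (const c)

compile : Prog → Cmd
compile (a [ e ]≔ f)  = a at e ≔ f
compile (p ⨟ q)       = compile p ⨾ compile q
compile (when e p)    = if e (compile p) skip
compile (for v i c p) = (v at const 0 ≔ limit i c) ⨾
  while (v at const 0)
    ((v at const 0 ≔ op monus (v at const 0) (const 1)) ⨾ compile p)

branch : ℕ → State → State → State
branch zero    σ τ = τ
branch (suc _) σ τ = σ

-- The recursion counts by itself and never rereads `v`. The compiled loop tests the cell, and the
-- two agree because a well-formed body does not write `v`.
countdown : ℕ → (State → State) → ℕ → State → State
countdown v f zero    σ = σ
countdown v f (suc k) σ = countdown v f k (f (σ [ v at 0 ≔ k ]))

sem : Prog → State → State
sem (a [ e ]≔ f)  σ = σ [ a at ⟦ e ⟧ σ ≔ ⟦ f ⟧ σ ]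
sem (p ⨟ q)       σ = sem q (sem p σ)
sem (when e p)    σ = branch (⟦ e ⟧ σ) (sem p σ) σ
sem (for v i c p) σ =
  countdown v (sem p) (σ 0 i + c) (σ [ v at 0 ≔ σ 0 i + c ])

-- Purely syntactic, so that for a concrete program it evaluates and frame conditions are proved by
-- `refl`.
writes : ℕ → Prog → Bool
writes x (a [ e ]≔ f)  = x ≡ᵇ a
writes x (p ⨟ q)       = writes x p ∨ writes x q
writes x (when e p)    = writes x p
writes x (for v i c p) = (x ≡ᵇ v) ∨ writes x p

update-other : ∀ σ {x a} i y → (x ≡ᵇ a) ≡ false → ∀ j → (σ [ a at i ≔ y ]) x j ≡ σ x j
update-other σ i y h j rewrite h = refl

update-cell : ∀ σ a i y → (σ [ a at i ≔ y ]) a i ≡ y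
update-cell σ a i y rewrite ≡ᵇ-refl a | ≡ᵇ-refl i = refl

update-other-cell : ∀ σ a {i j} y → j ≢ i → (σ [ a at i ≔ y ]) a j ≡ σ a j
update-other-cell σ a y j≢i rewrite ≡ᵇ-refl a | ≡ᵇ-≢ j≢i = refl

Frame : Prog → State → State → Set
Frame p σ τ = ∀ {x} → writes x p ≡ false → ∀ j → τ x j ≡ σ x j

frame : ∀ p σ → Frame p σ (sem p σ)
countdown-frame : ∀ v p k σ {x} → (x ≡ᵇ v) ≡ false → writes x p ≡ false → ∀ j →
                  countdown v (sem p) k σ x j ≡ σ x j

frame (a [ e ]≔ f) σ h j = update-other σ (⟦ e ⟧ σ) (⟦ f ⟧ σ) h j
frame (p ⨟ q) σ h j =
  let h₁ , h₂ = ∨-false h in trans (frame q (sem p σ) h₂ j) (frame p σ h₁ j)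
frame (when e p) σ h j with ⟦ e ⟧ σ
... | zero  = refl
... | suc _ = frame p σ h j
frame (for v i c p) σ h j =
  let h₁ , h₂ = ∨-false h in
  trans (countdown-frame v p (σ 0 i + c) _ h₁ h₂ j) (update-other σ 0 _ h₁ j)

countdown-frame v p zero    σ h₁ h₂ j = refl
countdown-frame v p (suc k) σ h₁ h₂ j =
  trans (countdown-frame v p k _ h₁ h₂ j)
    (trans (frame p _ h₂ j) (update-other σ 0 k h₁ j))

-- Counters run downwards: `I k` describes the moment when the indices k , ... , N - 1 have been
-- treated. `Fr` carries what the whole loop leaves alone, so that invariants mention only what
-- changes.
Step : ℕ → Prog → ℕ → (State → Set) → (ℕ → State → Set) → Set
Step v p N Fr I = ∀ k τ → k < N → Fr τ → I (suc k) τ → I k (sem p (τ [ v at 0 ≔ k ]))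

Hit : ℕ → List Expr → Prog → ℕ → (State → Set) → (ℕ → State → Set) → Set
Hit v es p N Fr I = ∀ k τ → k < N → Fr τ → I (suc k) τ →
  All (λ e → ⟦ e ⟧ (τ [ v at 0 ≔ k ]) ≢ 0) es → I k (sem p (τ [ v at 0 ≔ k ]))

Miss : ℕ → List Expr → ℕ → (State → Set) → (ℕ → State → Set) → Set
Miss v es N Fr I = ∀ k τ → k < N → Fr τ → I (suc k) τ →
  ¬ All (λ e → ⟦ e ⟧ (τ [ v at 0 ≔ k ]) ≢ 0) es → I k (τ [ v at 0 ≔ k ])

for-rule : ∀ v i c p σ {N} → σ 0 i + c ≡ N → (I : ℕ → State → Set) →
  I N (σ [ v at 0 ≔ N ]) →
  Step v p N (Frame (for v i c p) σ) I →
  I 0 (sem (for v i c p) σ)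
for-rule v i c p σ refl I start step = go _ _ ≤-refl (λ h → fr₀ h) start
  where
  N = σ 0 i + c
  fr₀ : Frame (for v i c p) σ (σ [ v at 0 ≔ N ])
  fr₀ h j = update-other σ 0 N (proj₁ (∨-false h)) j
  go : ∀ k τ → k ≤ N → Frame (for v i c p) σ τ → I k τ → I 0 (countdown v (sem p) k τ)
  go zero    τ _  _  ih = ih
  go (suc k) τ le fr ih =
    go k (sem p (τ [ v at 0 ≔ k ])) (<⇒≤ le)
      (λ h j → trans (frame p _ (proj₂ (∨-false h)) j)
        (trans (update-other τ 0 k (proj₁ (∨-false h)) j) (fr h j)))
      (step k τ le fr ih)

when-rule : ∀ e p σ (Q : State → Set) →
  (⟦ e ⟧ σ ≢ 0 → Q (sem p σ)) → (⟦ e ⟧ σ ≡ 0 → Q σ) → Q (sem (when e p) σ)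
when-rule e p σ Q yes′ no′ with ⟦ e ⟧ σ
... | zero  = no′ refl
... | suc _ = yes′ λ ()

whenAll : List Expr → Prog → Prog
whenAll []       p = p
whenAll (e ∷ es) p = when e (whenAll es p)

whenAll-rule : ∀ es p σ (Q : State → Set) →
  (All (λ e → ⟦ e ⟧ σ ≢ 0) es → Q (sem p σ)) →
  (¬ All (λ e → ⟦ e ⟧ σ ≢ 0) es → Q σ) → Q (sem (whenAll es p) σ)
whenAll-rule []       p σ Q yes′ no′ = yes′ []
whenAll-rule (e ∷ es) p σ Q yes′ no′ = when-rule e (whenAll es p) σ Q
  (λ e≢0 → whenAll-rule es p σ Q (yes′ ∘ (e≢0 ∷_)) (λ ¬es → no′ λ { (_ ∷ h) → ¬es h }))
  (λ e≡0 → no′ λ { (e≢0 ∷ _) → e≢0 e≡0 })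

guarded-for-rule : ∀ v i c es p σ {N} → σ 0 i + c ≡ N → (I : ℕ → State → Set) →
  let Fr = Frame (for v i c (whenAll es p)) σ in
  I N (σ [ v at 0 ≔ N ]) → Hit v es p N Fr I → Miss v es N Fr I →
  I 0 (sem (for v i c (whenAll es p)) σ)
guarded-for-rule v i c es p σ eq I start hit miss =
  for-rule v i c (whenAll es p) σ eq I start λ k τ k<N fr ih →
    whenAll-rule es p (τ [ v at 0 ≔ k ]) (I k) (hit k τ k<N fr ih) (miss k τ k<N fr ih)

-- Resources

-- The value of an input expression depends on the memory only through
-- cells of the (never overwritten) input arrays 0 , … , 5.
isInput : Expr → Bool
isInput (const c)  = c ≤ᵇ 7
isInput (a at e)   = a ≤ᵇ 5
isInput (op _ e f) = isInput e ∧ isInput f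

-- Every product has an input factor, so that one step multiplies the
-- largest number in the memory by a bounded power of the largest input:
-- the length of the numbers grows only linearly with the running time.
isLinear : Expr → Bool
isLinear (const c)      = c ≤ᵇ 7
isLinear (a at e)       = isLinear e
isLinear (op times e f) = isLinear e ∧ isLinear f ∧ isInput f
isLinear (op _ e f)     = isLinear e ∧ isLinear f

-- Input arrays stay intact, and every loop limit is a cell of array 0 plus at most 2, so the input
-- bounds all iteration counts. Constants are at most 7 in order that a base of at least 8 dominates
-- them.
wellFormed : Prog → Bool
wellFormed (a [ e ]≔ f)  = (5 <ᵇ a) ∧ isLinear e ∧ isLinear f
wellFormed (p ⨟ q)       = wellFormed p ∧ wellFormed q
wellFormed (when e p)    = isLinear e ∧ wellFormed p
wellFormed (for v i c p) =
  (5 <ᵇ v) ∧ (i ≤ᵇ 7) ∧ (c ≤ᵇ 2) ∧ not (writes v p) ∧ wellFormed p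

inputs-unwritten : ∀ p → wellFormed p ≡ true → ∀ x → x ≤ 5 → writes x p ≡ false
inputs-unwritten (a [ e ]≔ f) h x x≤5 =
  ≡ᵇ-≢ (<⇒≢ (≤-<-trans x≤5 (<ᵇ-sound {5} {a} (proj₁ (∧-split h)))))
inputs-unwritten (p ⨟ q) h x x≤5
  rewrite inputs-unwritten p (proj₁ (∧-split h)) x x≤5 = inputs-unwritten q (proj₂ (∧-split h)) x x≤5
inputs-unwritten (when e p) h x x≤5 = inputs-unwritten p (proj₂ (∧-split h)) x x≤5
inputs-unwritten (for v i c p) h x x≤5
  rewrite ≡ᵇ-≢ (<⇒≢ (≤-<-trans x≤5 (<ᵇ-sound {5} {v} (proj₁ (∧-split h))))) =
  inputs-unwritten p
    (proj₂ (∧-split {not (writes v p)} (proj₂ (∧-split {c ≤ᵇ 2} (proj₂ (∧-split {i ≤ᵇ 7} (proj₂ (∧-split {5 <ᵇ v} h)))))))) x x≤5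

-- A loop pays 6 for storing its limit and 3 for the last, failing test; each iteration pays 3 for
-- its test and 6 for the decrement. The 2 in `when` covers the branch and a possible `skip`.
maxTime : Prog → ℕ → ℕ
maxTime (a [ e ]≔ f)  N = 1 + cost e + cost f
maxTime (p ⨟ q)       N = maxTime p N + maxTime q N
maxTime (when e p)    N = 2 + cost e + maxTime p N
maxTime (for v i c p) N = 9 + N * (9 + maxTime p N)

-- Numbers are measured by exponents of `Y`: if all cells are at most `Y ^ z` before a program runs,
-- they are at most `Y ^ (z + maxTime p N)` afterwards. A time bound is thereby also a bound on the
-- word length, with `E` the largest exponent allowed.
module Execution (Y N b E : ℕ) (8≤Y : 8 ≤ Y) (word : Y ^ E < 2 ^ b) where

  Inputs : State → Set
  Inputs σ = (∀ a i → a ≤ 5 → σ a i ≤ Y) × (∀ i → σ 0 i + 2 ≤ N)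

  record Cells (z : ℕ) (σ : State) : Set where
    constructor bounded
    field bound : ∀ a i → σ a i ≤ Y ^ z
  open Cells

  instance
    Y≢0 : NonZero Y
    Y≢0 = >-nonZero (≤-trans (s≤s z≤n) 8≤Y)

  const≤Y : ∀ {c} → (c ≤ᵇ 7) ≡ true → c ≤ Y
  const≤Y {c} h = ≤-trans (≤ᵇ-sound {c} {7} h) (≤-trans (n≤1+n 7) 8≤Y)

  Y≤Y^suc : ∀ z → Y ≤ Y ^ suc z
  Y≤Y^suc z = m≤m*n Y (Y ^ z) {{m^n≢0 Y z}}

  +≤Y* : ∀ {x y} {c} → x ≤ c → y ≤ c → x + y ≤ Y * c
  +≤Y* {x} {y} {c} h₁ h₂ = begin
    x + y       ≤⟨ +-mono-≤ h₁ h₂ ⟩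
    c + c       ≡⟨ cong (c +_) (+-identityʳ c) ⟨
    2 * c       ≤⟨ *-monoˡ-≤ c (≤-trans (s≤s (s≤s z≤n)) 8≤Y) ⟩
    Y * c       ∎ where open ≤-Reasoning

  quot≤ : ∀ x y → ⟦ quot ⟧op x y ≤ x
  quot≤ x zero    = z≤n
  quot≤ x (suc y) = m/n≤m x (suc y)

  module _ {σ : State} (inp : Inputs σ) where

    input≤ : ∀ e → isInput e ≡ true → ⟦ e ⟧ σ ≤ Y ^ cost e
    input≤ (const c) h = ≤-trans (const≤Y h) (Y≤Y^suc 0)
    input≤ (a at e)  h = ≤-trans (proj₁ inp a _ (≤ᵇ-sound {a} {5} h)) (Y≤Y^suc (cost e))
    input≤ (op o e f) h = go o
      where
      open ≤-Reasoning
      e≤ = input≤ e (proj₁ (∧-split h))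
      f≤ = input≤ f (proj₂ (∧-split h))
      e≤′ : ⟦ e ⟧ σ ≤ Y ^ (cost e + cost f)
      e≤′ = ≤-trans e≤ (^-monoʳ-≤ Y (m≤m+n (cost e) (cost f)))
      f≤′ : ⟦ f ⟧ σ ≤ Y ^ (cost e + cost f)
      f≤′ = ≤-trans f≤ (^-monoʳ-≤ Y (m≤n+m _ (cost e)))
      weaken : ∀ {x} → x ≤ Y ^ (cost e + cost f) → x ≤ Y ^ suc (cost e + cost f)
      weaken x≤ = ≤-trans x≤ (^-monoʳ-≤ Y (n≤1+n (cost e + cost f)))
      go : ∀ o → ⟦ o ⟧op (⟦ e ⟧ σ) (⟦ f ⟧ σ) ≤ Y ^ suc (cost e + cost f)
      go plus  = +≤Y* {⟦ e ⟧ σ} {⟦ f ⟧ σ} {Y ^ (cost e + cost f)} e≤′ f≤′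
      go monus = weaken (≤-trans (m∸n≤m (⟦ e ⟧ σ) (⟦ f ⟧ σ)) e≤′)
      go times = weaken (≤-trans (*-mono-≤ e≤ f≤) (≤-reflexive (sym (^-distribˡ-+-* Y (cost e) (cost f)))))
      go quot  = weaken (≤-trans (quot≤ (⟦ e ⟧ σ) (⟦ f ⟧ σ)) e≤′)

    module _ {z : ℕ} (1≤z : 1 ≤ z) (cells : Cells z σ) where

      -- Multiplication adds exponents, so two factors taken from the working memory would double z.
      -- The input factor demanded by `isLinear` contributes only its own cost, by `input≤`, and z
      -- enters once.
      linear≤ : ∀ e → isLinear e ≡ true → ⟦ e ⟧ σ ≤ Y ^ (z + cost e)
      linear≤-op : ∀ o e f → ⟦ e ⟧ σ ≤ Y ^ (z + cost e) → ⟦ f ⟧ σ ≤ Y ^ (z + cost f) →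
        (o ≡ times → isInput f ≡ true) → ⟦ op o e f ⟧ σ ≤ Y ^ (z + cost (op o e f))

      linear≤ (const c) h = ≤-trans (const≤Y h)
        (≤-trans (Y≤Y^suc z) (^-monoʳ-≤ Y (≤-reflexive (+-comm 1 z))))
      linear≤ (a at e) h = ≤-trans (bound cells a _) (^-monoʳ-≤ Y (m≤m+n z _))
      linear≤ (op plus e f) h = let h₁ , h₂ = ∧-split h in
        linear≤-op plus e f (linear≤ e h₁) (linear≤ f h₂) λ ()
      linear≤ (op monus e f) h = let h₁ , h₂ = ∧-split h in
        linear≤-op monus e f (linear≤ e h₁) (linear≤ f h₂) λ ()
      linear≤ (op quot e f) h = let h₁ , h₂ = ∧-split h in
        linear≤-op quot e f (linear≤ e h₁) (linear≤ f h₂) λ ()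
      linear≤ (op times e f) h = let h₁ , h₂ = ∧-split h ; h₃ , h₄ = ∧-split h₂ in
        linear≤-op times e f (linear≤ e h₁) (linear≤ f h₃) λ _ → h₄

      linear≤-op o e f e≤ f≤ times⇒ = go o times⇒
        where
        rest : ℕ
        rest = cost e + cost f
        e≤′ : ⟦ e ⟧ σ ≤ Y ^ (z + rest)
        e≤′ = ≤-trans e≤ (^-monoʳ-≤ Y (+-monoʳ-≤ z (m≤m+n _ _)))
        f≤′ : ⟦ f ⟧ σ ≤ Y ^ (z + rest)
        f≤′ = ≤-trans f≤ (^-monoʳ-≤ Y (+-monoʳ-≤ z (m≤n+m _ (cost e))))
        suc-out : Y ^ suc (z + rest) ≤ Y ^ (z + suc rest)
        suc-out = ^-monoʳ-≤ Y (≤-reflexive (sym (+-suc z rest)))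
        weaken : ∀ {x} → x ≤ Y ^ (z + rest) → x ≤ Y ^ (z + suc rest)
        weaken x≤ = ≤-trans x≤ (^-monoʳ-≤ Y (+-monoʳ-≤ z (n≤1+n _)))
        go : ∀ o → (o ≡ times → isInput f ≡ true) →
             ⟦ o ⟧op (⟦ e ⟧ σ) (⟦ f ⟧ σ) ≤ Y ^ (z + suc rest)
        go plus  _ = ≤-trans (+≤Y* e≤′ f≤′) suc-out
        go monus _ = weaken (≤-trans (m∸n≤m (⟦ e ⟧ σ) (⟦ f ⟧ σ)) e≤′)
        go quot  _ = weaken (≤-trans (quot≤ (⟦ e ⟧ σ) (⟦ f ⟧ σ)) e≤′)
        go times h = weaken (≤-trans (*-mono-≤ e≤ (input≤ f (h refl)))
          (≤-reflexive (trans (sym (^-distribˡ-+-* Y (z + cost e) (cost f)))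
            (cong (Y ^_) (+-assoc z (cost e) (cost f))))))

      fits : ∀ e → isLinear e ≡ true → z + cost e ≤ E → Fits b e σ
      fitsSub : ∀ e → isLinear e ≡ true → z + cost e ≤ E → FitsSub b e σ

      fits e h le = ≤-<-trans (≤-trans (linear≤ e h) (^-monoʳ-≤ Y le)) word , fitsSub e h le

      fitsOp : ∀ o e f → isLinear e ≡ true → isLinear f ≡ true →
               z + suc (cost e + cost f) ≤ E → Fits b e σ × Fits b f σ
      fitsOp o e f h₁ h₂ le =
        fits e h₁ (≤-trans (+-monoʳ-≤ z (m≤n⇒m≤1+n (m≤m+n _ _))) le) ,
        fits f h₂ (≤-trans (+-monoʳ-≤ z (m≤n⇒m≤1+n (m≤n+m _ (cost e)))) le)

      fitsSub (const c) h le = tt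
      fitsSub (a at e)  h le = fits e h (≤-trans (+-monoʳ-≤ z (n≤1+n _)) le)
      fitsSub (op plus e f) h le = let h₁ , h₂ = ∧-split h in fitsOp plus e f h₁ h₂ le
      fitsSub (op monus e f) h le = let h₁ , h₂ = ∧-split h in fitsOp monus e f h₁ h₂ le
      fitsSub (op quot e f) h le = let h₁ , h₂ = ∧-split h in fitsOp quot e f h₁ h₂ le
      fitsSub (op times e f) h le = let h₁ , h₂ = ∧-split h ; h₃ , _ = ∧-split h₂ in
        fitsOp times e f h₁ h₃ le

  Inputs-preserved : ∀ {σ τ} → (∀ x → x ≤ 5 → ∀ j → τ x j ≡ σ x j) → Inputs σ → Inputs τ
  Inputs-preserved fr (h₁ , h₂) =
    (λ a i a≤5 → subst (_≤ Y) (sym (fr a a≤5 i)) (h₁ a i a≤5)) ,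
    (λ i → subst (λ x → x + 2 ≤ N) (sym (fr 0 z≤n i)) (h₂ i))

  sem-Inputs : ∀ p σ → wellFormed p ≡ true → Inputs σ → Inputs (sem p σ)
  sem-Inputs p σ h = Inputs-preserved λ x x≤5 → frame p σ (inputs-unwritten p h x x≤5)

  record Executes (p : Prog) (z : ℕ) (σ : State) : Set where
    constructor executes
    field
      time : ℕ
      time≤ : time ≤ maxTime p N
      execution : b ⊢⟨ compile p , σ ⟩⇓⟨ sem p σ , time ⟩
      cells : Cells (z + maxTime p N) (sem p σ)

  Cells-mono : ∀ {y z σ} → y ≤ z → Cells y σ → Cells z σ
  Cells-mono y≤z h .bound a i = ≤-trans (bound h a i) (^-monoʳ-≤ Y y≤z)

  Cells-update : ∀ {z σ} a i x → Cells z σ → x ≤ Y ^ z → Cells z (σ [ a at i ≔ x ])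
  Cells-update a i x h x≤ .bound a′ i′ with (a′ ≡ᵇ a) ∧ (i′ ≡ᵇ i)
  ... | true  = x≤
  ... | false = bound h a′ i′

  execute : ∀ p {z σ} → wellFormed p ≡ true → Inputs σ → 1 ≤ z → Cells z σ →
            z + maxTime p N ≤ E → Executes p z σ
  execute (a [ e ]≔ f) {z} {σ} h inp 1≤z cs le =
    executes _ ≤-refl
      (store⇓ (fits inp 1≤z cs e h₂ (≤-trans (+-monoʳ-≤ z (m≤n⇒m≤1+n (m≤m+n _ _))) le))
              (fits inp 1≤z cs f h₃ f-fits))
      (Cells-update a _ _ (Cells-mono (m≤m+n z _) cs)
        (≤-trans (linear≤ inp 1≤z cs f h₃) (^-monoʳ-≤ Y f≤)))
    where
    h₁ = ∧-split {5 <ᵇ a} h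
    h₂ = proj₁ (∧-split (proj₂ h₁))
    h₃ = proj₂ (∧-split (proj₂ h₁))
    f≤ : z + cost f ≤ z + (1 + cost e + cost f)
    f≤ = +-monoʳ-≤ z (m≤n+m _ (1 + cost e))
    f-fits : z + cost f ≤ E
    f-fits = ≤-trans f≤ le
  execute (p ⨟ q) {z} {σ} h inp 1≤z cs le
    with h₁ , h₂ ← ∧-split h
    with executes t₁ t₁≤ ex₁ cs₁ ← execute p h₁ inp 1≤z cs
           (≤-trans (+-monoʳ-≤ z (m≤m+n _ _)) le)
    with executes t₂ t₂≤ ex₂ cs₂ ← execute q h₂ (sem-Inputs p σ h₁ inp)
           (≤-trans 1≤z (m≤m+n _ _)) cs₁ (≤-trans (≤-reflexive (+-assoc z _ _)) le)
    = executes _ (+-mono-≤ t₁≤ t₂≤) (seq⇓ ex₁ ex₂)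
        (Cells-mono (≤-reflexive (+-assoc z _ _)) cs₂)
  execute (when e p) {z} {σ} h inp 1≤z cs le
    with h₁ , h₂ ← ∧-split h
    with executes t t≤ ex cs′ ← execute p h₂ inp 1≤z cs
           (≤-trans (+-monoʳ-≤ z (m≤n+m _ (2 + cost e))) le)
    with fit ← fits inp 1≤z cs e h₁
           (≤-trans (+-monoʳ-≤ z (≤-trans (n≤1+n _) (≤-trans (n≤1+n _) (m≤m+n (2 + cost e) _)))) le)
    with ⟦ e ⟧ σ ≟ 0
  ... | yes eq = executes (1 + cost e + 1)
          (≤-trans (≤-reflexive (+-comm (1 + cost e) 1)) (m≤m+n (2 + cost e) _))
          (subst (λ τ → b ⊢⟨ compile (when e p) , σ ⟩⇓⟨ τ , 1 + cost e + 1 ⟩) (sym skipped)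
            (if⇓false fit eq skip⇓))
          (subst (Cells _) (sym skipped) (Cells-mono (m≤m+n z _) cs))
    where
    skipped : sem (when e p) σ ≡ σ
    skipped = cong (λ x → branch x (sem p σ) σ) eq
  ... | no ≢0 = executes (1 + cost e + t)
          (≤-trans (+-monoʳ-≤ (1 + cost e) t≤) (n≤1+n _))
          (subst (λ τ → b ⊢⟨ compile (when e p) , σ ⟩⇓⟨ τ , 1 + cost e + t ⟩) (sym taken)
            (if⇓true fit ≢0 ex))
          (subst (Cells _) (sym taken) (Cells-mono (+-monoʳ-≤ z (m≤n+m _ (2 + cost e))) cs′))
    where
    branch-suc : ∀ x → x ≢ 0 → branch x (sem p σ) σ ≡ sem p σ
    branch-suc zero    0≢0 = contradiction refl 0≢0
    branch-suc (suc _) _   = refl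
    taken : sem (when e p) σ ≡ sem p σ
    taken = branch-suc (⟦ e ⟧ σ) ≢0
  execute (for v i c p) {z} {σ} h inp 1≤z cs le
    with hv , h₁ ← ∧-split {5 <ᵇ v} h
    with hi , h₂ ← ∧-split {i ≤ᵇ 7} h₁
    with hc , h₃ ← ∧-split {c ≤ᵇ 2} h₂
    with hw′ , hp ← ∧-split {not (writes v p)} h₃
    = result
    where
    hw = not-true hw′
    B = 9 + maxTime p N
    x = σ 0 i + c
    x≤N : x ≤ N
    x≤N = ≤-trans (+-monoʳ-≤ (σ 0 i) (≤ᵇ-sound {c} {2} hc)) (proj₂ inp i)
    c≤7 : (c ≤ᵇ 7) ≡ true
    c≤7 = ≤ᵇ-complete (≤-trans (≤ᵇ-sound {c} {2} hc) (s≤s (s≤s z≤n)))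
    v≢ : ∀ y → y ≤ 5 → (y ≡ᵇ v) ≡ false
    v≢ y y≤5 = ≡ᵇ-≢ (<⇒≢ (≤-<-trans y≤5 (<ᵇ-sound {5} {v} hv)))
    update-Inputs : ∀ {τ} y → Inputs τ → Inputs (τ [ v at 0 ≔ y ])
    update-Inputs {τ} y = Inputs-preserved λ a a≤5 j → update-other τ 0 y (v≢ a a≤5) j
    -- The 2 is the cost of reading the counter in the last test. An iteration may raise the
    -- exponent by `B`, of which 4 go into evaluating the decrement.
    loop : ∀ k {y τ} → Inputs τ → 1 ≤ y → Cells y τ → τ v 0 ≡ k →
      y + 2 + k * B ≤ E →
      Σ[ t ∈ ℕ ] t ≤ 3 + k * B ×
        b ⊢⟨ while (v at const 0) ((v at const 0 ≔ op monus (v at const 0) (const 1)) ⨾ compile p) , τ ⟩⇓⟨ countdown v (sem p) k τ , t ⟩ ×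
        Cells (y + k * B) (countdown v (sem p) k τ)
    loop zero {y} inpτ 1≤y csτ eq leE =
      3 , ≤-refl ,
      while⇓false (fits inpτ 1≤y csτ (v at const 0) refl (≤-trans (m≤m+n _ _) leE)) eq ,
      Cells-mono (m≤m+n y _) csτ
    loop (suc k) {y} {τ} inpτ 1≤y csτ eq leE =
      let t , t≤ , ex , cs′ = loop k (sem-Inputs p τ′ hp (update-Inputs k inpτ))
                               (≤-trans (≤-trans 1≤y (m≤m+n y _)) (m≤m+n (y + 4) _)) (cells body) v-kept rest≤E
      in _ , (begin
          3 + (6 + time body) + t ≤⟨ +-mono-≤ (+-monoʳ-≤ 3 (+-monoʳ-≤ 6 (time≤ body))) t≤ ⟩
          B + (3 + k * B)         ≡⟨ solve 2 (λ b r → b :+ (con 3 :+ r) := con 3 :+ (b :+ r)) refl B (k * B) ⟩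
          3 + suc k * B           ∎) ,
        while⇓true (fits inpτ 1≤y csτ (v at const 0) refl (≤-trans (m≤m+n _ _) leE))
          (λ τv≡0 → contradiction (trans (sym eq) τv≡0) λ ())
          (seq⇓ store (execution body)) ex ,
        Cells-mono cells≤ cs′
      where
      open ≤-Reasoning
      open Executes
      open +-*-Solver using (solve; con; _:+_; _:=_)
      M : ℕ
      M = maxTime p N
      within : ∀ {l u} c → l + c ≡ u → l ≤ u
      within {l} c e = subst (l ≤_) e (m≤m+n l c)
      y+4≤E : y + 4 ≤ E
      y+4≤E = ≤-trans (within (7 + M + k * B)
        (solve 3 (λ y M r → y :+ con 4 :+ (con 7 :+ M :+ r) := y :+ con 2 :+ ((con 9 :+ M) :+ r)) refl y M (k * B))) leE
      body≤E : y + 4 + M ≤ E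
      body≤E = ≤-trans (within (7 + k * B)
        (solve 3 (λ y M r → y :+ con 4 :+ M :+ (con 7 :+ r) := y :+ con 2 :+ ((con 9 :+ M) :+ r)) refl y M (k * B))) leE
      rest≤E : y + 4 + M + 2 + k * B ≤ E
      rest≤E = ≤-trans (within 5
        (solve 3 (λ y M r → y :+ con 4 :+ M :+ con 2 :+ r :+ con 5 := y :+ con 2 :+ ((con 9 :+ M) :+ r)) refl y M (k * B))) leE
      cells≤ : y + 4 + M + k * B ≤ y + suc k * B
      cells≤ = within 5
        (solve 3 (λ y M r → y :+ con 4 :+ M :+ r :+ con 5 := y :+ ((con 9 :+ M) :+ r)) refl y M (k * B))
      τ′ = τ [ v at 0 ≔ k ]
      k≤ : k ≤ Y ^ (y + 4)
      k≤ = ≤-trans (n≤1+n k) (≤-trans (≤-reflexive (sym eq)) (≤-trans (bound csτ v 0) (^-monoʳ-≤ Y (m≤m+n y 4))))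
      decrement : ⟦ op monus (v at const 0) (const 1) ⟧ τ ≡ k
      decrement = cong (_∸ 1) eq
      store : b ⊢⟨ v at const 0 ≔ op monus (v at const 0) (const 1) , τ ⟩⇓⟨ τ′ , 6 ⟩
      store = subst (λ k → b ⊢⟨ v at const 0 ≔ op monus (v at const 0) (const 1) , τ ⟩⇓⟨ τ [ v at 0 ≔ k ] , 6 ⟩) decrement
        (store⇓ (fits inpτ 1≤y csτ (const 0) refl (≤-trans (+-monoʳ-≤ y (s≤s z≤n)) y+4≤E))
                (fits inpτ 1≤y csτ (op monus (v at const 0) (const 1)) refl y+4≤E))
      body : Executes p (y + 4) τ′
      body = execute p hp (update-Inputs k inpτ) (≤-trans 1≤y (m≤m+n y 4))
        (Cells-update v 0 k (Cells-mono (m≤m+n y 4) csτ) k≤)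
        body≤E
      v-kept : sem p τ′ v 0 ≡ k
      v-kept = trans (frame p τ′ hw 0) (update-cell τ v 0 k)
    limit-linear : isLinear (limit i c) ≡ true
    limit-linear = ∧-join hi c≤7
    z+4 : z + 4 ≤ E
    z+4 = ≤-trans (+-monoʳ-≤ z (≤-trans (s≤s (s≤s (s≤s (s≤s z≤n)))) (m≤m+n 9 _))) le
    Nx≤ : x * B ≤ N * B
    Nx≤ = *-monoˡ-≤ B x≤N
    looped = loop x {z + 4} (update-Inputs x inp) (≤-trans 1≤z (m≤m+n z _))
      (Cells-update v 0 x (Cells-mono (m≤m+n z _) cs) (linear≤ inp 1≤z cs (limit i c) limit-linear))
      (update-cell σ v 0 x)
      (≤-trans (≤-reflexive (trans (cong (_+ x * B) (+-assoc z 4 2)) (+-assoc z 6 _)))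
        (≤-trans (+-monoʳ-≤ z (+-mono-≤ {6} {9} (s≤s (s≤s (s≤s (s≤s (s≤s (s≤s z≤n)))))) Nx≤)) le))
    result : Executes (for v i c p) z σ
    result = let t , t≤ , ex , cs′ = looped in
      executes (6 + t) (+-monoʳ-≤ 6 (≤-trans t≤ (+-monoʳ-≤ 3 Nx≤)))
        (seq⇓ (store⇓ (fits inp 1≤z cs (const 0) refl (≤-trans (+-monoʳ-≤ z (s≤s z≤n)) z+4))
                      (fits inp 1≤z cs (limit i c) limit-linear z+4)) ex)
        (Cells-mono (≤-trans (≤-reflexive (+-assoc z 4 _)) (+-monoʳ-≤ z (+-mono-≤ {4} {9} (s≤s (s≤s (s≤s (s≤s z≤n)))) Nx≤))) cs′)

-- For a literal array name, reading the array after a store to it reduces to this conditional on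
-- the index.
if-cell : ∀ (Q : ℕ → Set) i j {x y} → (i ≡ j → Q x) → (i ≢ j → Q y) → Q (if i ≡ᵇ j then x else y)
if-cell Q i j {x} {y} here there with i ≟ j
... | yes refl = subst (λ b → Q (if b then x else y)) (sym (≡ᵇ-refl i)) (here refl)
... | no i≢j   = subst (λ b → Q (if b then x else y)) (sym (≡ᵇ-≢ i≢j)) (there i≢j)

-- Finite sums

sumTo : ℕ → (ℕ → ℕ) → ℕ
sumTo zero    f = 0
sumTo (suc n) f = sumTo n f + f n

sumTo-cong : ∀ n {f g} → (∀ i → i < n → f i ≡ g i) → sumTo n f ≡ sumTo n g
sumTo-cong zero    h = refl
sumTo-cong (suc n) h = cong₂ _+_ (sumTo-cong n λ i i<n → h i (m≤n⇒m≤1+n i<n)) (h n ≤-refl)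

sumTo-mono : ∀ n {f g} → (∀ i → i < n → f i ≤ g i) → sumTo n f ≤ sumTo n g
sumTo-mono zero    h = z≤n
sumTo-mono (suc n) h = +-mono-≤ (sumTo-mono n λ i i<n → h i (m≤n⇒m≤1+n i<n)) (h n ≤-refl)

sumTo-+ : ∀ n f g → sumTo n (λ i → f i + g i) ≡ sumTo n f + sumTo n g
sumTo-+ zero    f g = refl
sumTo-+ (suc n) f g = trans (cong (_+ (f n + g n)) (sumTo-+ n f g)) (interchange (sumTo n f) _ _ _)

sumTo-* : ∀ n c f → sumTo n (λ i → c * f i) ≡ c * sumTo n f
sumTo-* zero    c f = sym (*-zeroʳ c)
sumTo-* (suc n) c f = trans (cong (_+ c * f n) (sumTo-* n c f)) (sym (*-distribˡ-+ c (sumTo n f) (f n)))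

sumTo-const : ∀ n c → sumTo n (λ _ → c) ≡ n * c
sumTo-const zero    c = refl
sumTo-const (suc n) c = trans (cong (_+ c) (sumTo-const n c)) (+-comm (n * c) c)

sumTo-head : ∀ n f → sumTo (suc n) f ≡ f 0 + sumTo n (f ∘ suc)
sumTo-head zero    f = +-comm 0 (f 0)
sumTo-head (suc n) f = trans (cong (_+ f (suc n)) (sumTo-head n f)) (+-assoc (f 0) _ _)

-- Sets of numbers below n

on : Bool → ℕ → ℕ
on true  x = x
on false x = 0

on≤ : ∀ b x → on b x ≤ x
on≤ true  x = ≤-refl
on≤ false x = z≤n

on-∧ : ∀ a b x → on (a ∧ b) x ≡ on a (on b x)
on-∧ true  b x = refl
on-∧ false b x = refl

on-+ : ∀ b x y → on b (x + y) ≡ on b x + on b y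
on-+ true  x y = refl
on-+ false x y = refl

on-* : ∀ b c x → on b (c * x) ≡ c * on b x
on-* true  c x = refl
on-* false c x = sym (*-zeroʳ c)

on-⊆ : ∀ {a b} x → (a ≡ true → b ≡ true) → on a x ≤ on b x
on-⊆ {false} x h = z≤n
on-⊆ {true}  x h rewrite h refl = ≤-refl

PSet : Set
PSet = ℕ → Bool

_∖_ : PSet → ℕ → PSet
(H ∖ k) i = H i ∧ not (i ≡ᵇ k)

_∩_ : PSet → PSet → PSet
(H ∩ K) i = H i ∧ K i

infixl 8 _∖_
infixl 7 _∩_

∖-⊆ : ∀ {H} k {i} → (H ∖ k) i ≡ true → H i ≡ true × i ≢ k
∖-⊆ {H} k {i} h with H i | i ≡ᵇ k in eq
... | true | false = refl , λ { refl → clash eq (≡ᵇ-refl i) }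

∖-intro : ∀ {H} {k} {i} → H i ≡ true → i ≢ k → (H ∖ k) i ≡ true
∖-intro h i≢k = ∧-join h (cong not (≡ᵇ-≢ i≢k))

module _ (n : ℕ) where

  sumOver : PSet → (ℕ → ℕ) → ℕ
  sumOver H f = sumTo n (λ i → on (H i) (f i))

  size : PSet → ℕ
  size H = sumOver H (λ _ → 1)

  _⊆_ : PSet → PSet → Set
  H ⊆ K = ∀ i → i < n → H i ≡ true → K i ≡ true

  sumOver-mono : ∀ {H f g} → (∀ i → i < n → H i ≡ true → f i ≤ g i) → sumOver H f ≤ sumOver H g
  sumOver-mono {H} {f} {g} h = sumTo-mono n go
    where
    go : ∀ i → i < n → on (H i) (f i) ≤ on (H i) (g i)
    go i i<n with H i in eq
    ... | true  = h i i<n eq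
    ... | false = z≤n

  sumOver-cong : ∀ {H f g} → (∀ i → i < n → H i ≡ true → f i ≡ g i) → sumOver H f ≡ sumOver H g
  sumOver-cong h = ≤-antisym
    (sumOver-mono λ i i<n Hi → ≤-reflexive (h i i<n Hi))
    (sumOver-mono λ i i<n Hi → ≤-reflexive (sym (h i i<n Hi)))

  sumOver-⊆ : ∀ {H K} f → H ⊆ K → sumOver H f ≤ sumOver K f
  sumOver-⊆ f h = sumTo-mono n λ i i<n → on-⊆ (f i) (h i i<n)

  sumOver-ext : ∀ {H K} f → H ⊆ K → K ⊆ H → sumOver H f ≡ sumOver K f
  sumOver-ext f h k = ≤-antisym (sumOver-⊆ f h) (sumOver-⊆ f k)

  sumOver-+ : ∀ H f g → sumOver H (λ i → f i + g i) ≡ sumOver H f + sumOver H g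
  sumOver-+ H f g = trans (sumTo-cong n λ i _ → on-+ (H i) (f i) (g i)) (sumTo-+ n _ _)

  sumOver-* : ∀ H c f → sumOver H (λ i → c * f i) ≡ c * sumOver H f
  sumOver-* H c f = trans (sumTo-cong n λ i _ → on-* (H i) c (f i)) (sumTo-* n c _)

  sumOver-∩ : ∀ H K f → sumOver (H ∩ K) f ≡ sumOver H (λ i → on (K i) (f i))
  sumOver-∩ H K f = sumTo-cong n λ i _ → on-∧ (H i) (K i) (f i)

  sumOver-empty : ∀ {H} f → (∀ i → i < n → H i ≡ false) → sumOver H f ≡ 0
  sumOver-empty {H} f h = trans (sumTo-cong n λ i i<n → cong (λ b → on b (f i)) (h i i<n))
    (trans (sumTo-const n 0) (*-zeroʳ n))

  sumOver-∪ : ∀ {H K L} f → (∀ i → i < n → H i ≡ true → K i ≡ true ⊎ L i ≡ true) →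
              sumOver H f ≤ sumOver K f + sumOver L f
  sumOver-∪ {H} {K} {L} f h = ≤-trans (sumTo-mono n go) (≤-reflexive (sumTo-+ n _ _))
    where
    go : ∀ i → i < n → on (H i) (f i) ≤ on (K i) (f i) + on (L i) (f i)
    go i i<n with H i in eq
    ... | false = z≤n
    ... | true with h i i<n eq
    ...   | inj₁ e rewrite e = m≤m+n (f i) _
    ...   | inj₂ e rewrite e = m≤n+m (f i) _

sumTo-single : ∀ n k x → k < n → sumTo n (λ i → on (i ≡ᵇ k) x) ≡ x
sumTo-single (suc n) k x k<1+n with n ≟ k
... | yes refl rewrite ≡ᵇ-refl n =
  cong (_+ x) (sumOver-empty n (λ _ → x) λ i i<n → ≡ᵇ-≢ (<⇒≢ i<n))
... | no n≢k rewrite ≡ᵇ-≢ n≢k =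
  trans (+-identityʳ _) (sumTo-single n k x (≤∧≢⇒< (s≤s⁻¹ k<1+n) (n≢k ∘ sym)))

module _ {n : ℕ} where

  private
    on-split : ∀ (H : PSet) (f : ℕ → ℕ) k → H k ≡ true → ∀ i →
               on (H i) (f i) ≡ on (i ≡ᵇ k) (f k) + on ((H ∖ k) i) (f i)
    on-split H f k Hk i with i ≟ k
    ... | yes refl rewrite ≡ᵇ-refl k | Hk = sym (+-identityʳ (f k))
    ... | no i≢k rewrite ≡ᵇ-≢ i≢k | ∧-identityʳ (H i) = refl

  sumOver-remove : ∀ {H} f {k} → k < n → H k ≡ true → sumOver n H f ≡ f k + sumOver n (H ∖ k) f
  sumOver-remove {H} f {k} k<n Hk = trans (sumTo-cong n λ i _ → on-split H f k Hk i)
    (trans (sumTo-+ n _ _) (cong (_+ sumOver n (H ∖ k) f) (sumTo-single n k (f k) k<n)))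

  member≤sumOver : ∀ {H} f {k} → k < n → H k ≡ true → f k ≤ sumOver n H f
  member≤sumOver f k<n Hk = subst (f _ ≤_) (sym (sumOver-remove f k<n Hk)) (m≤m+n (f _) _)

  sumOver-∖-absent : ∀ {H} f {k} → H k ≡ false → sumOver n (H ∖ k) f ≡ sumOver n H f
  sumOver-∖-absent {H} f {k} Hk = sumOver-ext n f
    (λ i _ h → proj₁ (∖-⊆ {H} k h))
    (λ i _ h → ∖-intro {H} h λ { refl → clash Hk h })

  ∖-⊆ₙ : ∀ {H} k → _⊆_ n (H ∖ k) H
  ∖-⊆ₙ {H} k i _ h = proj₁ (∖-⊆ {H} k h)

<suc-elim : ∀ {n} (Q : ℕ → Set) → (∀ i → i < n → Q i) → Q n → ∀ i → i < suc n → Q i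
<suc-elim {n} Q below last i i<1+n with i ≟ n
... | yes refl = last
... | no i≢n   = below i (≤∧≢⇒< (s≤s⁻¹ i<1+n) i≢n)

member? : ∀ n (H : PSet) → (Σ[ i ∈ ℕ ] i < n × H i ≡ true) ⊎ (∀ i → i < n → H i ≡ false)
member? zero    H = inj₂ λ i ()
member? (suc n) H with H n in eq
... | true  = inj₁ (n , ≤-refl , eq)
... | false with member? n H
...   | inj₁ (i , i<n , Hi) = inj₁ (i , m≤n⇒m≤1+n i<n , Hi)
...   | inj₂ none = inj₂ (<suc-elim (λ i → H i ≡ false) none eq)

module Extremum (_≼_ : ℕ → ℕ → Set) (≼-total : Total _≼_) (≼-trans : Transitive _≼_) where

  ≼-refl : ∀ x → x ≼ x
  ≼-refl x with ≼-total x x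
  ... | inj₁ h = h
  ... | inj₂ h = h

  extremum : ∀ n (H : PSet) (f : ℕ → ℕ) →
    (Σ[ k ∈ ℕ ] k < n × H k ≡ true × (∀ i → i < n → H i ≡ true → f i ≼ f k))
      ⊎ (∀ i → i < n → H i ≡ false)
  extremum zero    H f = inj₂ λ i ()
  extremum (suc n) H f with extremum n H f | H n in eq
  ... | inj₂ none | false = inj₂ (<suc-elim (λ i → H i ≡ false) none eq)
  ... | inj₂ none | true = inj₁ (n , ≤-refl , eq ,
    <suc-elim (λ i → H i ≡ true → f i ≼ f n) (λ i i<n → clash (none i i<n)) λ _ → ≼-refl (f n))
  ... | inj₁ (k , k<n , Hk , best) | false = inj₁ (k , m≤n⇒m≤1+n k<n , Hk ,
    <suc-elim (λ i → H i ≡ true → f i ≼ f k) best (clash eq))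
  ... | inj₁ (k , k<n , Hk , best) | true with ≼-total (f n) (f k)
  ...   | inj₁ fn≼fk = inj₁ (k , m≤n⇒m≤1+n k<n , Hk ,
    <suc-elim (λ i → H i ≡ true → f i ≼ f k) best λ _ → fn≼fk)
  ...   | inj₂ fk≼fn = inj₁ (n , ≤-refl , eq ,
    <suc-elim (λ i → H i ≡ true → f i ≼ f n) (λ i i<n Hi → ≼-trans (best i i<n Hi) fk≼fn) λ _ → ≼-refl (f n))

open Extremum _≤_ ≤-total ≤-trans public using () renaming (extremum to maximum)
open Extremum _≥_ (flip ≤-total) (flip ≤-trans) public using () renaming (extremum to minimum)

-- Graph colouring

-- Pigeonhole principle: it finds the colour that no neighbour uses.
sumTo-≡0 : ∀ c f → sumTo c f < c → Σ[ q ∈ ℕ ] q < c × f q ≡ 0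
sumTo-≡0 (suc c) f h with f c in eq
... | zero  = c , ≤-refl , eq
... | suc x =
  let q , q<c , fq≡0 = sumTo-≡0 c f (≤-<-trans (m≤m+n _ x) (s≤s⁻¹ (≤-trans (≤-reflexive (cong suc (sym (+-suc _ x)))) h)))
  in q , m≤n⇒m≤1+n q<c , fq≡0

module Colouring (n : ℕ) (adjacent : ℕ → ℕ → Bool)
  (adjacent-sym : ∀ i j → adjacent i j ≡ true → adjacent j i ≡ true) where

  Independent : PSet → Set
  Independent H = ∀ i j → i < n → j < n → H i ≡ true → H j ≡ true → i ≢ j → adjacent i j ≡ false

  -- Degeneracy in the sense of graph theory: every nonempty subset has a member of degree at most c
  -- in it. `k` itself is removed before counting, since `adjacent` may be reflexive.
  Degenerate : ℕ → PSet → Set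
  Degenerate c G = ∀ H → _⊆_ n H G →
    (Σ[ k ∈ ℕ ] k < n × H k ≡ true × size n ((H ∖ k) ∩ adjacent k) ≤ c)
      ⊎ (∀ i → i < n → H i ≡ false)

  Proper : ℕ → PSet → (ℕ → ℕ) → Set
  Proper c H col = (∀ i → i < n → H i ≡ true → col i < suc c) ×
    (∀ i j → i < n → j < n → H i ≡ true → H j ≡ true → i ≢ j → col i ≡ col j → adjacent i j ≡ false)

  sum-classes : ∀ C H (col : ℕ → ℕ) f → (∀ i → i < n → H i ≡ true → col i < C) →
    sumTo C (λ q → sumOver n (H ∩ (λ i → col i ≡ᵇ q)) f) ≡ sumOver n H f
  sum-classes C H col f col<C = trans (exchange C)
      (sumOver-cong n λ i i<n Hi → indicator i (col<C i i<n Hi))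
    where
    below : ℕ → ℕ → ℕ
    below C i = sumTo C (λ q → on (col i ≡ᵇ q) (f i))
    exchange : ∀ C → sumTo C (λ q → sumOver n (H ∩ (λ i → col i ≡ᵇ q)) f) ≡ sumOver n H (below C)
    exchange zero    = sym (sumOver-* n H 0 (λ _ → 0))
    exchange (suc C) = trans (cong₂ _+_ (exchange C) (sumOver-∩ n H _ f)) (sym (sumOver-+ n H _ _))
    swap-≡ᵇ : ∀ x y → (x ≡ᵇ y) ≡ (y ≡ᵇ x)
    swap-≡ᵇ x y with x ≟ y
    ... | yes refl = refl
    ... | no x≢y = trans (≡ᵇ-≢ x≢y) (sym (≡ᵇ-≢ (x≢y ∘ sym)))
    indicator : ∀ i → col i < C → below C i ≡ f i
    indicator i lt = trans (sumTo-cong C λ q _ → cong (λ b → on b (f i)) (swap-≡ᵇ (col i) q))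
      (sumTo-single C (col i) (f i) lt)

  -- Greedy colouring: set a vertex of low degree aside, colour the rest, and give the vertex a
  -- colour that its at most c neighbours leave free among c + 1. The recursion is on the bound s
  -- for the size.
  colouring : ∀ c G → Degenerate c G → ∀ s H → size n H ≤ s → _⊆_ n H G → Σ[ col ∈ (ℕ → ℕ) ] Proper c H col
  colouring c G deg s H size≤ H⊆G with deg H H⊆G
  ... | inj₂ none = (λ _ → 0) , (λ _ _ _ → s≤s z≤n) , λ i j i<n _ Hi → clash (none i i<n) Hi
  colouring c G deg zero H size≤ H⊆G | inj₁ (k , k<n , Hk , _) =
    contradiction (≤-trans (member≤sumOver (λ _ → 1) k<n Hk) size≤) λ ()
  colouring c G deg (suc s) H size≤ H⊆G | inj₁ (k , k<n , Hk , few)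
    with col , bnd , prop ← colouring c G deg s (H ∖ k)
           (s≤s⁻¹ (≤-trans (≤-reflexive (sym (sumOver-remove (λ _ → 1) k<n Hk))) size≤))
           (λ i i<n h → H⊆G i i<n (∖-⊆ₙ {n} {H} k i i<n h))
    with q , q<1+c , unused ← sumTo-≡0 (suc c) (λ q → size n ((H ∖ k) ∩ adjacent k ∩ (λ i → col i ≡ᵇ q)))
           (≤-trans (s≤s (≤-reflexive (sum-classes (suc c) ((H ∖ k) ∩ adjacent k) col (λ _ → 1)
              λ i i<n h → bnd i i<n (proj₁ (∧-split h))))) (s≤s few))
    = col′ , bnd′ , prop′
    where
    col′ : ℕ → ℕ
    col′ i with i ≟ k
    ... | yes _ = q
    ... | no  _ = col i
    bnd′ : ∀ i → i < n → H i ≡ true → col′ i < suc c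
    bnd′ i i<n Hi with i ≟ k
    ... | yes _  = q<1+c
    ... | no i≢k = bnd i i<n (∖-intro {H} Hi i≢k)
    free : ∀ i → i < n → H i ≡ true → i ≢ k → col i ≡ q → adjacent k i ≡ false
    free i i<n Hi i≢k coli with adjacent k i in eq
    ... | false = refl
    ... | true = contradiction
          (≤-trans (member≤sumOver (λ _ → 1) i<n
            (∧-join (∧-join (∖-intro {H} Hi i≢k) eq) (trans (cong (_≡ᵇ q) coli) (≡ᵇ-refl q)))) (≤-reflexive unused))
          λ ()
    sym-false : ∀ i j → adjacent i j ≡ false → adjacent j i ≡ false
    sym-false i j e with adjacent j i in eq
    ... | false = refl
    ... | true = trans (sym (adjacent-sym j i eq)) e
    prop′ : ∀ i j → i < n → j < n → H i ≡ true → H j ≡ true → i ≢ j → col′ i ≡ col′ j → adjacent i j ≡ false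
    prop′ i j i<n j<n Hi Hj i≢j e with i ≟ k | j ≟ k
    ... | yes refl | yes refl = contradiction refl i≢j
    ... | yes refl | no j≢k = free j j<n Hj j≢k (sym e)
    ... | no i≢k | yes refl = sym-false k i (free i i<n Hi i≢k e)
    ... | no i≢k | no j≢k = prop i j i<n j<n (∖-intro {H} Hi i≢k) (∖-intro {H} Hj j≢k) i≢j e

  -- The c + 1 colour classes partition G, so the heaviest class carries at least an average share
  -- of the weight.
  heavy-independent : ∀ c G → Degenerate c G → (f : ℕ → ℕ) →
    Σ[ H ∈ PSet ] _⊆_ n H G × Independent H × sumOver n G f ≤ suc c * sumOver n H f
  heavy-independent c G deg f
    with col , bnd , prop ← colouring c G deg (size n G) G ≤-refl (λ _ _ h → h)
    with maximum (suc c) (λ _ → true) (λ q → sumOver n (G ∩ (λ i → col i ≡ᵇ q)) f)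
  ... | inj₂ none = contradiction (none 0 (s≤s z≤n)) λ ()
  ... | inj₁ (q , _ , _ , best) = G ∩ (λ i → col i ≡ᵇ q) , (λ i _ h → proj₁ (∧-split h)) ,
        (λ i j i<n j<n Hi Hj i≢j → prop i j i<n j<n (proj₁ (∧-split Hi)) (proj₁ (∧-split Hj)) i≢j
           (trans (≡ᵇ-sound (proj₂ (∧-split {G i} Hi))) (sym (≡ᵇ-sound (proj₂ (∧-split {G j} Hj)))))) ,
        (begin
          sumOver n G f ≡⟨ sum-classes (suc c) G col f bnd ⟨
          sumTo (suc c) (λ q → sumOver n (G ∩ (λ i → col i ≡ᵇ q)) f) ≤⟨ sumTo-mono (suc c) (λ q q<1+c → best q q<1+c refl) ⟩
          sumTo (suc c) (λ _ → sumOver n (G ∩ (λ i → col i ≡ᵇ q)) f) ≡⟨ sumTo-const (suc c) _ ⟩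
          suc c * sumOver n (G ∩ (λ i → col i ≡ᵇ q)) f ∎)
    where open ≤-Reasoning

-- Digits in base M. The same arithmetic serves the edge keys, made of capacity and position, and
-- the table addresses, made of row and column.
radix-≤ : ∀ {M x e x′ e′} → e′ < M → x * M + e ≤ x′ * M + e′ → x ≤ x′
radix-≤ {M} {x} {e} {x′} {e′} e′<M le = ≮⇒≥ λ x′<x → <⇒≱ (begin-strict
  x′ * M + e′ <⟨ +-monoʳ-< (x′ * M) e′<M ⟩
  x′ * M + M  ≡⟨ +-comm (x′ * M) M ⟩
  suc x′ * M  ≤⟨ *-monoˡ-≤ M x′<x ⟩
  x * M       ≤⟨ m≤m+n (x * M) e ⟩
  x * M + e   ∎) le
  where open ≤-Reasoning

radix-injective : ∀ {M x e x′ e′} → e < M → e′ < M → x * M + e ≡ x′ * M + e′ → x ≡ x′ × e ≡ e′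
radix-injective {M} {x} {e} {x′} {e′} e<M e′<M eq = x≡x′ , +-cancelˡ-≡ (x * M) e e′ (trans eq (cong (λ y → y * M + e′) (sym x≡x′)))
  where
  x≡x′ : x ≡ x′
  x≡x′ = ≤-antisym (radix-≤ {M} {x} {e} e′<M (≤-reflexive eq)) (radix-≤ {M} {x′} {e′} e<M (≤-reflexive (sym eq)))

-- Tasks, bottleneck edges and feasible sets

record Tasks : Set where
  field
    n m : ℕ
    c s t d : ℕ → ℕ
    anchor : ℕ → ℕ

  -- The edges are ordered by capacity, ties being broken by position.
  key : ℕ → ℕ
  key e = c e * m + e

  field
    s≤anchor : ∀ i → i < n → s i ≤ anchor i
    anchor<t : ∀ i → i < n → anchor i < t i
    t≤m      : ∀ i → i < n → t i ≤ m
    lowest   : ∀ i → i < n → ∀ e → s i ≤ e → e < t i → key (anchor i) ≤ key e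
    d>0      : ∀ i → i < n → 0 < d i

  b : ℕ → ℕ
  b i = c (anchor i)

  bottom : ℕ → ℕ
  bottom i = b i ∸ d i

  uses : ℕ → ℕ → Bool
  uses i e = (s i ≤ᵇ e) ∧ (e <ᵇ t i)

  overlaps : ℕ → ℕ → Bool
  overlaps i j = (s i <ᵇ t j) ∧ (s j <ᵇ t i)

  load : PSet → ℕ → ℕ
  load H e = sumOver n (H ∩ (λ i → uses i e)) d

  Feas : PSet → Set
  Feas H = ∀ e → e < m → load H e ≤ c e

  uses-intro : ∀ {i e} → s i ≤ e → e < t i → uses i e ≡ true
  uses-intro p q = ∧-join (≤ᵇ-complete p) (<ᵇ-complete q)

  uses-elim : ∀ {i e} → uses i e ≡ true → s i ≤ e × e < t i
  uses-elim {i} {e} h = let p , q = ∧-split {s i ≤ᵇ e} h in ≤ᵇ-sound p , <ᵇ-sound q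

  overlaps-intro : ∀ {i j} → s i < t j → s j < t i → overlaps i j ≡ true
  overlaps-intro p q = ∧-join (<ᵇ-complete p) (<ᵇ-complete q)

  overlaps-elim : ∀ {i j} → overlaps i j ≡ true → s i < t j × s j < t i
  overlaps-elim {i} {j} h = let p , q = ∧-split {s i <ᵇ t j} h in <ᵇ-sound p , <ᵇ-sound q

  uses⇒overlaps : ∀ {i j e} → uses i e ≡ true → uses j e ≡ true → overlaps i j ≡ true
  uses⇒overlaps {i} {j} hi hj =
    let si≤ , <ti = uses-elim {i} hi ; sj≤ , <tj = uses-elim {j} hj in
    overlaps-intro {i} {j} (≤-<-trans si≤ <tj) (≤-<-trans sj≤ <ti)

  uses-anchor : ∀ i → i < n → uses i (anchor i) ≡ true
  uses-anchor i i<n = uses-intro {i} (s≤anchor i i<n) (anchor<t i i<n)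

  anchor<m : ∀ i → i < n → anchor i < m
  anchor<m i i<n = <-≤-trans (anchor<t i i<n) (t≤m i i<n)

  key⇒c : ∀ {e e′} → e′ < m → key e ≤ key e′ → c e ≤ c e′
  key⇒c {e} {e′} e′<m = radix-≤ {m} {c e} {e} e′<m

  b≤c : ∀ i e → i < n → uses i e ≡ true → b i ≤ c e
  b≤c i e i<n h = let p , q = uses-elim {i} h in
    key⇒c (<-≤-trans q (t≤m i i<n)) (lowest i i<n e p q)

  Feas-⊆ : ∀ {H G} → _⊆_ n H G → Feas G → Feas H
  Feas-⊆ {H} {G} H⊆G feas e e<m = ≤-trans (sumOver-⊆ n d λ i i<n h →
    let p , q = ∧-split {H i} h in ∧-join (H⊆G i i<n p) q) (feas e e<m)

  common-edge : ∀ {G L e} → Feas G → e < m → _⊆_ n L G →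
    (∀ i → i < n → L i ≡ true → uses i e ≡ true) → sumOver n L d ≤ c e
  common-edge {e = e} feas e<m L⊆G through = ≤-trans
    (sumOver-⊆ n d λ i i<n h → ∧-join (L⊆G i i<n h) (through i i<n h)) (feas e e<m)

  member-fits : ∀ {G i} → Feas G → i < n → G i ≡ true → d i ≤ b i
  member-fits {G} {i} feas i<n Gi = ≤-trans
    (member≤sumOver d i<n (∧-join Gi (uses-anchor i i<n))) (feas (anchor i) (anchor<m i i<n))

  -- Members of L reaching the left end of [x , y) from an anchor before x
  -- all use the last of these anchors.
  left-anchored : ∀ {G L x} → Feas G → _⊆_ n L G →
    (∀ i → i < n → L i ≡ true → anchor i < x × x < t i) →
    (Σ[ k ∈ ℕ ] k < n × L k ≡ true × sumOver n L d ≤ b k) ⊎ (∀ i → i < n → L i ≡ false)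
  left-anchored {L = L} feas L⊆G h with maximum n L anchor
  ... | inj₂ none = inj₂ none
  ... | inj₁ (k , k<n , Lk , best) = inj₁ (k , k<n , Lk ,
    common-edge feas (anchor<m k k<n) L⊆G λ i i<n Li →
      uses-intro {i} (≤-trans (s≤anchor i i<n) (best i i<n Li))
        (<-trans (proj₁ (h k k<n Lk)) (proj₂ (h i i<n Li))))

  right-anchored : ∀ {G L y} → Feas G → _⊆_ n L G →
    (∀ i → i < n → L i ≡ true → y ≤ anchor i × s i < y) →
    (Σ[ k ∈ ℕ ] k < n × L k ≡ true × sumOver n L d ≤ b k) ⊎ (∀ i → i < n → L i ≡ false)
  right-anchored {L = L} feas L⊆G h with minimum n L anchor
  ... | inj₂ none = inj₂ none
  ... | inj₁ (k , k<n , Lk , best) = inj₁ (k , k<n , Lk ,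
    common-edge feas (anchor<m k k<n) L⊆G λ i i<n Li →
      uses-intro {i} (<⇒≤ (<-≤-trans (proj₂ (h i i<n Li)) (proj₁ (h k k<n Lk))))
        (≤-<-trans (best i i<n Li) (anchor<t i i<n)))

-- Local ratio for small tasks

module LocalRatio (A : Tasks) where
  open Tasks A

  overlapping-demand : ∀ {G j} → Feas G → j < n →
    (∀ i → i < n → G i ≡ true → key (anchor i) ≤ key (anchor j)) →
    sumOver n (G ∩ (λ i → overlaps i j)) d ≤ b j + (b j + b j)
  overlapping-demand {G} {j} feas j<n high = ≤-trans
    (sumOver-∪ n {H} {M} {λ i → L i ∨ R i} d classify)
    (+-mono-≤ M≤ (≤-trans (sumOver-∪ n {λ i → L i ∨ R i} {L} {R} d λ i _ h → ∨-elim (L i) h) (+-mono-≤ L≤ R≤)))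
    where
    H M L R : PSet
    H = G ∩ (λ i → overlaps i j)
    M = G ∩ (λ i → uses i (anchor j))
    L = H ∩ (λ i → anchor i <ᵇ s j)
    R = H ∩ (λ i → t j ≤ᵇ anchor i)
    b≤ : ∀ i → i < n → G i ≡ true → b i ≤ b j
    b≤ i i<n Gi = key⇒c (anchor<m j j<n) (high i i<n Gi)
    M≤ : sumOver n M d ≤ b j
    M≤ = feas (anchor j) (anchor<m j j<n)
    H⊆ : ∀ {i} → H i ≡ true → G i ≡ true × s i < t j × s j < t i
    H⊆ {i} h = let p , q = ∧-split {G i} h in p , overlaps-elim {i} {j} q
    L≤ : sumOver n L d ≤ b j
    L≤ with left-anchored {G} {L} {s j} feas (λ i _ h → proj₁ (H⊆ {i} (proj₁ (∧-split {H i} h))))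
             (λ i _ h → let p , q = ∧-split {H i} h in <ᵇ-sound q , proj₂ (proj₂ (H⊆ {i} p)))
    ... | inj₁ (k , k<n , Lk , le) = ≤-trans le (b≤ k k<n (proj₁ (H⊆ {k} (proj₁ (∧-split {H k} Lk)))))
    ... | inj₂ none = ≤-trans (≤-reflexive (sumOver-empty n d none)) z≤n
    R≤ : sumOver n R d ≤ b j
    R≤ with right-anchored {G} {R} {t j} feas (λ i _ h → proj₁ (H⊆ {i} (proj₁ (∧-split {H i} h))))
             (λ i _ h → let p , q = ∧-split {H i} h in ≤ᵇ-sound q , proj₁ (proj₂ (H⊆ {i} p)))
    ... | inj₁ (k , k<n , Lk , le) = ≤-trans le (b≤ k k<n (proj₁ (H⊆ {k} (proj₁ (∧-split {H k} Lk)))))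
    ... | inj₂ none = ≤-trans (≤-reflexive (sumOver-empty n d none)) z≤n
    classify : ∀ i → i < n → H i ≡ true → M i ≡ true ⊎ (L i ∨ R i) ≡ true
    classify i i<n h with anchor i <? s j | t j ≤? anchor i
    ... | yes p | _     = inj₂ (∨-introˡ (∧-join h (<ᵇ-complete p)))
    ... | no _  | yes p = inj₂ (∨-introʳ (L i) (∧-join h (≤ᵇ-complete p)))
    ... | no p  | no q  = inj₁ (∧-join Gi (subst (λ e → uses i e ≡ true) same (uses-anchor i i<n)))
      where
      Gi = proj₁ (H⊆ {i} h)
      -- An anchor of i on the path of j has a key at least that of `anchor j`, by minimality, and
      -- at most that, by `high`. Equal keys mean equal edges because the position is part of the
      -- key.
      same : anchor i ≡ anchor j
      same = proj₂ (radix-injective {m} {b i} {anchor i} {b j} (anchor<m i i<n) (anchor<m j j<n)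
        (≤-antisym (high i i<n Gi) (lowest j j<n (anchor i) (≮⇒≥ p) (≰⇒> q))))

  -- The weight reduction with its denominator `bottom j` cleared: all weights are scaled by it.
  -- Truncation turns a weight that would become negative into 0.
  residual : ℕ → (ℕ → ℕ) → ℕ → ℕ
  residual j w i = w i * bottom j ∸ on (overlaps i j) (w j * d i)

  insert : ℕ → PSet → PSet
  insert j S i = S i ∨ (i ≡ᵇ j)

  -- `positive` is there to be inherited by earlier rounds: a member with positive residual weight
  -- was not affected by truncation, so undoing the reduction restores its weight exactly.
  record Approximates (w : ℕ → ℕ) (R S : PSet) : Set where
    field
      within   : _⊆_ n S R
      positive : ∀ i → i < n → S i ≡ true → 0 < w i
      feasible : Feas S
      ratio    : ∀ G → _⊆_ n G R → Feas G → sumOver n G w ≤ 6 * sumOver n S w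

  open Approximates

  skip-step : ∀ {w R S j} → j < n → w j ≡ 0 → Approximates w (R ∖ j) S → Approximates w R S
  skip-step {w} {R} {S} {j} j<n wj≡0 ap = record
    { within = λ i i<n h → ∖-⊆ₙ {n} {R} j i i<n (within ap i i<n h)
    ; positive = positive ap
    ; feasible = feasible ap
    ; ratio = λ G G⊆R feas → ≤-trans (smaller G)
        (ratio ap (G ∖ j) (λ i i<n h → let p , q = ∖-⊆ {G} j h in ∖-intro {R} (G⊆R i i<n p) q)
          (Feas-⊆ (∖-⊆ₙ {n} {G} j) feas)) }
    where
    smaller : ∀ G → sumOver n G w ≤ sumOver n (G ∖ j) w
    smaller G with G j in eq
    ... | true  = ≤-reflexive (trans (sumOver-remove w j<n eq) (cong (_+ sumOver n (G ∖ j) w) wj≡0))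
    ... | false = ≤-reflexive (sym (sumOver-∖-absent {n} {G} w eq))

  Fits-in : PSet → ℕ → Set
  Fits-in S j = ∀ e → e < m → uses j e ≡ true → load S e + d j ≤ c e

  module _ {w : ℕ → ℕ} {R S : PSet} {j : ℕ} (j<n : j < n) (Rj : R j ≡ true)
    (small : 2 * d j ≤ b j)
    (highest : ∀ i → i < n → R i ≡ true → key (anchor i) ≤ key (anchor j))
    (ap : Approximates (residual j w) (R ∖ j) S) where

    private
      D : ℕ
      D = bottom j
      w′ : ℕ → ℕ
      w′ = residual j w
      d≤D : d j ≤ D
      d≤D = m+n≤o⇒m≤o∸n (d j) (≤-trans (≤-reflexive (cong (d j +_) (sym (+-identityʳ (d j))))) small)
      D+d≡b : D + d j ≡ b j
      D+d≡b = m∸n+n≡m (≤-trans (m≤m+n (d j) _) small)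
      instance
        D≢0 : NonZero D
        D≢0 = >-nonZero (<-≤-trans (d>0 j j<n) d≤D)

      S-avoids : S j ≡ false
      S-avoids with S j in eq
      ... | false = refl
      ... | true = contradiction refl (proj₂ (∖-⊆ {R} j (within ap j j<n eq)))

      expand : ∀ G → sumOver n G (λ i → w′ i + on (overlaps i j) (w j * d i)) ≡
               sumOver n G w′ + w j * sumOver n (G ∩ (λ i → overlaps i j)) d
      expand G = trans (sumOver-+ n G w′ _) (cong (sumOver n G w′ +_)
        (trans (sym (sumOver-∩ n G (λ i → overlaps i j) (λ i → w j * d i)))
          (sumOver-* n (G ∩ (λ i → overlaps i j)) (w j) d)))

      scaled : ∀ G → D * sumOver n G w ≡ sumOver n G (λ i → w i * D)
      scaled G = trans (sym (sumOver-* n G D w)) (sumOver-cong n λ i _ _ → *-comm D (w i))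

      charge : ∀ G → D * sumOver n G w ≤ sumOver n G w′ + w j * sumOver n (G ∩ (λ i → overlaps i j)) d
      charge G = begin
        D * sumOver n G w                                         ≡⟨ scaled G ⟩
        sumOver n G (λ i → w i * D)                               ≤⟨ sumOver-mono n (λ i _ _ → m≤n+m∸n (w i * D) (on (overlaps i j) (w j * d i))) ⟩
        sumOver n G (λ i → on (overlaps i j) (w j * d i) + w′ i)   ≡⟨ sumOver-cong n (λ i _ _ → +-comm (on (overlaps i j) _) (w′ i)) ⟩
        sumOver n G (λ i → w′ i + on (overlaps i j) (w j * d i))   ≡⟨ expand G ⟩
        sumOver n G w′ + w j * sumOver n (G ∩ (λ i → overlaps i j)) d ∎
        where open ≤-Reasoning

      j-overlaps : overlaps j j ≡ true
      j-overlaps = uses⇒overlaps {j} {j} (uses-anchor j j<n) (uses-anchor j j<n)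

      -- As j is small, `b j` = D + `d j` is at most 2 D. Three edges of capacity at most `b j`
      -- therefore carry at most 6 D, which is the origin of the factor 6.
      6D : ∀ y x → y + x ≤ b j + (b j + b j) → x + y ≤ 6 * D
      6D y x h = begin
        x + y                       ≡⟨ +-comm x y ⟩
        y + x                       ≤⟨ h ⟩
        b j + (b j + b j)           ≡⟨ cong (λ z → z + (z + z)) D+d≡b ⟨
        D + d j + (D + d j + (D + d j)) ≤⟨ +-mono-≤ le (+-mono-≤ le le) ⟩
        D + D + (D + D + (D + D))   ≡⟨ solve 1 (λ x → (x :+ x) :+ ((x :+ x) :+ (x :+ x)) := con 6 :* x) refl D ⟩
        6 * D                       ∎
        where
        open ≤-Reasoning
        open +-*-Solver
        le : D + d j ≤ D + D
        le = +-monoʳ-≤ D d≤D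

      weight≤ : ∀ G → _⊆_ n G R → Feas G → D * sumOver n G w ≤ 6 * (sumOver n S w′ + w j * D)
      weight≤ G G⊆R feas = ≤-trans main (≤-reflexive (sym distrib))
        where
        open ≤-Reasoning
        G′ = G ∖ j
        distrib : 6 * (sumOver n S w′ + w j * D) ≡ 6 * sumOver n S w′ + w j * (6 * D)
        distrib = solve 3 (λ x y z → con 6 :* (x :+ y :* z) := con 6 :* x :+ y :* (con 6 :* z)) refl (sumOver n S w′) (w j) D
          where open +-*-Solver
        load₃ = overlapping-demand feas j<n (λ i i<n Gi → highest i i<n (G⊆R i i<n Gi))
        G′≤ : sumOver n G′ w′ ≤ 6 * sumOver n S w′
        G′≤ = ratio ap G′ (λ i i<n h → let p , q = ∖-⊆ {G} j h in ∖-intro {R} (G⊆R i i<n p) q)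
                (Feas-⊆ (∖-⊆ₙ {n} {G} j) feas)
        X = sumOver n (G′ ∩ (λ i → overlaps i j)) d
        main : D * sumOver n G w ≤ 6 * sumOver n S w′ + w j * (6 * D)
        main with G j in eq
        ... | false = begin
          D * sumOver n G w            ≡⟨ cong (D *_) (sumOver-∖-absent {n} {G} w eq) ⟨
          D * sumOver n G′ w           ≤⟨ charge G′ ⟩
          sumOver n G′ w′ + w j * X    ≤⟨ +-mono-≤ G′≤ (*-monoʳ-≤ (w j) (6D X 0 (≤-trans (≤-reflexive (+-identityʳ X)) X≤))) ⟩
          6 * sumOver n S w′ + w j * (6 * D) ∎
          where
          X≤ : X ≤ b j + (b j + b j)
          X≤ = ≤-trans (sumOver-⊆ n d λ i i<n h → let p , q = ∧-split {G′ i} h in ∧-join (∖-⊆ₙ {n} {G} j i i<n p) q) load₃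
        ... | true = begin
          D * sumOver n G w            ≡⟨ cong (D *_) (sumOver-remove w j<n eq) ⟩
          D * (w j + sumOver n G′ w)   ≡⟨ *-distribˡ-+ D (w j) _ ⟩
          D * w j + D * sumOver n G′ w ≤⟨ +-monoʳ-≤ (D * w j) (charge G′) ⟩
          D * w j + (sumOver n G′ w′ + w j * X) ≡⟨ solve 4 (λ x y z u → x :* y :+ (z :+ y :* u) := z :+ y :* (x :+ u)) refl D (w j) (sumOver n G′ w′) X ⟩
          sumOver n G′ w′ + w j * (D + X) ≤⟨ +-mono-≤ G′≤ (*-monoʳ-≤ (w j) D+X≤) ⟩
          6 * sumOver n S w′ + w j * (6 * D) ∎
          where
          open +-*-Solver
          X≤ : d j + X ≤ b j + (b j + b j)
          X≤ = ≤-trans (≤-trans (≤-reflexive (cong (d j +_) (sumOver-ext n d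
                 (λ i _ h → let p , q = ∧-split {G′ i} h ; p₁ , p₂ = ∖-⊆ {G} j p in ∖-intro {G ∩ (λ i → overlaps i j)} (∧-join p₁ q) p₂)
                 (λ i _ h → let p , q = ∖-⊆ {G ∩ (λ i → overlaps i j)} j h ; p₁ , p₂ = ∧-split {G i} p in ∧-join (∖-intro {G} p₁ q) p₂))))
               (≤-reflexive (sym (sumOver-remove d j<n (∧-join eq j-overlaps))))) load₃
          -- When j belongs to G, its weight is lost in full, but its demand occupies the three
          -- edges too: X is at most 3 `b j` - `d j`, hence D + X is at most 4 D + 2 `d j`. Adding
          -- `d j` on both sides avoids the subtraction.
          D+X≤ : D + X ≤ 6 * D
          D+X≤ = +-cancelʳ-≤ (d j) (D + X) (6 * D) (begin
            D + X + d j     ≡⟨ solve 3 (λ x y z → x :+ y :+ z := x :+ (z :+ y)) refl D X (d j) ⟩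
            D + (d j + X)   ≤⟨ +-monoʳ-≤ D X≤ ⟩
            D + (b j + (b j + b j)) ≡⟨ cong (λ z → D + (z + (z + z))) D+d≡b ⟨
            D + (D + d j + (D + d j + (D + d j))) ≡⟨ solve 2 (λ x z → x :+ (x :+ z :+ (x :+ z :+ (x :+ z))) := (con 4 :* x :+ (z :+ z)) :+ z) refl D (d j) ⟩
            4 * D + (d j + d j) + d j ≤⟨ +-monoˡ-≤ (d j) (+-monoʳ-≤ (4 * D) (+-mono-≤ d≤D d≤D)) ⟩
            4 * D + (D + D) + d j ≡⟨ solve 2 (λ x z → con 4 :* x :+ (x :+ x) :+ z := con 6 :* x :+ z) refl D (d j) ⟩
            6 * D + d j ∎)

      -- By `weight≤`, any treatment of j is good enough if undoing the reduction gains at least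
      -- `w j * D` over the residual profit of S.
      finish : ∀ S⁺ → sumOver n S w′ + w j * D ≤ D * sumOver n S⁺ w →
               ∀ G → _⊆_ n G R → Feas G → sumOver n G w ≤ 6 * sumOver n S⁺ w
      finish S⁺ h G G⊆R feas = *-cancelˡ-≤ D (begin
        D * sumOver n G w                  ≤⟨ weight≤ G G⊆R feas ⟩
        6 * (sumOver n S w′ + w j * D)     ≤⟨ *-monoʳ-≤ 6 h ⟩
        6 * (D * sumOver n S⁺ w)           ≡⟨ solve 2 (λ x y → con 6 :* (x :* y) := x :* (con 6 :* y)) refl D (sumOver n S⁺ w) ⟩
        D * (6 * sumOver n S⁺ w)           ∎)
        where
        open ≤-Reasoning
        open +-*-Solver

      w′≤ : sumOver n S w′ ≤ D * sumOver n S w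
      w′≤ = ≤-trans (sumOver-mono n λ i _ _ → m∸n≤m (w i * D) (on (overlaps i j) (w j * d i))) (≤-reflexive (sym (scaled S)))

      positive′ : ∀ i → i < n → S i ≡ true → 0 < w i
      positive′ i i<n Si with w i | positive ap i i<n Si
      ... | zero  | h = contradiction (≤-trans h (m∸n≤m 0 (on (overlaps i j) (w j * d i)))) λ ()
      ... | suc _ | _ = s≤s z≤n

    -- The tasks of S on the overfull edge e all overlap j and have total demand above `c e` -
    -- `d j`, so at least D, since `c e` is at least `b j`. Undoing the reduction on them returns
    -- `w j * D`; the sums are exact because members of S have positive residual weight.
    blocked-step : ∀ e → e < m → uses j e ≡ true → c e < load S e + d j → Approximates w R S
    blocked-step e e<m je over = record
      { within = λ i i<n h → ∖-⊆ₙ {n} {R} j i i<n (within ap i i<n h)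
      ; positive = positive′
      ; feasible = feasible ap
      ; ratio = finish S (begin
          sumOver n S w′ + w j * D    ≤⟨ +-monoʳ-≤ _ (*-monoʳ-≤ (w j) blockers) ⟩
          sumOver n S w′ + w j * sumOver n (S ∩ (λ i → overlaps i j)) d ≡⟨ expand S ⟨
          sumOver n S (λ i → w′ i + on (overlaps i j) (w j * d i)) ≡⟨ sumOver-cong n exact ⟩
          sumOver n S (λ i → w i * D) ≡⟨ scaled S ⟨
          D * sumOver n S w           ∎) }
      where
      open ≤-Reasoning
      exact : ∀ i → i < n → S i ≡ true → w′ i + on (overlaps i j) (w j * d i) ≡ w i * D
      exact i i<n Si = m∸n+n≡m {w i * D} {on (overlaps i j) (w j * d i)} (<⇒≤ (m∸n≢0⇒n<m {w i * D} (m<n⇒n≢0 (positive ap i i<n Si))))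
      blockers : D ≤ sumOver n (S ∩ (λ i → overlaps i j)) d
      blockers = ≤-trans (m≤n+o⇒m∸n≤o (b j) (d j) (begin
          b j              ≤⟨ b≤c j e j<n je ⟩
          c e              ≤⟨ <⇒≤ over ⟩
          load S e + d j   ≡⟨ +-comm (load S e) (d j) ⟩
          d j + load S e   ∎))
        (sumOver-⊆ n d λ i _ h → let p , q = ∧-split {S i} h in ∧-join p (uses⇒overlaps {i} {j} q je))

    -- Here j itself brings the required `w j * D`, and the reduction on S may be undone with a
    -- loss: `w′≤` only says that weights do not shrink.
    insert-step : Fits-in S j → 0 < w j → Approximates w R (insert j S)
    insert-step fit-in wj>0 = record
      { within = λ i i<n h → case ∨-elim (S i) h of λ where
          (inj₁ Si) → ∖-⊆ₙ {n} {R} j i i<n (within ap i i<n Si)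
          (inj₂ i≡j) → subst (λ k → R k ≡ true) (sym (≡ᵇ-sound i≡j)) Rj
      ; positive = λ i i<n h → case ∨-elim (S i) h of λ where
          (inj₁ Si) → positive′ i i<n Si
          (inj₂ i≡j) → subst (λ k → 0 < w k) (sym (≡ᵇ-sound i≡j)) wj>0
      ; feasible = feasible⁺
      ; ratio = finish (insert j S) (begin
          sumOver n S w′ + w j * D            ≤⟨ +-monoˡ-≤ (w j * D) w′≤ ⟩
          D * sumOver n S w + w j * D         ≡⟨ solve 3 (λ x y z → x :* y :+ z :* x := x :* (z :+ y)) refl D (sumOver n S w) (w j) ⟩
          D * (w j + sumOver n S w)           ≤⟨ *-monoʳ-≤ D heavier ⟩
          D * sumOver n (insert j S) w        ∎) }
      where
      open ≤-Reasoning
      open +-*-Solver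
      inserted : insert j S j ≡ true
      inserted = ∨-introʳ (S j) (≡ᵇ-refl j)
      heavier : w j + sumOver n S w ≤ sumOver n (insert j S) w
      heavier = ≤-trans (+-monoʳ-≤ (w j) (sumOver-⊆ n w λ i _ Si → ∖-intro {insert j S} {j} (∨-introˡ Si) λ { refl → clash S-avoids Si }))
        (≤-reflexive (sym (sumOver-remove w j<n inserted)))
      feasible⁺ : Feas (insert j S)
      feasible⁺ e e<m with uses j e in eq
      ... | true = begin
        load (insert j S) e ≡⟨ sumOver-remove d j<n (∧-join inserted eq) ⟩
        d j + sumOver n ((insert j S ∩ (λ i → uses i e)) ∖ j) d ≤⟨ +-monoʳ-≤ (d j) (sumOver-⊆ n d λ i i<n h →
            let p , q = ∖-⊆ {insert j S ∩ (λ i → uses i e)} j h ; p₁ , p₂ = ∧-split {insert j S i} p in ∧-join (old p₁ q) p₂) ⟩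
        d j + load S e      ≡⟨ +-comm (d j) (load S e) ⟩
        load S e + d j      ≤⟨ fit-in e e<m eq ⟩
        c e                 ∎
        where
        old : ∀ {i} → insert j S i ≡ true → i ≢ j → S i ≡ true
        old {i} h i≢j with ∨-elim (S i) h
        ... | inj₁ Si = Si
        ... | inj₂ i≡j = contradiction (≡ᵇ-sound i≡j) i≢j
      ... | false = ≤-trans (sumOver-⊆ n d λ i i<n h → let p , q = ∧-split {insert j S i} h in
             ∧-join (old p q) q) (feasible ap e e<m)
        where
        old : ∀ {i} → insert j S i ≡ true → uses i e ≡ true → S i ≡ true
        old {i} h ie with ∨-elim (S i) h
        ... | inj₁ Si = Si
        ... | inj₂ i≡j = clash eq (subst (λ k → uses k e ≡ true) (≡ᵇ-sound i≡j) ie)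

-- Large tasks as rectangles

module Rectangles (A : Tasks) where
  open Tasks A

  IsLarge : ℕ → Set
  IsLarge i = b i < 2 * d i

  -- Task i is drawn as the rectangle [s i , t i) × [bottom i , b i).
  conflict : ℕ → ℕ → Bool
  conflict i j = overlaps i j ∧ (bottom j <ᵇ b i) ∧ (bottom i <ᵇ b j)

  covers-anchor : ℕ → ℕ → Bool
  covers-anchor i j = uses i (anchor j) ∨ uses j (anchor i)

  -- The conflict graph is coloured in two stages because its two kinds of edges call for opposite
  -- elimination orders: near conflicts remove the rectangle with the highest top, far conflicts the
  -- one with the lowest top.
  near far : ℕ → ℕ → Bool
  near i j = conflict i j ∧ covers-anchor i j
  far  i j = conflict i j ∧ not (covers-anchor i j)

  conflict-swap : ∀ i j → conflict i j ≡ conflict j i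
  conflict-swap i j = cong₂ _∧_ (∧-comm (s i <ᵇ t j) _) (∧-comm (bottom j <ᵇ b i) _)

  near-sym : ∀ i j → near i j ≡ true → near j i ≡ true
  near-sym i j = trans (cong₂ _∧_ (conflict-swap j i) (∨-comm (uses j (anchor i)) _))

  far-sym : ∀ i j → far i j ≡ true → far j i ≡ true
  far-sym i j = trans (cong₂ _∧_ (conflict-swap j i) (cong not (∨-comm (uses j (anchor i)) _)))

  module Near = Colouring n near near-sym
  module Far  = Colouring n far far-sym

  -- Each member has demand at least x / 2, so two of them would exceed y.
  few-members : ∀ {N x y} → (∀ i → i < n → N i ≡ true → x ≤ 2 * d i) → sumOver n N d ≤ y → y < x →
                size n N ≤ 1
  few-members {N} {x} {y} x≤ sum≤ y<x = ≮⇒≥ λ 1<size → <⇒≱ y<x (*-cancelˡ-≤ 2 (begin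
    2 * x                      ≡⟨ *-comm 2 x ⟩
    x * 2                      ≤⟨ *-monoʳ-≤ x 1<size ⟩
    x * size n N               ≡⟨ sumOver-* n N x (λ _ → 1) ⟨
    sumOver n N (λ _ → x * 1)  ≤⟨ sumOver-mono n (λ i i<n Ni → ≤-trans (≤-reflexive (*-identityʳ x)) (x≤ i i<n Ni)) ⟩
    sumOver n N (λ i → 2 * d i) ≡⟨ sumOver-* n N 2 d ⟩
    2 * sumOver n N d          ≤⟨ *-monoʳ-≤ 2 sum≤ ⟩
    2 * y                      ∎))
    where open ≤-Reasoning

  module _ {G : PSet} (feas : Feas G) (large : ∀ i → i < n → G i ≡ true → IsLarge i) where

    pair-load : ∀ {i k e} → i < n → k < n → G i ≡ true → G k ≡ true → i ≢ k → e < m →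
                uses i e ≡ true → uses k e ≡ true → d k + d i ≤ c e
    pair-load {i} {k} {e} i<n k<n Gi Gk i≢k e<m ie ke = ≤-trans
      (≤-trans (+-monoʳ-≤ (d k) (member≤sumOver d i<n (∖-intro {G ∩ (λ i → uses i e)} (∧-join Gi ie) i≢k)))
        (≤-reflexive (sym (sumOver-remove {n} {G ∩ (λ i → uses i e)} d k<n (∧-join Gk ke)))))
      (feas e e<m)

    -- Among the members with an anchor on the path of k, none has a higher
    -- anchor than k; two of the others do not fit below k and above bottom k.
    near-degenerate : Near.Degenerate 1 G
    near-degenerate H H⊆G with maximum n H b
    ... | inj₂ none = inj₂ none
    ... | inj₁ (k , k<n , Hk , highest) = inj₁ (k , k<n , Hk ,
      few-members {N} {suc (bottom k)} {bottom k} (λ i i<n Ni → <⇒≤ (≤-<-trans (conflicting i Ni) (large i i<n (G∋ i i<n Ni)))) load≤ ≤-refl)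
      where
      N = (H ∖ k) ∩ near k
      H∋ : ∀ i → N i ≡ true → H i ≡ true × i ≢ k
      H∋ i Ni = ∖-⊆ {H} k (proj₁ (∧-split {(H ∖ k) i} Ni))
      G∋ : ∀ i → i < n → N i ≡ true → G i ≡ true
      G∋ i i<n Ni = H⊆G i i<n (proj₁ (H∋ i Ni))
      Gk = H⊆G k k<n Hk
      near-k : ∀ i → N i ≡ true → conflict k i ≡ true × covers-anchor k i ≡ true
      near-k i Ni = ∧-split {conflict k i} (proj₂ (∧-split {(H ∖ k) i} Ni))
      conflicting : ∀ i → N i ≡ true → bottom k < b i
      conflicting i Ni = <ᵇ-sound (proj₂ (∧-split {bottom i <ᵇ b k} (proj₂ (∧-split {overlaps k i} (proj₁ (near-k i Ni))))))
      uses-k : ∀ i → i < n → N i ≡ true → uses i (anchor k) ≡ true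
      uses-k i i<n Ni with ∨-elim (uses k (anchor i)) (proj₂ (near-k i Ni))
      ... | inj₂ h = h
      -- If k used the anchor of i, both would load an edge of capacity `b i`. Being large they need
      -- more than (`b i` + `b k`) / 2 together, and `b k` is at least `b i` by the choice of k.
      ... | inj₁ h = contradiction
        (pair-load i<n k<n Gi Gk (proj₂ (H∋ i Ni)) (anchor<m i i<n) (uses-anchor i i<n) h)
        (<⇒≱ (*-cancelˡ-< 2 (b i) (d k + d i) (begin-strict
          2 * b i            ≡⟨ cong (b i +_) (+-identityʳ (b i)) ⟩
          b i + b i          <⟨ +-mono-< (≤-<-trans (highest i i<n (proj₁ (H∋ i Ni))) (large k k<n Gk)) (large i i<n Gi) ⟩
          2 * d k + 2 * d i  ≡⟨ *-distribˡ-+ 2 (d k) (d i) ⟨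
          2 * (d k + d i)    ∎)))
        where
        open ≤-Reasoning
        Gi = G∋ i i<n Ni
      load≤ : sumOver n N d ≤ bottom k
      load≤ = m+n≤o⇒m≤o∸n (sumOver n N d) (begin
        sumOver n N d + d k  ≡⟨ +-comm (sumOver n N d) (d k) ⟩
        d k + sumOver n N d  ≤⟨ +-monoʳ-≤ (d k) (sumOver-⊆ n d λ i i<n Ni →
             ∖-intro {G ∩ (λ i → uses i (anchor k))} (∧-join (G∋ i i<n Ni) (uses-k i i<n Ni)) (proj₂ (H∋ i Ni))) ⟩
        d k + sumOver n ((G ∩ (λ i → uses i (anchor k))) ∖ k) d ≡⟨ sumOver-remove {n} {G ∩ (λ i → uses i (anchor k))} d k<n (∧-join Gk (uses-anchor k k<n)) ⟨
        load G (anchor k)    ≤⟨ feas (anchor k) (anchor<m k k<n) ⟩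
        b k                  ∎)
        where open ≤-Reasoning

    -- All of J shares an edge of capacity `b j` with j in J, so the members other than j have total
    -- demand at most `bottom j`. This is less than `b k`, while each of them needs at least half of
    -- `b k`: at most one of them is left besides j.
    one-sided : ∀ {J k} → _⊆_ n J G →
      (∀ i → i < n → J i ≡ true → b k ≤ b i × bottom i < b k) →
      (Σ[ j ∈ ℕ ] j < n × J j ≡ true × sumOver n J d ≤ b j) ⊎ (∀ i → i < n → J i ≡ false) →
      size n J ≤ 2
    one-sided J⊆G h (inj₂ none) = ≤-trans (≤-reflexive (sumOver-empty n (λ _ → 1) none)) z≤n
    one-sided {J} {k} J⊆G h (inj₁ (j , j<n , Jj , sum≤)) = ≤-trans
      (≤-reflexive (sumOver-remove (λ _ → 1) j<n Jj))
      (s≤s (few-members {J ∖ j} {b k} {bottom j}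
        (λ i i<n Ji → let Ji′ = ∖-⊆ₙ {n} {J} j i i<n Ji in
          ≤-trans (proj₁ (h i i<n Ji′)) (<⇒≤ (large i i<n (J⊆G i i<n Ji′))))
        (m+n≤o⇒m≤o∸n (sumOver n (J ∖ j) d) (≤-trans
          (≤-reflexive (trans (+-comm (sumOver n (J ∖ j) d) (d j)) (sym (sumOver-remove d j<n Jj)))) sum≤))
        (proj₂ (h j j<n Jj))))

    -- A far neighbour of the rectangle k with the lowest top has its anchor to the left or to the
    -- right of the path of k. Each side contributes at most two neighbours by `one-sided`.
    far-degenerate : Far.Degenerate 4 G
    far-degenerate H H⊆G with minimum n H b
    ... | inj₂ none = inj₂ none
    ... | inj₁ (k , k<n , Hk , highest) = inj₁ (k , k<n , Hk , ≤-trans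
      (sumOver-∪ n {N} {L} {R} (λ _ → 1) classify)
      (+-mono-≤
        (one-sided {L} {k} (λ i i<n h → G∋ i i<n (proj₁ (∧-split {N i} h)))
          (λ i i<n h → facts i i<n (proj₁ (∧-split {N i} h)))
          (left-anchored {G} {L} {s k} feas (λ i i<n h → G∋ i i<n (proj₁ (∧-split {N i} h)))
            λ i i<n h → let p , q = ∧-split {N i} h in <ᵇ-sound q , proj₁ (crossing i p)))
        (one-sided {R} {k} (λ i i<n h → G∋ i i<n (proj₁ (∧-split {N i} h)))
          (λ i i<n h → facts i i<n (proj₁ (∧-split {N i} h)))
          (right-anchored {G} {R} {t k} feas (λ i i<n h → G∋ i i<n (proj₁ (∧-split {N i} h)))
            λ i i<n h → let p , q = ∧-split {N i} h in ≤ᵇ-sound q , proj₂ (crossing i p)))))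
      where
      N L R : PSet
      N = (H ∖ k) ∩ far k
      L = N ∩ (λ i → anchor i <ᵇ s k)
      R = N ∩ (λ i → t k ≤ᵇ anchor i)
      H∋ : ∀ i → N i ≡ true → H i ≡ true
      H∋ i Ni = proj₁ (∖-⊆ {H} k (proj₁ (∧-split {(H ∖ k) i} Ni)))
      G∋ : ∀ i → i < n → N i ≡ true → G i ≡ true
      G∋ i i<n Ni = H⊆G i i<n (H∋ i Ni)
      far-k : ∀ i → N i ≡ true → conflict k i ≡ true × not (covers-anchor k i) ≡ true
      far-k i Ni = ∧-split {conflict k i} (proj₂ (∧-split {(H ∖ k) i} Ni))
      crossing : ∀ i → N i ≡ true → s k < t i × s i < t k
      crossing i Ni = overlaps-elim {k} {i} (proj₁ (∧-split {overlaps k i} (proj₁ (far-k i Ni))))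
      facts : ∀ i → i < n → N i ≡ true → b k ≤ b i × bottom i < b k
      facts i i<n Ni = highest i i<n (H∋ i Ni) ,
        <ᵇ-sound (proj₁ (∧-split {bottom i <ᵇ b k} (proj₂ (∧-split {overlaps k i} (proj₁ (far-k i Ni))))))
      classify : ∀ i → i < n → N i ≡ true → L i ≡ true ⊎ R i ≡ true
      classify i i<n Ni with anchor i <? s k | t k ≤? anchor i
      ... | yes p | _     = inj₁ (∧-join Ni (<ᵇ-complete p))
      ... | no _  | yes p = inj₂ (∧-join Ni (≤ᵇ-complete p))
      ... | no p  | no q  = clash (not-true (proj₂ (far-k i Ni)))
        (∨-introˡ (uses-intro {k} (≮⇒≥ p) (≰⇒> q)))

  conflict-free-part : ∀ {G} (w : ℕ → ℕ) → Feas G → (∀ i → i < n → G i ≡ true → IsLarge i) →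
    Σ[ H ∈ PSet ] _⊆_ n H G ×
      (∀ i j → i < n → j < n → H i ≡ true → H j ≡ true → i ≢ j → conflict i j ≡ false) ×
      sumOver n G w ≤ 10 * sumOver n H w
  conflict-free-part {G} w feas large
    with G₁ , G₁⊆G , near-free , w₁ ← Near.heavy-independent 1 G (near-degenerate feas large) w
    with H , H⊆G₁ , far-free , w₂ ← Far.heavy-independent 4 G₁
           (far-degenerate (Feas-⊆ G₁⊆G feas) (λ i i<n h → large i i<n (G₁⊆G i i<n h))) w
    = H , (λ i i<n h → G₁⊆G i i<n (H⊆G₁ i i<n h)) , free ,
      -- One of 2 colour classes for near conflicts, and within it one of 5 classes for far
      -- conflicts, keeps a tenth of the weight.
      ≤-trans w₁ (≤-trans (*-monoʳ-≤ 2 w₂) (≤-reflexive (sym (*-assoc 2 5 (sumOver n H w)))))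
    where
    free : ∀ i j → i < n → j < n → H i ≡ true → H j ≡ true → i ≢ j → conflict i j ≡ false
    free i j i<n j<n Hi Hj i≢j
      with conflict i j | covers-anchor i j
         | near-free i j i<n j<n (H⊆G₁ i i<n Hi) (H⊆G₁ j j<n Hj) i≢j | far-free i j i<n j<n Hi Hj i≢j
    ... | false | _     | _  | _  = refl
    ... | true  | true  | () | _
    ... | true  | false | _  | ()

-- Subproblems between two rectangles

-- Indices n and n + 1 stand for walls to the left and to the right of the
-- path.
record Walled (A : Tasks) : Set where
  open Tasks A
  field
    position top : ℕ → ℕ
    position≡ : ∀ i → i < n → position i ≡ suc (anchor i)
    top≡      : ∀ i → i < n → top i ≡ b i
    top-wall  : ∀ i → n ≤ i → top i ≡ 0
    t-wall    : ∀ i → n ≤ i → t i ≡ 0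
    left-wall : position n ≡ 0
    right-wall : position (suc n) ≡ suc m

module Intervals {A : Tasks} (W : Walled A) where
  open Tasks A
  open Rectangles A
  open Walled W

  base : ℕ → ℕ
  base i = top i ∸ d i

  Compatible : ℕ → ℕ → Set
  Compatible i j = s i < t j → s j < t i → top i ≤ base j ⊎ top j ≤ base i

  Compatible-sym : ∀ {i j} → Compatible i j → Compatible j i
  Compatible-sym h p q with h q p
  ... | inj₁ x = inj₂ x
  ... | inj₂ x = inj₁ x

  -- `P` and `Q` are the rectangles or walls whose anchors delimit the subproblem. Since k starts at
  -- least as high as both, compatibility with these two is all that must be remembered;
  -- `widen-left` and `widen-right` recover compatibility with the boundaries outside. For walls,
  -- `top` and hence `base` are 0.
  record Eligible (P Q k : ℕ) : Set where
    field
      k<n    : k < n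
      large  : top k < 2 * d k
      fits   : d k ≤ top k
      P<k    : position P < position k
      k<Q    : position k < position Q
      P≤k    : base P ≤ base k
      Q≤k    : base Q ≤ base k
      compP  : Compatible k P
      compQ  : Compatible k Q

  open Eligible

  record Valid (P Q : ℕ) (H : PSet) : Set where
    field
      eligible   : ∀ i → i < n → H i ≡ true → Eligible P Q i
      compatible : ∀ i j → i < n → j < n → H i ≡ true → H j ≡ true → i ≢ j → Compatible i j

  open Valid

  base<top : ∀ i → i < n → d i ≤ top i → base i < top i
  base<top i i<n d≤ = ∸-monoʳ-< (d>0 i i<n) d≤

  uses⇒top≤ : ∀ {i k} → i < n → k < n → uses i (anchor k) ≡ true → top i ≤ top k
  uses⇒top≤ {i} {k} i<n k<n h = subst₂ _≤_ (sym (top≡ i i<n)) (sym (top≡ k k<n)) (b≤c i (anchor k) i<n h)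

  -- A rectangle over the bottleneck of k has its top at most at `top k`. Whichever of the two lies
  -- below the other, `top i` would then be at most `base i`, since `base k` is at most `base i`.
  avoids-anchor : ∀ {i k} → i < n → k < n → d i ≤ top i → base k ≤ base i → Compatible i k →
                  uses i (anchor k) ≡ true → ∀ {X : Set} → X
  avoids-anchor {i} {k} i<n k<n d≤ base≤ comp h
    with si≤ , <ti ← uses-elim {i} h
    with comp (≤-<-trans si≤ (anchor<t k k<n)) (≤-<-trans (s≤anchor k k<n) <ti)
  ... | inj₁ x = contradiction (≤-trans x base≤) (<⇒≱ (base<top i i<n d≤))
  ... | inj₂ x = contradiction (≤-trans (uses⇒top≤ {i} i<n k<n h) x) (<⇒≱ (base<top i i<n d≤))

  anchor-< : ∀ {i k} → i < n → k < n → position i < position k → anchor i < anchor k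
  anchor-< i<n k<n h = s≤s⁻¹ (subst₂ _<_ (position≡ _ i<n) (position≡ _ k<n) h)

  left-of : ∀ {P k i} → k < n → Eligible P k i → t i ≤ anchor k
  left-of {P} {k} {i} k<n′ el = ≮⇒≥ λ anchor<ti →
    avoids-anchor {i} {k} (k<n el) k<n′ (fits el) (Q≤k el) (compQ el)
      (uses-intro {i} (<⇒≤ (≤-<-trans (s≤anchor i (k<n el)) (anchor-< (k<n el) k<n′ (k<Q el)))) anchor<ti)

  right-of : ∀ {k Q i} → k < n → Eligible k Q i → anchor k < s i
  right-of {k} {Q} {i} k<n′ el = ≰⇒> λ si≤ →
    avoids-anchor {i} {k} (k<n el) k<n′ (fits el) (P≤k el) (compP el)
      (uses-intro {i} si≤ (<-trans (anchor-< k<n′ (k<n el) (P<k el)) (anchor<t i (k<n el))))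

  -- Both paths contain the anchor of k, so one rectangle lies below the other. It cannot be k, as
  -- `base w` is at most `base k`.
  below-inner : ∀ {k w} → k < n → w < n → d k ≤ top k → base w ≤ base k → Compatible k w →
                uses w (anchor k) ≡ true → top w ≤ base k
  below-inner {k} {w} k<n w<n d≤ base≤ comp h
    with sw≤ , <tw ← uses-elim {w} h
    with comp (≤-<-trans (s≤anchor k k<n) <tw) (≤-<-trans sw≤ (anchor<t k k<n))
  ... | inj₂ x = x
  ... | inj₁ x = contradiction (≤-trans x base≤) (<⇒≱ (base<top k k<n d≤))

  -- A wall has end 0, so no path overlaps it.
  wall? : ∀ {i w} → s i < t w → w < n
  wall? {i} {w} h = ≰⇒> λ n≤w → contradiction (subst (s i <_) (t-wall w n≤w) h) λ ()

  join : ℕ → PSet → PSet → PSet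
  join k H K i = (H i ∨ K i) ∨ (i ≡ᵇ k)

  module _ {P Q k : ℕ} (el : Eligible P Q k) where

    private
      k<n′ : k < n
      k<n′ = k<n el

    -- A member i of the left subproblem ends before the anchor of k. If Q nevertheless overlaps i,
    -- then Q crosses this anchor, lies entirely below k, and thus below i, whose bottom is at least
    -- as high as that of k.
    widen-left : ∀ {i} → Eligible P k i → Eligible P Q i
    widen-left {i} e = record
      { k<n = k<n e ; large = large e ; fits = fits e ; P<k = P<k e
      ; k<Q = <-trans (k<Q e) (k<Q el) ; P≤k = P≤k e ; Q≤k = ≤-trans (Q≤k el) (Q≤k e)
      ; compP = compP e
      ; compQ = λ si<tQ sQ<ti → let Q<n = wall? {i} si<tQ in inj₂ (≤-trans
          (below-inner k<n′ Q<n (fits el) (Q≤k el) (compQ el)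
            (uses-intro {Q} (<⇒≤ (<-≤-trans sQ<ti (left-of {P} k<n′ e)))
              (<-trans (anchor-< k<n′ Q<n (k<Q el)) (anchor<t Q Q<n))))
          (Q≤k e)) }

    widen-right : ∀ {i} → Eligible k Q i → Eligible P Q i
    widen-right {i} e = record
      { k<n = k<n e ; large = large e ; fits = fits e ; P<k = <-trans (P<k el) (P<k e)
      ; k<Q = k<Q e ; P≤k = ≤-trans (P≤k el) (P≤k e) ; Q≤k = Q≤k e
      ; compP = λ si<tP sP<ti → let P<n = wall? {i} si<tP in inj₂ (≤-trans
          (below-inner k<n′ P<n (fits el) (P≤k el) (compP el)
            (uses-intro {P} (<⇒≤ (≤-<-trans (s≤anchor P P<n) (anchor-< P<n k<n′ (P<k el))))
              (<-trans (right-of {k} {Q} k<n′ e) si<tP)))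
          (P≤k e))
      ; compQ = compQ e }

    module _ {H K : PSet} (vH : Valid P k H) (vK : Valid k Q K) where

      join-elim : ∀ i → join k H K i ≡ true → H i ≡ true ⊎ K i ≡ true ⊎ i ≡ k
      join-elim i h with ∨-elim (H i ∨ K i) h
      ... | inj₂ e = inj₂ (inj₂ (≡ᵇ-sound e))
      ... | inj₁ e with ∨-elim (H i) e
      ...   | inj₁ x = inj₁ x
      ...   | inj₂ x = inj₂ (inj₁ x)

      apart : ∀ i j → i < n → j < n → H i ≡ true → K j ≡ true → Compatible i j
      apart i j i<n j<n Hi Kj _ sj<ti = contradiction
        (<-trans (right-of {k} {Q} k<n′ (eligible vK j j<n Kj)) sj<ti)
        (≤⇒≯ (left-of {P} k<n′ (eligible vH i i<n Hi)))

      join-valid : Valid P Q (join k H K)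
      join-valid = record { eligible = el′ ; compatible = comp′ }
        where
        el′ : ∀ i → i < n → join k H K i ≡ true → Eligible P Q i
        el′ i i<n h with join-elim i h
        ... | inj₁ Hi = widen-left (eligible vH i i<n Hi)
        ... | inj₂ (inj₁ Ki) = widen-right (eligible vK i i<n Ki)
        ... | inj₂ (inj₂ refl) = el
        comp′ : ∀ i j → i < n → j < n → join k H K i ≡ true → join k H K j ≡ true → i ≢ j → Compatible i j
        comp′ i j i<n j<n hi hj i≢j with join-elim i hi | join-elim j hj
        ... | inj₁ Hi | inj₁ Hj = compatible vH i j i<n j<n Hi Hj i≢j
        ... | inj₁ Hi | inj₂ (inj₁ Kj) = apart i j i<n j<n Hi Kj
        ... | inj₁ Hi | inj₂ (inj₂ refl) = compQ (eligible vH i i<n Hi)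
        ... | inj₂ (inj₁ Ki) | inj₁ Hj = Compatible-sym (apart j i j<n i<n Hj Ki)
        ... | inj₂ (inj₁ Ki) | inj₂ (inj₁ Kj) = compatible vK i j i<n j<n Ki Kj i≢j
        ... | inj₂ (inj₁ Ki) | inj₂ (inj₂ refl) = compP (eligible vK i i<n Ki)
        ... | inj₂ (inj₂ refl) | inj₁ Hj = Compatible-sym (compQ (eligible vH j j<n Hj))
        ... | inj₂ (inj₂ refl) | inj₂ (inj₁ Kj) = Compatible-sym (compP (eligible vK j j<n Kj))
        ... | inj₂ (inj₂ refl) | inj₂ (inj₂ refl) = contradiction refl i≢j

      -- No profit is counted twice, because the positions of H lie strictly before that of k and
      -- those of K strictly after it.
      join-weight : ∀ w → w k + (sumOver n H w + sumOver n K w) ≤ sumOver n (join k H K) w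
      join-weight w = ≤-trans (+-monoʳ-≤ (w k) (≤-trans (≤-reflexive (sym (sumTo-+ n _ _))) (sumTo-mono n pointwise)))
        (≤-reflexive (sym (sumOver-remove {n} {join k H K} w k<n′ (∨-introʳ (H k ∨ K k) (≡ᵇ-refl k)))))
        where
        not-k : ∀ i → i < n → H i ≡ true ⊎ K i ≡ true → i ≢ k
        not-k i i<n (inj₁ Hi) refl = <-irrefl refl (k<Q (eligible vH i i<n Hi))
        not-k i i<n (inj₂ Ki) refl = <-irrefl refl (P<k (eligible vK i i<n Ki))
        pointwise : ∀ i → i < n → on (H i) (w i) + on (K i) (w i) ≤ on ((join k H K ∖ k) i) (w i)
        pointwise i i<n with H i in eqH | K i in eqK
        ... | true | true = contradiction
              (<-trans (k<Q (eligible vH i i<n eqH)) (P<k (eligible vK i i<n eqK))) (<-irrefl refl)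
        ... | false | false = z≤n
        ... | true | false rewrite ≡ᵇ-≢ (not-k i i<n (inj₁ eqH)) = ≤-reflexive (+-identityʳ (w i))
        ... | false | true rewrite ≡ᵇ-≢ (not-k i i<n (inj₂ eqK)) = ≤-refl

  -- The member k with the lowest bottom is the only one using its anchor.
  split : ∀ {P Q H} → Valid P Q H →
    (Σ[ k ∈ ℕ ] Eligible P Q k × Σ[ L ∈ PSet ] Σ[ R ∈ PSet ] Valid P k L × Valid k Q R ×
      size n L < size n H × size n R < size n H ×
      (∀ w → sumOver n H w ≤ w k + (sumOver n L w + sumOver n R w)))
    ⊎ (∀ i → i < n → H i ≡ false)
  split {P} {Q} {H} v with minimum n H base
  ... | inj₂ none = inj₂ none
  ... | inj₁ (k , k<n′ , Hk , lowest-base) = inj₁ (k , el , L , R ,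
    record { eligible = elL ; compatible = λ i j i<n j<n Li Lj → compatible v i j i<n j<n (proj₁ (∧-split {H i} Li)) (proj₁ (∧-split {H j} Lj)) } ,
    record { eligible = elR ; compatible = λ i j i<n j<n Ri Rj → compatible v i j i<n j<n (proj₁ (∧-split {H i} Ri)) (proj₁ (∧-split {H j} Rj)) } ,
    smaller L (λ i _ h → let p , q = ∧-split {H i} h in ∖-intro {H} p λ { refl → <-irrefl refl (<ᵇ-sound {position k} {position k} q) }) ,
    smaller R (λ i _ h → let p , q = ∧-split {H i} h in ∖-intro {H} p λ { refl → <-irrefl refl (<ᵇ-sound {position k} {position k} q) }) ,
    λ w → ≤-trans (≤-reflexive (sumOver-remove w k<n′ Hk)) (+-monoʳ-≤ (w k) (sumOver-∪ n {H ∖ k} {L} {R} w sides)))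
    where
    el = eligible v k k<n′ Hk
    L R : PSet
    L = H ∩ (λ i → position i <ᵇ position k)
    R = H ∩ (λ i → position k <ᵇ position i)
    smaller : ∀ K → _⊆_ n K (H ∖ k) → size n K < size n H
    smaller K K⊆ = ≤-trans (s≤s (sumOver-⊆ n (λ _ → 1) K⊆)) (≤-reflexive (sym (sumOver-remove (λ _ → 1) k<n′ Hk)))
    elL : ∀ i → i < n → L i ≡ true → Eligible P k i
    elL i i<n h with Hi , q ← ∧-split {H i} h with e ← eligible v i i<n Hi = record
      { k<n = i<n ; large = large e ; fits = fits e ; P<k = P<k e ; k<Q = <ᵇ-sound q
      ; P≤k = P≤k e ; Q≤k = lowest-base i i<n Hi ; compP = compP e
      ; compQ = compatible v i k i<n k<n′ Hi Hk λ { refl → <-irrefl refl (<ᵇ-sound {position k} {position k} q) } }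
    elR : ∀ i → i < n → R i ≡ true → Eligible k Q i
    elR i i<n h with Hi , q ← ∧-split {H i} h with e ← eligible v i i<n Hi = record
      { k<n = i<n ; large = large e ; fits = fits e ; P<k = <ᵇ-sound q ; k<Q = k<Q e
      ; P≤k = lowest-base i i<n Hi ; Q≤k = Q≤k e ; compQ = compQ e
      ; compP = compatible v i k i<n k<n′ Hi Hk λ { refl → <-irrefl refl (<ᵇ-sound {position k} {position k} q) } }
    sides : ∀ i → i < n → (H ∖ k) i ≡ true → L i ≡ true ⊎ R i ≡ true
    sides i i<n h with Hi , i≢k ← ∖-⊆ {H} k h with <-cmp (position i) (position k)
    ... | tri< p _ _ = inj₁ (∧-join Hi (<ᵇ-complete p))
    ... | tri> _ _ p = inj₂ (∧-join Hi (<ᵇ-complete p))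
    -- A second member with the same anchor would use the anchor of k with a bottom at least as
    -- high, which `avoids-anchor` rules out.
    ... | tri≈ _ p _ = avoids-anchor {i} {k} i<n k<n′ (fits (eligible v i i<n Hi)) (lowest-base i i<n Hi)
            (compatible v i k i<n k<n′ Hi Hk i≢k)
            (subst (λ e → uses i e ≡ true) (suc-injective (trans (sym (position≡ i i<n)) (trans p (position≡ k k<n′)))) (uses-anchor i i<n))

  -- Compatible rectangles over one edge are stacked. Without the highest one, k, all others fit
  -- under `base k`, and `d k` + `base k` is `top k`. The bound z on the size drives the recursion.
  stack : ∀ z H e X → size n H ≤ z → (∀ i → i < n → H i ≡ true → uses i e ≡ true × d i ≤ top i × top i ≤ X) →
    (∀ i j → i < n → j < n → H i ≡ true → H j ≡ true → i ≢ j → Compatible i j) → sumOver n H d ≤ X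
  stack z H e X size≤ h comp with maximum n H top
  ... | inj₂ none = ≤-trans (≤-reflexive (sumOver-empty n d none)) z≤n
  stack zero H e X size≤ h comp | inj₁ (k , k<n′ , Hk , _) =
    contradiction (≤-trans (member≤sumOver (λ _ → 1) k<n′ Hk) size≤) λ ()
  stack (suc z) H e X size≤ h comp | inj₁ (k , k<n′ , Hk , highest) = begin
    sumOver n H d                ≡⟨ sumOver-remove d k<n′ Hk ⟩
    d k + sumOver n (H ∖ k) d    ≤⟨ +-monoʳ-≤ (d k) (stack z (H ∖ k) e (base k)
        (s≤s⁻¹ (≤-trans (≤-reflexive (sym (sumOver-remove (λ _ → 1) k<n′ Hk))) size≤)) below
        (λ i j i<n j<n Hi Hj → comp i j i<n j<n (∖-⊆ₙ {n} {H} k i i<n Hi) (∖-⊆ₙ {n} {H} k j j<n Hj))) ⟩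
    d k + base k                 ≡⟨ m+[n∸m]≡n (proj₁ (proj₂ (h k k<n′ Hk))) ⟩
    top k                        ≤⟨ proj₂ (proj₂ (h k k<n′ Hk)) ⟩
    X                            ∎
    where
    open ≤-Reasoning
    below : ∀ i → i < n → (H ∖ k) i ≡ true → uses i e ≡ true × d i ≤ top i × top i ≤ base k
    below i i<n h′ with Hi , i≢k ← ∖-⊆ {H} k h′
      with ie , d≤ , _ ← h i i<n Hi
      with p , q ← overlaps-elim {i} {k} (uses⇒overlaps {i} {k} ie (proj₁ (h k k<n′ Hk)))
      with comp i k i<n k<n′ Hi Hk i≢k p q
    ... | inj₁ x = ie , d≤ , x
    ... | inj₂ x = contradiction (≤-trans (highest i i<n Hi) x) (<⇒≱ (base<top i i<n d≤))

  Valid⇒Feas : ∀ {P Q H} → Valid P Q H → Feas H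
  Valid⇒Feas {P} {Q} {H} v e e<m = stack _ (H ∩ (λ i → uses i e)) e (c e) ≤-refl
    (λ i i<n h → let Hi , ie = ∧-split {H i} h in
      ie , fits (eligible v i i<n Hi) , subst (_≤ c e) (sym (top≡ i i<n)) (b≤c i e i<n ie))
    (λ i j i<n j<n hi hj → compatible v i j i<n j<n (proj₁ (∧-split {H i} hi)) (proj₁ (∧-split {H j} hj)))

  base-wall : ∀ i → n ≤ i → base i ≡ 0
  base-wall i n≤i = trans (cong (_∸ d i) (top-wall i n≤i)) (0∸n≡0 (d i))

  conflict-free⇒Valid : ∀ {G H} → Feas G → (∀ i → i < n → G i ≡ true → IsLarge i) → _⊆_ n H G →
    (∀ i j → i < n → j < n → H i ≡ true → H j ≡ true → i ≢ j → conflict i j ≡ false) →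
    Valid n (suc n) H
  conflict-free⇒Valid {G} {H} feas large′ H⊆G free = record
      { eligible = λ i i<n Hi → record
          { k<n = i<n
          ; large = subst (_< 2 * d i) (sym (top≡ i i<n)) (large′ i i<n (H⊆G i i<n Hi))
          ; fits = subst (d i ≤_) (sym (top≡ i i<n)) (member-fits {G} feas i<n (H⊆G i i<n Hi))
          ; P<k = subst₂ _<_ (sym left-wall) (sym (position≡ i i<n)) (s≤s z≤n)
          ; k<Q = subst₂ _<_ (sym (position≡ i i<n)) (sym right-wall) (s≤s (anchor<m i i<n))
          ; P≤k = subst (_≤ base i) (sym (base-wall n ≤-refl)) z≤n
          ; Q≤k = subst (_≤ base i) (sym (base-wall (suc n) (n≤1+n n))) z≤n
          ; compP = λ h _ → contradiction (wall? {i} {n} h) (<-irrefl refl)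
          ; compQ = λ h _ → contradiction (wall? {i} {suc n} h) (≤⇒≯ (n≤1+n n)) }
      ; compatible = compat }
    where
    compat : ∀ i j → i < n → j < n → H i ≡ true → H j ≡ true → i ≢ j → Compatible i j
    compat i j i<n j<n Hi Hj i≢j p q with top i ≤? base j | top j ≤? base i
    ... | yes x | _ = inj₁ x
    ... | no _ | yes x = inj₂ x
    ... | no x | no y = clash (free i j i<n j<n Hi Hj i≢j)
      (∧-join (overlaps-intro {i} {j} p q) (∧-join
        (<ᵇ-complete (subst₂ _<_ (cong (_∸ d j) (top≡ j j<n)) (top≡ i i<n) (≰⇒> x)))
        (<ᵇ-complete (subst₂ _<_ (cong (_∸ d i) (top≡ i i<n)) (top≡ j j<n) (≰⇒> y)))))

  heavy-Valid-part : ∀ {G} (w : ℕ → ℕ) → Feas G → (∀ i → i < n → G i ≡ true → IsLarge i) →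
    Σ[ H ∈ PSet ] Valid n (suc n) H × sumOver n G w ≤ 10 * sumOver n H w
  heavy-Valid-part w feas large′ =
    let H , H⊆G , free , w≤ = conflict-free-part w feas large′ in
    H , conflict-free⇒Valid feas large′ H⊆G free , w≤

-- The program

-- Arrays 0 , … , 6 hold the input and the output, 7 , … , 15 are the
-- working arrays, and the others are scalars.
CAP START END DEM PROFIT SEL KEY POS TOP WEIGHT DONE ORD RES VAL SOL : ℕ
CAP = 1
START = 2
END = 3
DEM = 4
PROFIT = 5
SEL = 6
KEY = 7
POS = 8
TOP = 9
WEIGHT = 10
DONE = 11
ORD = 12
RES = 13
VAL = 14
SOL = 15

ti te tr tP tQ tk x best task wt ld ok val arg total : ℕ
ti = 20
te = 21
tr = 22
tP = 23
tQ = 24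
tk = 25
x = 30
best = 31
task = 32
wt = 33
ld = 34
ok = 35
val = 36
arg = 37
total = 38

! : ℕ → Expr
! a = a at const 0

_⊞_ _⊟_ _⊠_ : Expr → Expr → Expr
_⊞_ = op plus
_⊟_ = op monus
_⊠_ = op times

infixl 8 _⊞_ _⊟_
infixl 9 _⊠_

nᴱ mᴱ : Expr
nᴱ = 0 at const 0
mᴱ = 0 at const 1

-- Comparisons are truncated differences: nonzero exactly when the comparison holds, as the tests of
-- the machine require.
_≺_ _≼_ : Expr → Expr → Expr
e ≺ f = f ⊟ e
e ≼ f = const 1 ⊞ f ⊟ e

infix 7 _≺_ _≼_

keyᴱ : Expr → Expr
keyᴱ e = (CAP at e) ⊠ mᴱ ⊞ e

usesᴱ : Expr → Expr → List Expr
usesᴱ i e = (START at i ≼ e) ∷ (e ≺ END at i) ∷ []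

infix 6 _←_
_←_ : ℕ → Expr → Prog
v ← e = v [ const 0 ]≔ e

lowerᴱ : List Expr
lowerᴱ = (START at ! ti ≼ ! te) ∷ (! te ≺ END at ! ti) ∷ (keyᴱ (! te) ≺ keyᴱ (! x)) ∷ []

findAnchor : Prog
findAnchor = for te 1 0 (whenAll lowerᴱ (x ← ! te))

anchorBody : Prog
anchorBody = (x ← START at ! ti) ⨟ findAnchor ⨟
  (POS [ ! ti ]≔ const 1 ⊞ ! x) ⨟ (TOP [ ! ti ]≔ CAP at ! x) ⨟ (KEY [ ! ti ]≔ keyᴱ (! x))

anchors : Prog
anchors = for ti 0 0 anchorBody ⨟ (POS [ const 1 ⊞ nᴱ ]≔ const 1 ⊞ mᴱ)

-- Large tasks keep the initial weight 0, and tasks of weight 0 are never selected by the local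
-- ratio.
weights : Prog
weights = for ti 0 0
  (whenAll ((const 2 ⊠ (DEM at ! ti) ≼ TOP at ! ti) ∷ []) (WEIGHT [ ! ti ]≔ PROFIT at ! ti))

-- The comparison with the best key so far is not strict, so that any waiting task replaces the
-- initial value 0.
higherᴱ : List Expr
higherᴱ = (const 1 ⊟ (DONE at ! ti)) ∷ (! best ≼ KEY at ! ti) ∷ []

findHighest : Prog
findHighest = (best ← const 0) ⨟
  for ti 0 0 (whenAll higherᴱ ((task ← ! ti) ⨟ (best ← KEY at ! ti)))

overlapᴱ : List Expr
overlapᴱ = (START at ! ti ≺ END at ! task) ∷ (START at ! task ≺ END at ! ti) ∷ []

-- `POS` stores the anchor plus one, hence the subtraction of 1 before the bottleneck capacity is
-- read.
scale subtract reduce : Prog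
scale    = WEIGHT [ ! ti ]≔
  (WEIGHT at ! ti) ⊠ ((CAP at ((POS at ! task) ⊟ const 1)) ⊟ (DEM at ! task))
subtract = WEIGHT [ ! ti ]≔ (WEIGHT at ! ti) ⊟ ! wt ⊠ (DEM at ! ti)
reduce   = for ti 0 0 (scale ⨟ whenAll overlapᴱ subtract)

round : Prog
round = findHighest ⨟ (DONE [ ! task ]≔ const 1) ⨟ (wt ← WEIGHT at ! task) ⨟
  (ORD [ ! tr ]≔ ! task) ⨟ (RES [ ! tr ]≔ ! wt) ⨟ when (! wt) reduce

rounds : Prog
rounds = for tr 0 0 round

loadAt : Prog
loadAt = (ld ← DEM at ! task) ⨟ for ti 0 0
  (whenAll ((SEL at ! ti) ∷ usesᴱ (! ti) (! te)) (ld ← ! ld ⊞ (DEM at ! ti)))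

checkEdge checkFit : Prog
checkEdge = loadAt ⨟ when (CAP at ! te ≺ ! ld) (ok ← const 0)
checkFit  = for te 1 0 (whenAll (usesᴱ (! task) (! te)) checkEdge)

-- `rounds` fills `ORD` and `RES` from cell n - 1 down to 0. The counter of this loop runs downwards
-- as well, so the index n - (1 + `tr`) visits 0 , 1 , ... and reverses the order of the rounds.
selectBody select : Prog
selectBody = (task ← ORD at (nᴱ ⊟ (const 1 ⊞ ! tr))) ⨟ (ok ← RES at (nᴱ ⊟ (const 1 ⊞ ! tr))) ⨟
  checkFit ⨟ when (! ok) (SEL [ ! task ]≔ const 1)
select     = for tr 0 0 selectBody

sumSelected : Prog
sumSelected = (total ← const 0) ⨟ for ti 0 0
  (whenAll ((SEL at ! ti) ∷ []) (total ← ! total ⊞ (PROFIT at ! ti)))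

-- Base n + 2, since an index is a task or one of the two walls. Nesting it addresses the sets in
-- `SOL`.
pairᴱ : Expr → Expr → Expr
pairᴱ e f = e ⊠ (nᴱ ⊞ const 2) ⊞ f

baseᴱ : Expr → Expr
baseᴱ i = (TOP at i) ⊟ (DEM at i)

-- Nonzero iff the rectangles do not overlap horizontally or one of them
-- lies above the other.
compatibleᴱ : Expr → Expr → Expr
compatibleᴱ i j = (END at j ≼ START at i) ⊞ (END at i ≼ START at j) ⊞
  (TOP at i ≼ baseᴱ j) ⊞ (TOP at j ≼ baseᴱ i)

eligibleᴱ : Expr → Expr → Expr → List Expr
eligibleᴱ P Q k =
  (TOP at k ≺ const 2 ⊠ (DEM at k)) ∷ (DEM at k ≼ TOP at k) ∷
  (POS at P ≺ POS at k) ∷ (POS at k ≺ POS at Q) ∷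
  (baseᴱ P ≼ baseᴱ k) ∷ (baseᴱ Q ≼ baseᴱ k) ∷
  compatibleᴱ k P ∷ compatibleᴱ k Q ∷ []

splitᴱ : Expr
splitᴱ = (PROFIT at ! tk) ⊞ ((VAL at pairᴱ (! tP) (! tk)) ⊞ (VAL at pairᴱ (! tk) (! tQ)))

-- `arg` is one more than the best split, so that 0 can mean that no split beats the stored value.
takeSplit trySplit findSplit : Prog
takeSplit = (val ← splitᴱ) ⨟ (arg ← const 1 ⊞ ! tk)
trySplit  = when (! val ≺ splitᴱ) takeSplit
findSplit = (val ← VAL at pairᴱ (! tP) (! tQ)) ⨟ (arg ← const 0) ⨟
  for tk 0 0 (whenAll (eligibleᴱ (! tP) (! tQ) (! tk)) trySplit)

-- Nonzero cells encode membership, so addition computes the union of the two stored sets.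
mergeAt merge : Prog
mergeAt = SOL [ pairᴱ (pairᴱ (! tP) (! tQ)) (! ti) ]≔
  (SOL at pairᴱ (pairᴱ (! tP) (! tk)) (! ti)) ⊞ (SOL at pairᴱ (pairᴱ (! tk) (! tQ)) (! ti))
merge   = for ti 0 0 mergeAt

store entry : Prog
store = (tk ← ! arg ⊟ const 1) ⨟ (VAL [ pairᴱ (! tP) (! tQ) ]≔ ! val) ⨟ merge ⨟
  (SOL [ pairᴱ (pairᴱ (! tP) (! tQ)) (! tk) ]≔ const 1)
entry = findSplit ⨟ when (! arg) store

-- A set of at most r rectangles is reached after r sweeps, whatever the order of the pairs, so n
-- sweeps suffice.
row sweep table : Prog
row   = for tQ 0 2 entry
sweep = for tP 0 2 row
table = for tr 0 0 sweep

wallsᴱ : Expr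
wallsᴱ = pairᴱ nᴱ (nᴱ ⊞ const 1)

copy choose : Prog
copy   = for ti 0 0 (SEL [ ! ti ]≔ SOL at pairᴱ wallsᴱ (! ti))
choose = when (! total ≺ VAL at wallsᴱ) copy

afterAnchors algorithm : Prog
afterAnchors = weights ⨟ rounds ⨟ select ⨟ sumSelected ⨟ table ⨟ choose
algorithm    = anchors ⨟ afterAnchors

algorithm-wellFormed : wellFormed algorithm ≡ true
algorithm-wellFormed = refl

-- Correctness of the search for the bottleneck edges

array-toℕ : ∀ {k} (f : Fin k → ℕ) i → array f (toℕ i) ≡ f i
array-toℕ {k} f i with toℕ i <? k
... | yes lt = cong f (fromℕ<-toℕ i lt)
... | no ≮   = contradiction (toℕ<n i) ≮

array-< : ∀ {k} (f : Fin k → ℕ) {j} (P : ℕ → Set) → j < k → (∀ i → P (f i)) → P (array f j)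
array-< {k} f {j} P lt h with j <? k
... | yes p = h (fromℕ< p)
... | no ≮  = contradiction lt ≮

array-≥ : ∀ {k} (f : Fin k → ℕ) {j} → k ≤ j → array f j ≡ 0
array-≥ {k} f {j} le with j <? k
... | yes p = contradiction p (≤⇒≯ le)
... | no _  = refl

≺-true : ∀ {x y} → y ∸ x ≢ 0 → x < y
≺-true {x} {y} h = m∸n≢0⇒n<m {y} {x} h

≺-false : ∀ {x y} → y ∸ x ≡ 0 → y ≤ x
≺-false {x} {y} h = m∸n≡0⇒m≤n {y} {x} h

<⇒≺ : ∀ {x y} → x < y → y ∸ x ≢ 0
<⇒≺ = m>n⇒m∸n≢0

≼-true : ∀ {x y} → suc y ∸ x ≢ 0 → x ≤ y
≼-true {x} {y} h = s≤s⁻¹ (≺-true {x} {suc y} h)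

≤⇒≼ : ∀ {x y} → x ≤ y → suc y ∸ x ≢ 0
≤⇒≼ h = <⇒≺ (s≤s h)

module Anchoring (I : UFPP) where
  open UFPP I renaming (start to startᶠ; end to endᶠ; demand to demandᶠ; profit to profitᶠ)

  c s t d p : ℕ → ℕ
  c = array capacity
  s = array (λ i → toℕ (startᶠ i))
  t = array (λ i → toℕ (endᶠ i))
  d = array demandᶠ
  p = array profitᶠ

  Input : State → Set
  Input σ = ∀ a → a ≤ 5 → ∀ i → σ a i ≡ initial I a i

  Input-frame : ∀ q {σ τ} → wellFormed q ≡ true → Frame q σ τ → Input σ → Input τ
  Input-frame q h fr inp a a≤5 i = trans (fr (inputs-unwritten q h a a≤5) i) (inp a a≤5 i)

  module Read {σ : State} (inp : Input σ) where
    n≡ : σ 0 0 ≡ n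
    n≡ = inp 0 z≤n 0
    m≡ : σ 0 1 ≡ m
    m≡ = inp 0 z≤n 1
    c≡ : ∀ e → σ 1 e ≡ c e
    c≡ e = inp 1 (s≤s z≤n) e
    s≡ : ∀ i → σ 2 i ≡ s i
    s≡ i = inp 2 (s≤s (s≤s z≤n)) i
    t≡ : ∀ i → σ 3 i ≡ t i
    t≡ i = inp 3 (s≤s (s≤s (s≤s z≤n))) i
    d≡ : ∀ i → σ 4 i ≡ d i
    d≡ i = inp 4 (s≤s (s≤s (s≤s (s≤s z≤n)))) i
    p≡ : ∀ i → σ 5 i ≡ p i
    p≡ i = inp 5 ≤-refl i
    n+ : ∀ {c} → σ 0 0 + c ≡ n + c
    n+ {c} = cong (_+ c) n≡
    n+0 : σ 0 0 + 0 ≡ n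
    n+0 = trans (+-identityʳ _) n≡
    m+0 : σ 0 1 + 0 ≡ m
    m+0 = trans (+-identityʳ _) m≡

  s<t : ∀ i → i < n → s i < t i
  s<t i i<n = subst (λ j → s j < t j) (toℕ-fromℕ< i<n)
    (subst₂ _<_ (sym (array-toℕ _ (fromℕ< i<n))) (sym (array-toℕ _ (fromℕ< i<n))) (start<end (fromℕ< i<n)))

  t≤m : ∀ i → i < n → t i ≤ m
  t≤m i i<n = array-< (λ i → toℕ (endᶠ i)) (_≤ m) i<n λ j → s≤s⁻¹ (toℕ<n (endᶠ j))

  keyOf : ℕ → ℕ
  keyOf e = c e * m + e

  record IsAnchor (i a : ℕ) : Set where
    constructor isAnchor
    field
      s≤a : s i ≤ a
      a<t : a < t i
      lowest : ∀ e → s i ≤ e → e < t i → keyOf a ≤ keyOf e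

  findAnchor-correct : ∀ σ i → i < n → Input σ → σ ti 0 ≡ i → σ x 0 ≡ s i →
                       IsAnchor i (sem findAnchor σ x 0)
  findAnchor-correct σ i i<n inp σti σx =
    let p₁ , p₂ , p₃ = guarded-for-rule te 1 0 lowerᴱ (x ← ! te) σ m+0 Inv start hit miss in
    isAnchor p₁ p₂ λ e se et → p₃ e z≤n se et
    where
    open Read inp using (m+0)
    Inv : ℕ → State → Set
    -- The candidate always lies on the path of i, as does its initial value `s i`; it is minimal
    -- among the path edges from k on.
    Inv k τ = s i ≤ τ x 0 × τ x 0 < t i × (∀ e → k ≤ e → s i ≤ e → e < t i → keyOf (τ x 0) ≤ keyOf e)
    start : Inv m (σ [ te at 0 ≔ m ])
    start = ≤-reflexive (sym σx) , subst (_< t i) (sym σx) (s<t i i<n) ,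
      λ e m≤e _ e<ti → contradiction (≤-trans e<ti (t≤m i i<n)) (≤⇒≯ m≤e)
    module _ (k : ℕ) (τ : State) (fr : Frame findAnchor σ τ) where
      inpτ : Input τ
      inpτ = Input-frame findAnchor refl fr inp
      τti : τ ti 0 ≡ i
      τti = trans (fr refl 0) σti
      open Read inpτ
      s-eq : τ 2 (τ ti 0) ≡ s i
      s-eq = trans (s≡ _) (cong s τti)
      t-eq : τ 3 (τ ti 0) ≡ t i
      t-eq = trans (t≡ _) (cong t τti)
      key-eq : ∀ e → τ 1 e * τ 0 1 + e ≡ keyOf e
      key-eq e = cong₂ (λ a b → a * b + e) (c≡ e) m≡
    hit : Hit te lowerᴱ (x ← ! te) m (Frame findAnchor σ) Inv
    hit k τ k<m fr (p₁ , p₂ , p₃) (h₁ ∷ h₂ ∷ h₃ ∷ []) =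
      subst (_≤ k) (s-eq k τ fr) (≼-true h₁) ,
      subst (k <_) (t-eq k τ fr) (≺-true h₂) ,
      λ e k≤e se et → case m≤n⇒m<n∨m≡n k≤e of λ where
        (inj₁ k<e)  → ≤-trans (<⇒≤ key<) (p₃ e k<e se et)
        (inj₂ refl) → ≤-refl
      where
      key< : keyOf k < keyOf (τ x 0)
      key< = subst₂ _<_ (key-eq k τ fr k) (key-eq k τ fr (τ x 0)) (≺-true h₃)
    miss : Miss te lowerᴱ m (Frame findAnchor σ) Inv
    miss k τ k<m fr (p₁ , p₂ , p₃) ¬h = p₁ , p₂ , λ e k≤e se et → case m≤n⇒m<n∨m≡n k≤e of λ where
        (inj₁ k<e)  → p₃ e k<e se et
        (inj₂ refl) → ≮⇒≥ λ key< → ¬h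
          (≤⇒≼ (subst (_≤ k) (sym (s-eq k τ fr)) se) ∷ <⇒≺ (subst (k <_) (sym (t-eq k τ fr)) et) ∷
           <⇒≺ (subst₂ _<_ (sym (key-eq k τ fr k)) (sym (key-eq k τ fr (τ x 0))) key<) ∷ [])

  record Anchored (i pos top key : ℕ) : Set where
    constructor anchored
    field
      anchor : ℕ
      is-anchor : IsAnchor i anchor
      pos≡ : pos ≡ suc anchor
      top≡ : top ≡ c anchor
      key≡ : key ≡ keyOf anchor

  record AnchorsFound (σ : State) : Set where
    field
      found : ∀ i → i < n → Anchored i (σ POS i) (σ TOP i) (σ KEY i)
      top-wall : ∀ i → n ≤ i → σ TOP i ≡ 0
      left-wall : σ POS n ≡ 0
      right-wall : σ POS (suc n) ≡ suc m

  anchors-correct : AnchorsFound (sem anchors (initial I))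
  anchors-correct = record
    { found = λ i i<n → subst (λ z → Anchored i z (σ₁ TOP i) (σ₁ KEY i)) (sym (below i i<n)) (proj₁ looped i z≤n i<n)
    ; top-wall = λ i n≤i → proj₂ (proj₂ looped i n≤i)
    -- No store reaches cell n of `POS`: the loop writes below n and the last store goes to n + 1.
    -- The left wall is the initial 0.
    ; left-wall = trans (if-cell (_≡ σ₁ POS n) n (suc (σ₁ 0 0)) (λ n≡ → contradiction (trans n≡ (cong suc n-eq)) (<⇒≢ ≤-refl)) (λ _ → refl))
        (proj₁ (proj₂ looped n ≤-refl))
    ; right-wall = if-cell (_≡ suc m) (suc n) (suc (σ₁ 0 0)) (λ _ → cong suc (Read.m≡ inp₁)) (λ ≢ → contradiction (cong suc (sym n-eq)) ≢) }
    where
    loop = for ti 0 0 anchorBody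
    inp₀ : Input (initial I)
    inp₀ a _ i = refl
    σ₁ = sem loop (initial I)
    inp₁ : Input σ₁
    inp₁ = Input-frame loop refl (frame loop (initial I)) inp₀
    n-eq : σ₁ 0 0 ≡ n
    n-eq = Read.n≡ inp₁
    Inv : ℕ → State → Set
    Inv k τ = (∀ i → k ≤ i → i < n → Anchored i (τ POS i) (τ TOP i) (τ KEY i)) ×
      (∀ i → n ≤ i → τ POS i ≡ 0 × τ TOP i ≡ 0)
    step : Step ti anchorBody n (Frame loop (initial I)) Inv
    step k τ k<n fr (done , rest) = done′ , rest′
      where
      inpτ : Input τ
      inpτ = Input-frame loop refl fr inp₀
      τ₁ = sem (x ← START at ! ti) (τ [ ti at 0 ≔ k ])
      inp₁′ : Input τ₁
      inp₁′ 0 h = inpτ 0 h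
      inp₁′ 1 h = inpτ 1 h
      inp₁′ 2 h = inpτ 2 h
      inp₁′ 3 h = inpτ 3 h
      inp₁′ 4 h = inpτ 4 h
      inp₁′ 5 h = inpτ 5 h
      inp₁′ (suc (suc (suc (suc (suc (suc _)))))) (s≤s (s≤s (s≤s (s≤s (s≤s ())))))
      τ₂ = sem findAnchor τ₁
      fr₂ : Frame findAnchor τ₁ τ₂
      fr₂ = frame findAnchor τ₁
      inp₂ : Input τ₂
      inp₂ = Input-frame findAnchor refl fr₂ inp₁′
      ti₂ : τ₂ ti 0 ≡ k
      ti₂ = fr₂ refl 0
      is-anchor : IsAnchor k (τ₂ x 0)
      is-anchor = findAnchor-correct τ₁ k k<n inp₁′ refl (Read.s≡ inpτ k)
      τ₃ = sem anchorBody (τ [ ti at 0 ≔ k ])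
      new : Anchored k (suc (τ₂ x 0)) (τ₂ 1 (τ₂ x 0)) (τ₂ 1 (τ₂ x 0) * τ₂ 0 1 + τ₂ x 0)
      new = anchored (τ₂ x 0) is-anchor refl (Read.c≡ inp₂ _)
        (cong₂ (λ a b → a * b + τ₂ x 0) (Read.c≡ inp₂ _) (Read.m≡ inp₂))
      cell : ∀ (Q : ℕ → ℕ → ℕ → Set) i → 
        (i ≡ k → Q (suc (τ₂ x 0)) (τ₂ 1 (τ₂ x 0)) (τ₂ 1 (τ₂ x 0) * τ₂ 0 1 + τ₂ x 0)) →
        (i ≢ k → Q (τ POS i) (τ TOP i) (τ KEY i)) → Q (τ₃ POS i) (τ₃ TOP i) (τ₃ KEY i)
      cell Q i here there with i ≟ τ₂ ti 0
      ... | yes eq rewrite trans (cong (_≡ᵇ τ₂ ti 0) eq) (≡ᵇ-refl (τ₂ ti 0)) = here (trans eq ti₂)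
      ... | no neq rewrite ≡ᵇ-≢ neq | fr₂ {POS} refl i | fr₂ {TOP} refl i | fr₂ {KEY} refl i =
        there (neq ∘ λ e → trans e (sym ti₂))
      done′ : ∀ i → k ≤ i → i < n → Anchored i (τ₃ POS i) (τ₃ TOP i) (τ₃ KEY i)
      done′ i k≤i i<n = cell (Anchored i) i (λ { refl → new })
        (λ i≢k → done i (≤∧≢⇒< k≤i (i≢k ∘ sym)) i<n)
      rest′ : ∀ i → n ≤ i → τ₃ POS i ≡ 0 × τ₃ TOP i ≡ 0
      rest′ i n≤i = cell (λ a b _ → a ≡ 0 × b ≡ 0) i (λ { refl → contradiction k<n (≤⇒≯ n≤i) }) (λ _ → rest i n≤i)
    looped : Inv 0 σ₁
    looped = for-rule ti 0 0 anchorBody (initial I) (+-identityʳ n) Inv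
      ((λ i n≤i i<n → contradiction i<n (≤⇒≯ n≤i)) , λ i _ → refl , refl) step
    below : ∀ i → i < n → sem anchors (initial I) POS i ≡ σ₁ POS i
    below i i<n = if-cell (_≡ σ₁ POS i) i (suc (σ₁ 0 0))
      (λ i≡ → contradiction (trans i≡ (cong suc n-eq)) (<⇒≢ (m≤n⇒m≤1+n i<n))) (λ _ → refl)

+≢0 : ∀ x {y} → x + y ≢ 0 → x ≢ 0 ⊎ y ≢ 0
+≢0 zero    h = inj₂ h
+≢0 (suc x) h = inj₁ λ ()

+≢0ˡ : ∀ {x} y → x ≢ 0 → x + y ≢ 0
+≢0ˡ y h e = h (m+n≡0⇒m≡0 _ e)

+≢0ʳ : ∀ x {y} → y ≢ 0 → x + y ≢ 0
+≢0ʳ x h e = h (m+n≡0⇒n≡0 x e)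

-- Arrays whose initial zeros carry meaning: weight 0 for large tasks, no task done or selected, and
-- a table of empty sets of value 0.
record Fresh (σ : State) : Set where
  field
    weight≡0 : ∀ i → σ WEIGHT i ≡ 0
    done≡0   : ∀ i → σ DONE i ≡ 0
    sel≡0    : ∀ i → σ SEL i ≡ 0
    val≡0    : ∀ i → σ VAL i ≡ 0
    sol≡0    : ∀ i → σ SOL i ≡ 0

-- Correctness of the local-ratio phases

module Correctness (I : UFPP) (σA : State) (anchors-found : Anchoring.AnchorsFound I σA) where
  open UFPP I using (n; m; demand>0)
  open Anchoring I
  open AnchorsFound anchors-found

  anchorOf : ℕ → ℕ
  anchorOf i = σA POS i ∸ 1

  anchorOf≡ : ∀ i i<n → anchorOf i ≡ Anchored.anchor (found i i<n)
  anchorOf≡ i i<n = cong (_∸ 1) (Anchored.pos≡ (found i i<n))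

  anchorOf-is-anchor : ∀ i → i < n → IsAnchor i (anchorOf i)
  anchorOf-is-anchor i i<n = subst (IsAnchor i) (sym (anchorOf≡ i i<n)) (Anchored.is-anchor (found i i<n))

  A : Tasks
  A = record
    { n = n ; m = m ; c = c ; s = s ; t = t ; d = d ; anchor = anchorOf
    ; s≤anchor = λ i i<n → IsAnchor.s≤a (anchorOf-is-anchor i i<n)
    ; anchor<t = λ i i<n → IsAnchor.a<t (anchorOf-is-anchor i i<n)
    ; t≤m = t≤m
    ; lowest = λ i i<n → IsAnchor.lowest (anchorOf-is-anchor i i<n)
    ; d>0 = λ i i<n → array-< _ (0 <_) i<n demand>0 }

  open Tasks A using (b; key; anchor; bottom; overlaps; uses; load; Feas; overlaps-intro; overlaps-elim; uses-intro; uses-elim)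

  W : Walled A
  W = record
    { position = σA POS ; top = σA TOP
    ; position≡ = λ i i<n → trans (Anchored.pos≡ (found i i<n)) (cong suc (sym (anchorOf≡ i i<n)))
    ; top≡ = λ i i<n → trans (Anchored.top≡ (found i i<n)) (cong c (sym (anchorOf≡ i i<n)))
    ; top-wall = top-wall
    ; t-wall = λ i n≤i → array-≥ _ n≤i
    ; left-wall = left-wall
    ; right-wall = right-wall }

  open Walled W using (position; top; top≡)
  open LocalRatio A

  key≡ : ∀ i → i < n → σA KEY i ≡ key (anchor i)
  key≡ i i<n = trans (Anchored.key≡ (found i i<n)) (cong keyOf (sym (anchorOf≡ i i<n)))

  record Context (σ : State) : Set where
    field
      input : Input σ
      pos-kept : ∀ i → σ POS i ≡ σA POS i
      top-kept : ∀ i → σ TOP i ≡ σA TOP i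
      key-kept : ∀ i → σ KEY i ≡ σA KEY i
    open Read input public

  open Context

  keeps : Prog → Bool
  keeps q = wellFormed q ∧ not (writes POS q) ∧ not (writes TOP q) ∧ not (writes KEY q)

  Context-frame : ∀ q {σ τ} → keeps q ≡ true → Frame q σ τ → Context σ → Context τ
  Context-frame q h fr ctx =
    let h₀ , h′ = ∧-split h ; h₁ , h″ = ∧-split h′ ; h₂ , h₃ = ∧-split h″ in record
    { input = Input-frame q h₀ fr (input ctx)
    ; pos-kept = λ i → trans (fr (not-true h₁) i) (pos-kept ctx i)
    ; top-kept = λ i → trans (fr (not-true h₂) i) (top-kept ctx i)
    ; key-kept = λ i → trans (fr (not-true h₃) i) (key-kept ctx i) }

  Context-sem : ∀ q {σ} → keeps q ≡ true → Context σ → Context (sem q σ)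
  Context-sem q k = Context-frame q k (frame q _)

  isSmall : ℕ → Bool
  isSmall i = 2 * d i ≤ᵇ b i

  w₀ : ℕ → ℕ
  w₀ i = on (isSmall i) (p i)

  weights-correct : ∀ σ → Context σ → (∀ i → σ WEIGHT i ≡ 0) → ∀ i → i < n → sem weights σ WEIGHT i ≡ w₀ i
  weights-correct σ ctx zeros i i<n = proj₁ (guarded-for-rule ti 0 0 guards body σ (n+0 ctx) Inv
      ((λ i n≤i i<n → contradiction i<n (≤⇒≯ n≤i)) , λ i _ → zeros i) hit miss) i z≤n i<n
    where
    guards = (const 2 ⊠ (DEM at ! ti) ≼ TOP at ! ti) ∷ []
    body = WEIGHT [ ! ti ]≔ PROFIT at ! ti
    Inv : ℕ → State → Set
    Inv k τ = (∀ i → k ≤ i → i < n → τ WEIGHT i ≡ w₀ i) × (∀ i → i < k → τ WEIGHT i ≡ 0)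
    module _ (k : ℕ) (τ : State) (k<n : k < n) (fr : Frame weights σ τ) where
      ctxτ : Context τ
      ctxτ = Context-frame weights refl fr ctx
      top-eq : τ TOP k ≡ b k
      top-eq = trans (top-kept ctxτ k) (top≡ k k<n)
      d-eq : 2 * τ DEM k ≡ 2 * d k
      d-eq = cong (2 *_) (d≡ ctxτ k)
    hit : Hit ti guards body n (Frame weights σ) Inv
    hit k τ k<n fr (done , rest) (h ∷ []) =
      (λ i k≤i i<n → if-cell (_≡ w₀ i) i k (λ { refl → trans (p≡ (ctxτ k τ k<n fr) k) (cong (λ b → on b (p k)) (sym small)) })
        (λ i≢k → done i (≤∧≢⇒< k≤i (i≢k ∘ sym)) i<n)) ,
      λ i i<k → if-cell (_≡ 0) i k (λ { refl → contradiction i<k (<-irrefl refl) }) (λ _ → rest i (m≤n⇒m≤1+n i<k))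
      where
      small : isSmall k ≡ true
      small = ≤ᵇ-complete (subst₂ _≤_ (d-eq k τ k<n fr) (top-eq k τ k<n fr) (≼-true h))
    miss : Miss ti guards n (Frame weights σ) Inv
    miss k τ k<n fr (done , rest) ¬h = (λ i k≤i i<n → case m≤n⇒m<n∨m≡n k≤i of λ where
        (inj₁ k<i) → done i k<i i<n
        (inj₂ refl) → trans (rest k ≤-refl) (cong (λ b → on b (p k)) (sym large))) ,
      λ i i<k → rest i (m≤n⇒m≤1+n i<k)
      where
      large : isSmall k ≡ false
      large with isSmall k in eq
      ... | false = refl
      ... | true = contradiction (≤⇒≼ (subst₂ _≤_ (sym (d-eq k τ k<n fr)) (sym (top-eq k τ k<n fr)) (≤ᵇ-sound {2 * d k} eq)) ∷ []) ¬h

  remaining : State → PSet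
  remaining σ i = σ DONE i ≡ᵇ 0

  record Highest (σ : State) (j : ℕ) : Set where
    constructor isHighest
    field
      j<n : j < n
      open′ : remaining σ j ≡ true
      highest : ∀ i → i < n → remaining σ i ≡ true → σA KEY i ≤ σA KEY j

  findHighest-correct : ∀ σ {i} → Context σ → i < n → remaining σ i ≡ true → Highest σ (sem findHighest σ task 0)
  findHighest-correct σ {i₀} ctx i₀<n Ri₀ = conclude {sem loop σ′}
    (guarded-for-rule ti 0 0 higherᴱ body σ′ (n+0 ctx) Inv
      ((λ i n≤i i<n → contradiction i<n (≤⇒≯ n≤i)) , inj₁ (refl , λ i n≤i i<n → contradiction i<n (≤⇒≯ n≤i))) hit miss)
    where
    σ′ = sem (best ← const 0) σ
    body = (task ← ! ti) ⨟ (best ← KEY at ! ti)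
    loop = for ti 0 0 (whenAll higherᴱ body)
    Inv : ℕ → State → Set
    -- `task` is meaningless until the loop meets a waiting task; the first alternative describes
    -- the time before that.
    Inv k τ = (∀ i → k ≤ i → i < n → remaining σ i ≡ true → σA KEY i ≤ τ best 0) ×
      ((τ best 0 ≡ 0 × (∀ i → k ≤ i → i < n → remaining σ i ≡ false)) ⊎
       (τ task 0 < n × remaining σ (τ task 0) ≡ true × σA KEY (τ task 0) ≡ τ best 0))
    conclude : ∀ {τ} → Inv 0 τ → Highest σ (τ task 0)
    conclude (_ , inj₁ (_ , none)) = clash (none i₀ z≤n i₀<n) Ri₀
    conclude (best≥ , inj₂ (j<n , Rj , eq)) = isHighest j<n Rj λ i i<n Ri → ≤-trans (best≥ i z≤n i<n Ri) (≤-reflexive (sym eq))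
    module _ (k : ℕ) (τ : State) (fr : Frame loop σ′ τ) where
      key-eq : τ KEY k ≡ σA KEY k
      key-eq = trans (fr refl k) (key-kept ctx k)
      done-eq : τ DONE k ≡ σ DONE k
      done-eq = fr refl k
    hit : Hit ti higherᴱ body n (Frame loop σ′) Inv
    hit k τ k<n fr (best≥ , _) (h₁ ∷ h₂ ∷ []) =
      (λ i k≤i i<n Ri → case m≤n⇒m<n∨m≡n k≤i of λ where
        (inj₁ k<i) → ≤-trans (best≥ i k<i i<n Ri) (≼-true h₂)
        (inj₂ refl) → ≤-reflexive (sym (key-eq k τ fr))) ,
      inj₂ (k<n , undone , sym (key-eq k τ fr))
      where
      undone : remaining σ k ≡ true
      undone with σ DONE k | done-eq k τ fr
      ... | zero  | _ = refl
      ... | suc x | e = contradiction (trans (cong (1 ∸_) e) (0∸n≡0 x)) h₁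
    miss : Miss ti higherᴱ n (Frame loop σ′) Inv
    miss k τ k<n fr (best≥ , attained) ¬h =
      (λ i k≤i i<n Ri → case m≤n⇒m<n∨m≡n k≤i of λ where
        (inj₁ k<i) → best≥ i k<i i<n Ri
        (inj₂ refl) → <⇒≤ (skipped Ri)) ,
      attained′ attained
      where
      undone : remaining σ k ≡ true → 1 ∸ τ DONE k ≢ 0
      undone Rk h = case trans (sym h) (cong (1 ∸_) (trans (done-eq k τ fr) (≡ᵇ-sound Rk))) of λ ()
      skipped : remaining σ k ≡ true → σA KEY k < τ best 0
      skipped Rk = ≰⇒> λ best≤ → ¬h (undone Rk ∷ ≤⇒≼ (subst (τ best 0 ≤_) (sym (key-eq k τ fr)) best≤) ∷ [])
      done : τ best 0 ≡ 0 → remaining σ k ≡ false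
      done best≡0 with remaining σ k in eq
      ... | false = refl
      ... | true = contradiction (subst (σA KEY k <_) best≡0 (skipped eq)) λ ()
      attained′ : _ → _
      attained′ (inj₂ h) = inj₂ h
      attained′ (inj₁ (best≡0 , none)) = inj₁ (best≡0 , λ i k≤i i<n → case m≤n⇒m<n∨m≡n k≤i of λ where
        (inj₁ k<i) → none i k<i i<n
        (inj₂ refl) → done best≡0)

  reduce-correct : ∀ σ {w j} → Context σ → j < n → σ task 0 ≡ j → σ wt 0 ≡ w j →
    (∀ i → i < n → σ WEIGHT i ≡ w i) → ∀ i → i < n → sem reduce σ WEIGHT i ≡ residual j w i
  reduce-correct σ {w} {j} ctx j<n task≡ wt≡ same i i<n = proj₁ (for-rule ti 0 0 body σ (n+0 ctx) Inv
      ((λ i n≤i i<n → contradiction i<n (≤⇒≯ n≤i)) , same) step) i z≤n i<n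
    where
    body = scale ⨟ whenAll overlapᴱ subtract
    Inv : ℕ → State → Set
    Inv k τ = (∀ i → k ≤ i → i < n → τ WEIGHT i ≡ residual j w i) × (∀ i → i < k → τ WEIGHT i ≡ w i)
    step : Step ti body n (Frame reduce σ) Inv
    step k τ k<n fr (done , rest) = whenAll-rule overlapᴱ subtract τ₁ (Inv k) hit miss
      where
      τ₁ = sem scale (τ [ ti at 0 ≔ k ])
      ctxτ : Context τ
      ctxτ = Context-frame reduce refl fr ctx
      taskτ : τ task 0 ≡ j
      taskτ = trans (fr refl 0) task≡
      scaled : τ WEIGHT k * (τ CAP (τ POS (τ task 0) ∸ 1) ∸ τ DEM (τ task 0)) ≡ w k * bottom j
      scaled = cong₂ _*_ (rest k ≤-refl) (cong₂ _∸_
        (trans (c≡ ctxτ _) (cong (λ a → c (a ∸ 1)) (trans (pos-kept ctxτ _) (cong (σA POS) taskτ))))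
        (trans (d≡ ctxτ _) (cong d taskτ)))
      tj : τ END (τ task 0) ≡ t j
      tj = trans (t≡ ctxτ _) (cong t taskτ)
      sj : τ START (τ task 0) ≡ s j
      sj = trans (s≡ ctxτ _) (cong s taskτ)
      τ₁-k : τ₁ WEIGHT k ≡ w k * bottom j
      τ₁-k = trans (update-cell (τ [ ti at 0 ≔ k ]) WEIGHT k _) scaled
      τ₁-other : ∀ i → i ≢ k → τ₁ WEIGHT i ≡ τ WEIGHT i
      τ₁-other i i≢k = update-other-cell (τ [ ti at 0 ≔ k ]) WEIGHT _ i≢k
      hit : All (λ e → ⟦ e ⟧ τ₁ ≢ 0) overlapᴱ → Inv k (sem subtract τ₁)
      hit (h₁ ∷ h₂ ∷ []) =
        (λ i k≤i i<n → if-cell (_≡ residual j w i) i k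
          (λ { refl → cong₂ _∸_ τ₁-k (trans (cong₂ _*_ (trans (fr refl 0) wt≡) (d≡ ctxτ k)) (cong (λ b → on b (w j * d k)) (sym ov))) })
          (λ i≢k → trans (τ₁-other i i≢k) (done i (≤∧≢⇒< k≤i (i≢k ∘ sym)) i<n))) ,
        λ i i<k → if-cell (_≡ w i) i k (λ { refl → contradiction i<k (<-irrefl refl) })
          (λ i≢k → trans (τ₁-other i i≢k) (rest i (m≤n⇒m≤1+n i<k)))
        where
        ov : overlaps k j ≡ true
        ov = overlaps-intro {k} {j} (subst₂ _<_ (s≡ ctxτ k) tj (≺-true h₁)) (subst₂ _<_ sj (t≡ ctxτ k) (≺-true h₂))
      miss : ¬ All (λ e → ⟦ e ⟧ τ₁ ≢ 0) overlapᴱ → Inv k τ₁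
      miss ¬h = (λ i k≤i i<n → case m≤n⇒m<n∨m≡n k≤i of λ where
          (inj₁ k<i) → trans (τ₁-other i (<⇒≢ k<i ∘ sym)) (done i k<i i<n)
          (inj₂ refl) → trans τ₁-k (cong (λ b → w k * bottom j ∸ on b (w j * d k)) (sym ov))) ,
        λ i i<k → trans (τ₁-other i (<⇒≢ i<k)) (rest i (m≤n⇒m≤1+n i<k))
        where
        ov : overlaps k j ≡ false
        ov with overlaps k j in eq
        ... | false = refl
        ... | true with q₁ , q₂ ← overlaps-elim {k} {j} eq = contradiction
          (<⇒≺ (subst₂ _<_ (sym (s≡ ctxτ k)) (sym tj) q₁) ∷ <⇒≺ (subst₂ _<_ (sym sj) (sym (t≡ ctxτ k)) q₂) ∷ []) ¬h

  Context-set : ∀ {τ a} i x → 9 < a → Context τ → Context (τ [ a at i ≔ x ])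
  Context-set {τ} {a} i x 9<a ctx = record
    { input = λ a′ a′≤5 j → trans (kept (≤-trans a′≤5 (m≤m+n 5 4)) j) (input ctx a′ a′≤5 j)
    ; pos-kept = λ j → trans (kept (n≤1+n 8) j) (pos-kept ctx j)
    ; top-kept = λ j → trans (kept ≤-refl j) (top-kept ctx j)
    ; key-kept = λ j → trans (kept (m≤m+n 7 2) j) (key-kept ctx j) }
    where
    kept : ∀ {a′} → a′ ≤ 9 → ∀ j → (τ [ a at i ≔ x ]) a′ j ≡ τ a′ j
    kept a′≤9 = update-other τ i x (≡ᵇ-≢ (<⇒≢ (≤-<-trans a′≤9 9<a)))

  all : PSet
  all _ = true

  -- Trace ord res k w R: the rounds n − 1 , … , k of the first phase have
  -- picked the tasks ord (n − 1) , … , ord k with residual weights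
  -- res (n − 1) , … , res k, leaving the weights w for the tasks in R.
  data Trace (ord res : ℕ → ℕ) : ℕ → (ℕ → ℕ) → PSet → Set where
    no-rounds : Trace ord res n w₀ all
    skip-round : ∀ {k w R j} → Trace ord res (suc k) w R → ord k ≡ j → j < n → R j ≡ true →
      w j ≡ 0 → res k ≡ 0 → Trace ord res k w (R ∖ j)
    reduce-round : ∀ {k w R j} → Trace ord res (suc k) w R → ord k ≡ j → j < n → R j ≡ true →
      w j ≢ 0 → res k ≢ 0 → 2 * d j ≤ b j →
      (∀ i → i < n → R i ≡ true → key (anchor i) ≤ key (anchor j)) →
      Trace ord res k (residual j w) (R ∖ j)

  Trace-cong : ∀ {ord ord′ res res′ k w R} → (∀ i → k ≤ i → ord i ≡ ord′ i × res i ≡ res′ i) →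
               Trace ord res k w R → Trace ord′ res′ k w R
  Trace-cong h no-rounds = no-rounds
  Trace-cong h (skip-round tr o q₁ q₂ q₃ q₄) = skip-round (Trace-cong (λ i le → h i (≤-trans (n≤1+n _) le)) tr)
    (trans (sym (proj₁ (h _ ≤-refl))) o) q₁ q₂ q₃ (trans (sym (proj₂ (h _ ≤-refl))) q₄)
  Trace-cong h (reduce-round tr o q₁ q₂ q₃ q₄ q₅ q₆) = reduce-round (Trace-cong (λ i le → h i (≤-trans (n≤1+n _) le)) tr)
    (trans (sym (proj₁ (h _ ≤-refl))) o) q₁ q₂ q₃ (q₄ ∘ trans (proj₂ (h _ ≤-refl))) q₅ q₆

  -- `count` guarantees that a waiting task exists whenever a round begins. `small` makes every
  -- reducing round a round of a small task, as `Trace` demands.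
  record RoundInvariant (k : ℕ) (τ : State) : Set where
    field
      w : ℕ → ℕ
      R : PSet
      trace : Trace (τ ORD) (τ RES) k w R
      weight≡ : ∀ i → i < n → τ WEIGHT i ≡ w i
      remaining≡ : ∀ i → i < n → remaining τ i ≡ R i
      small : ∀ i → i < n → w i ≢ 0 → 2 * d i ≤ b i
      count : size n R ≡ k

  open RoundInvariant

  rounds-correct : ∀ σ → Context σ → (∀ i → i < n → σ WEIGHT i ≡ w₀ i) → (∀ i → σ DONE i ≡ 0) →
                   RoundInvariant 0 (sem rounds σ)
  rounds-correct σ ctx same zeros = for-rule tr 0 0 round σ (n+0 ctx) RoundInvariant
    (record { w = w₀ ; R = all ; trace = no-rounds ; weight≡ = same ; remaining≡ = λ i _ → cong (_≡ᵇ 0) (zeros i)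
            ; small = small₀ ; count = trans (sumTo-const n 1) (*-identityʳ n) }) step
    where
    small₀ : ∀ i → i < n → w₀ i ≢ 0 → 2 * d i ≤ b i
    small₀ i i<n h with isSmall i in eq
    ... | true  = ≤ᵇ-sound eq
    ... | false = contradiction refl h
    step : Step tr round n (Frame rounds σ) RoundInvariant
    step k τ k<n fr inv = when-rule (! wt) reduce σ₅ (RoundInvariant k) reduced skipped
      where
      ctxτ : Context τ
      ctxτ = Context-frame rounds refl fr ctx
      σ₀ σ₁ σ₅ : State
      σ₀ = τ [ tr at 0 ≔ k ]
      σ₁ = sem findHighest σ₀
      σ₅ = sem ((DONE [ ! task ]≔ const 1) ⨟ (wt ← WEIGHT at ! task) ⨟
             (ORD [ ! tr ]≔ ! task) ⨟ (RES [ ! tr ]≔ ! wt)) σ₁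
      ctx₀ : Context σ₀
      ctx₀ = Context-set 0 k (m≤m+n 10 _) ctxτ
      fr₁ : Frame findHighest σ₀ σ₁
      fr₁ = frame findHighest σ₀
      some : Σ[ i ∈ ℕ ] i < n × remaining σ₀ i ≡ true
      some with member? n (R inv)
      ... | inj₁ (i , i<n , Ri) = i , i<n , trans (remaining≡ inv i i<n) Ri
      ... | inj₂ none = contradiction (trans (sym (count inv)) (sumOver-empty n (λ _ → 1) none)) λ ()
      j : ℕ
      j = σ₁ task 0
      picked : Highest σ₀ j
      picked = findHighest-correct σ₀ ctx₀ (proj₁ (proj₂ some)) (proj₂ (proj₂ some))
      open Highest picked
      Rj : R inv j ≡ true
      Rj = trans (sym (remaining≡ inv j j<n)) open′
      r₁ : σ₁ tr 0 ≡ k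
      r₁ = fr₁ refl 0
      weight₁ : ∀ i → i < n → σ₁ WEIGHT i ≡ w inv i
      weight₁ i i<n = trans (fr₁ refl i) (weight≡ inv i i<n)
      ctx₅ : Context σ₅
      ctx₅ = Context-sem ((DONE [ ! task ]≔ const 1) ⨟ (wt ← WEIGHT at ! task) ⨟
             (ORD [ ! tr ]≔ ! task) ⨟ (RES [ ! tr ]≔ ! wt)) refl
             (Context-sem findHighest refl ctx₀)
      ord-k : σ₅ ORD k ≡ j
      ord-k = if-cell (_≡ j) k (σ₁ tr 0) (λ _ → refl) (λ ≢ → contradiction (sym r₁) ≢)
      res-k : σ₅ RES k ≡ w inv j
      res-k = if-cell (_≡ w inv j) k (σ₁ tr 0) (λ _ → weight₁ j j<n) (λ ≢ → contradiction (sym r₁) ≢)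
      later : ∀ i → suc k ≤ i → τ ORD i ≡ σ₅ ORD i × τ RES i ≡ σ₅ RES i
      later i k<i =
        if-cell (τ ORD i ≡_) i (σ₁ tr 0) (λ e → contradiction (trans e r₁) (<⇒≢ k<i ∘ sym)) (λ _ → sym (fr₁ refl i)) ,
        if-cell (τ RES i ≡_) i (σ₁ tr 0) (λ e → contradiction (trans e r₁) (<⇒≢ k<i ∘ sym)) (λ _ → sym (fr₁ refl i))
      trace₅ : Trace (σ₅ ORD) (σ₅ RES) (suc k) (w inv) (R inv)
      trace₅ = Trace-cong later (trace inv)
      remaining₅ : ∀ i → i < n → remaining σ₅ i ≡ (R inv ∖ j) i
      remaining₅ i i<n = if-cell (λ x → (x ≡ᵇ 0) ≡ (R inv ∖ j) i) i j
        (λ { refl → sym (trans (cong (R inv i ∧_) (cong not (≡ᵇ-refl i))) (∧-zeroʳ (R inv i))) })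
        (λ i≢j → trans (cong (_≡ᵇ 0) (fr₁ refl i)) (trans (remaining≡ inv i i<n)
          (sym (trans (cong (λ z → R inv i ∧ not z) (≡ᵇ-≢ i≢j)) (∧-identityʳ (R inv i))))))
      count₅ : size n (R inv ∖ j) ≡ k
      count₅ = suc-injective (trans (sym (sumOver-remove (λ _ → 1) j<n Rj)) (count inv))
      skipped : σ₅ wt 0 ≡ 0 → RoundInvariant k σ₅
      skipped h = record
        { w = w inv ; R = R inv ∖ j
        ; trace = skip-round trace₅ ord-k j<n Rj wj≡0 (trans res-k wj≡0)
        ; weight≡ = weight₁ ; remaining≡ = remaining₅ ; small = small inv ; count = count₅ }
        where
        wj≡0 : w inv j ≡ 0
        wj≡0 = trans (sym (weight₁ j j<n)) h
      reduced : σ₅ wt 0 ≢ 0 → RoundInvariant k (sem reduce σ₅)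
      reduced h = record
        { w = residual j (w inv) ; R = R inv ∖ j
        ; trace = Trace-cong (λ i _ → sym (frame reduce σ₅ {ORD} refl i) , sym (frame reduce σ₅ {RES} refl i))
            (reduce-round trace₅ ord-k j<n Rj wj≢0 (wj≢0 ∘ trans (sym res-k)) (small inv j j<n wj≢0)
              λ i i<n Ri → subst₂ _≤_ (key≡ i i<n) (key≡ j j<n) (highest i i<n (trans (remaining≡ inv i i<n) Ri)))
        ; weight≡ = reduce-correct σ₅ ctx₅ j<n refl (weight₁ j j<n) weight₁
        ; remaining≡ = λ i i<n → trans (cong (_≡ᵇ 0) (frame reduce σ₅ {DONE} refl i)) (remaining₅ i i<n)
        -- Weight 0 stays 0 under scaling and truncated subtraction, so large tasks never acquire
        -- weight.
        ; small = λ i i<n w′≢0 → small inv i i<n λ wi≡0 → w′≢0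
            (trans (cong (λ z → z * bottom j ∸ on (overlaps i j) (w inv j * d i)) wi≡0) (0∸n≡0 (on (overlaps i j) (w inv j * d i))))
        ; count = count₅ }
        where
        wj≢0 : w inv j ≢ 0
        wj≢0 e = h (trans (weight₁ j j<n) e)

  selected : State → PSet
  selected σ i = not (σ SEL i ≡ᵇ 0)

  ≢0⇒selected : ∀ {x} → x ≢ 0 → not (x ≡ᵇ 0) ≡ true
  ≢0⇒selected {zero}  h = contradiction refl h
  ≢0⇒selected {suc x} h = refl

  selected⇒≢0 : ∀ {x} → not (x ≡ᵇ 0) ≡ true → x ≢ 0
  selected⇒≢0 {suc x} h ()

  loadAt-correct : ∀ σ {e j} → Context σ → σ te 0 ≡ e → σ task 0 ≡ j →
                   sem loadAt σ ld 0 ≡ d j + load (selected σ) e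
  loadAt-correct σ {e} {j} ctx te≡ task≡ = trans (sym (+-identityʳ _))
    (guarded-for-rule ti 0 0 guards body σ′ (n+0 ctx) Inv
      (cong (_+ sumTo n f) (trans (d≡ ctx _) (cong d task≡))) hit miss)
    where
    guards = (SEL at ! ti) ∷ usesᴱ (! ti) (! te)
    body = ld ← ! ld ⊞ (DEM at ! ti)
    loop = for ti 0 0 (whenAll guards body)
    σ′ = sem (ld ← DEM at ! task) σ
    f : ℕ → ℕ
    f i = on (selected σ i ∧ uses i e) (d i)
    Inv : ℕ → State → Set
    -- The load accumulated so far and the load still to come have a constant sum.
    Inv k τ = τ ld 0 + sumTo k f ≡ d j + sumTo n f
    module _ (k : ℕ) (τ : State) (fr : Frame loop σ′ τ) where
      te-eq : τ te 0 ≡ e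
      te-eq = trans (fr refl 0) te≡
      s-eq : τ START k ≡ s k
      s-eq = trans (fr refl k) (s≡ ctx k)
      t-eq : τ END k ≡ t k
      t-eq = trans (fr refl k) (t≡ ctx k)
      d-eq : τ DEM k ≡ d k
      d-eq = trans (fr refl k) (d≡ ctx k)
    hit : Hit ti guards body n (Frame loop σ′) Inv
    hit k τ k<n fr inv (h₁ ∷ h₂ ∷ h₃ ∷ []) = trans (+-assoc (τ ld 0) _ _) (trans (cong (τ ld 0 +_)
      (trans (+-comm (τ DEM k) (sumTo k f)) (cong (sumTo k f +_) (trans (d-eq k τ fr) (cong (λ b → on b (d k)) (sym counted)))))) inv)
      where
      counted : selected σ k ∧ uses k e ≡ true
      counted = ∧-join (≢0⇒selected (h₁ ∘ trans (fr refl k)))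
        (uses-intro {k} (subst₂ _≤_ (s-eq k τ fr) (te-eq k τ fr) (≼-true h₂)) (subst₂ _<_ (te-eq k τ fr) (t-eq k τ fr) (≺-true h₃)))
    miss : Miss ti guards n (Frame loop σ′) Inv
    miss k τ k<n fr inv ¬h = trans (cong (τ ld 0 +_) (trans (sym (+-identityʳ _))
        (cong (λ b → sumTo k f + on b (d k)) (sym skipped)))) inv
      where
      skipped : selected σ k ∧ uses k e ≡ false
      skipped with selected σ k ∧ uses k e in eq
      ... | false = refl
      ... | true with sel , use ← ∧-split {selected σ k} eq with q₁ , q₂ ← uses-elim {k} use = contradiction
        ((selected⇒≢0 sel ∘ trans (sym (fr refl k))) ∷
         ≤⇒≼ (subst₂ _≤_ (sym (s-eq k τ fr)) (sym (te-eq k τ fr)) q₁) ∷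
         <⇒≺ (subst₂ _<_ (sym (te-eq k τ fr)) (sym (t-eq k τ fr)) q₂) ∷ []) ¬h

  Blocked : PSet → ℕ → Set
  Blocked S j = Σ[ e ∈ ℕ ] e < m × uses j e ≡ true × c e < load S e + d j

  checkFit-correct : ∀ σ {j} → Context σ → j < n → σ task 0 ≡ j →
    let S = selected σ ; τ = sem checkFit σ in
    (σ ok 0 ≡ 0 → τ ok 0 ≡ 0) ×
    (σ ok 0 ≢ 0 → (τ ok 0 ≢ 0 × Fits-in S j) ⊎ (τ ok 0 ≡ 0 × Blocked S j))
  checkFit-correct σ {j} ctx j<n task≡ =
    let q₁ , q₂ = guarded-for-rule te 1 0 guards checkEdge σ (m+0 ctx) Inv
          ((λ h → h) , λ h → inj₁ (h , λ e m≤e e<m → contradiction e<m (≤⇒≯ m≤e))) hit miss in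
    q₁ , λ h → case q₂ h of λ where
      (inj₁ (x , fits)) → inj₁ (x , λ e e<m → fits e z≤n e<m)
      (inj₂ x) → inj₂ x
    where
    S = selected σ
    guards = usesᴱ (! task) (! te)
    Inv : ℕ → State → Set
    Inv k τ = (σ ok 0 ≡ 0 → τ ok 0 ≡ 0) ×
      (σ ok 0 ≢ 0 → (τ ok 0 ≢ 0 × (∀ e → k ≤ e → e < m → uses j e ≡ true → load S e + d j ≤ c e)) ⊎
                    (τ ok 0 ≡ 0 × Blocked S j))
    module _ (k : ℕ) (τ : State) (fr : Frame checkFit σ τ) where
      ctxτ : Context τ
      ctxτ = Context-frame checkFit refl fr ctx
      task-eq : τ task 0 ≡ j
      task-eq = trans (fr refl 0) task≡
      s-eq : τ START (τ task 0) ≡ s j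
      s-eq = trans (s≡ ctxτ _) (cong s task-eq)
      t-eq : τ END (τ task 0) ≡ t j
      t-eq = trans (t≡ ctxτ _) (cong t task-eq)
    hit : Hit te guards checkEdge m (Frame checkFit σ) Inv
    hit k τ k<m fr (q₁ , q₂) (h₁ ∷ h₂ ∷ []) = when-rule (CAP at ! te ≺ ! ld) (ok ← const 0) τ₁ (Inv k) over under
      where
      τ₀ τ₁ : State
      τ₀ = τ [ te at 0 ≔ k ]
      τ₁ = sem loadAt τ₀
      ctx₀ : Context τ₀
      ctx₀ = Context-set 0 k (m≤m+n 10 _) (ctxτ k τ fr)
      use : uses j k ≡ true
      use = uses-intro {j} (subst (_≤ k) (s-eq k τ fr) (≼-true h₁)) (subst (k <_) (t-eq k τ fr) (≺-true h₂))
      S-same : ∀ i → selected τ₀ i ≡ S i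
      S-same i = cong (λ z → not (z ≡ᵇ 0)) (fr refl i)
      ld-eq : τ₁ ld 0 ≡ load S k + d j
      ld-eq = trans (loadAt-correct τ₀ ctx₀ refl (task-eq k τ fr)) (trans (+-comm (d j) _)
        (cong (_+ d j) (sumTo-cong n λ i _ → cong (λ z → on (z ∧ uses i k) (d i)) (S-same i))))
      c-eq : τ₁ CAP (τ₁ te 0) ≡ c k
      c-eq = trans (c≡ (Context-sem loadAt refl ctx₀) _) (cong c (frame loadAt τ₀ {te} refl 0))
      ok-eq : τ₁ ok 0 ≡ τ ok 0
      ok-eq = frame loadAt τ₀ {ok} refl 0
      over : ⟦ CAP at ! te ≺ ! ld ⟧ τ₁ ≢ 0 → Inv k (sem (ok ← const 0) τ₁)
      over h = (λ _ → refl) , λ _ → inj₂ (refl , k , k<m , use , subst₂ _<_ c-eq ld-eq (≺-true h))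
      under : ⟦ CAP at ! te ≺ ! ld ⟧ τ₁ ≡ 0 → Inv k τ₁
      under h = (λ z → trans ok-eq (q₁ z)) , λ z → under′ (q₂ z)
        where
        under′ : _ → _
        under′ (inj₂ (x , y)) = inj₂ (trans ok-eq x , y)
        under′ (inj₁ (x , fits)) = inj₁ ((λ z → x (trans (sym ok-eq) z)) , λ e k≤e e<m → case m≤n⇒m<n∨m≡n k≤e of λ where
          (inj₁ k<e) → fits e k<e e<m
          (inj₂ refl) → λ _ → subst₂ _≤_ ld-eq c-eq (≺-false {τ₁ CAP (τ₁ te 0)} h))
    miss : Miss te guards m (Frame checkFit σ) Inv
    miss k τ k<m fr (q₁ , q₂) ¬h = q₁ , λ z → miss′ (q₂ z)
      where
      miss′ : _ → _
      miss′ (inj₂ y) = inj₂ y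
      miss′ (inj₁ (x , fits)) = inj₁ (x , λ e k≤e e<m → case m≤n⇒m<n∨m≡n k≤e of λ where
        (inj₁ k<e) → fits e k<e e<m
        (inj₂ refl) use → let p , q = uses-elim {j} use in contradiction
          (≤⇒≼ (subst (_≤ k) (sym (s-eq k τ fr)) p) ∷ <⇒≺ (subst (k <_) (sym (t-eq k τ fr)) q) ∷ []) ¬h)

  Approximates-cong : ∀ {w R S S′} → (∀ i → i < n → S i ≡ S′ i) → Approximates w R S → Approximates w R S′
  Approximates-cong {w} {R} {S} {S′} h ap = record
    { within = λ i i<n S′i → within i i<n (trans (h i i<n) S′i)
    ; positive = λ i i<n S′i → positive i i<n (trans (h i i<n) S′i)
    ; feasible = λ e e<m → subst (_≤ c e) (sumTo-cong n λ i i<n → cong (λ z → on (z ∧ uses i e) (d i)) (h i i<n)) (feasible e e<m)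
    ; ratio = λ G G⊆R feas → subst (λ z → sumOver n G w ≤ 6 * z) (sumTo-cong n λ i i<n → cong (λ z → on z (w i)) (h i i<n)) (ratio G G⊆R feas) }
    where open Approximates ap

  -- Selection consumes the trace from its last round back: with the counter at q, the rounds n - 1
  -- , ... , n - q are still to be undone, and the current set approximates for the weights that
  -- these rounds left.
  record SelectInvariant (ord res : ℕ → ℕ) (q : ℕ) (τ : State) : Set where
    field
      {w} : ℕ → ℕ
      {R} : PSet
      trace : Trace ord res (n ∸ q) w R
      approximates : Approximates w R (selected τ)

  Trace-start : ∀ {ord res k w R} → Trace ord res k w R → k ≤ n × (k ≡ n → w ≡ w₀ × R ≡ all)
  Trace-start no-rounds = ≤-refl , λ _ → refl , refl
  Trace-start (skip-round tr _ _ _ _ _) = let le , _ = Trace-start tr in <⇒≤ le , λ { refl → contradiction le (<-irrefl refl) }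
  Trace-start (reduce-round tr _ _ _ _ _ _ _) = let le , _ = Trace-start tr in <⇒≤ le , λ { refl → contradiction le (<-irrefl refl) }

  select-correct : ∀ σ → Context σ → RoundInvariant 0 σ → (∀ i → σ SEL i ≡ 0) →
                   Approximates w₀ all (selected (sem select σ))
  select-correct σ ctx inv₀ zeros = conclude (for-rule tr 0 0 selectBody σ (n+0 ctx) (SelectInvariant ord res)
      (record { trace = subst (λ k → Trace ord res k (w inv₀) (R inv₀)) (sym (n∸n≡0 n)) (trace inv₀) ; approximates = initially }) step)
    where
    ord = σ ORD
    res = σ RES
    conclude : ∀ {τ} → SelectInvariant ord res 0 τ → Approximates w₀ all (selected τ)
    conclude {τ} inv with Trace-start (SelectInvariant.trace inv)
    ... | _ , h = subst₂ (λ w R → Approximates w R (selected τ)) (proj₁ (h refl)) (proj₂ (h refl)) (SelectInvariant.approximates inv)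
    empty : ∀ i → i < n → R inv₀ i ≡ false
    empty i i<n with R inv₀ i in eq
    ... | false = refl
    ... | true = contradiction (≤-trans (member≤sumOver (λ _ → 1) i<n eq) (≤-reflexive (count inv₀))) λ ()
    unselected : ∀ i → selected (σ [ tr at 0 ≔ n ]) i ≡ false
    unselected i = cong (λ z → not (z ≡ᵇ 0)) (zeros i)
    -- After n rounds no task is left, so only empty sets compete and the empty selection is
    -- optimal.
    initially : Approximates (w inv₀) (R inv₀) (selected (σ [ tr at 0 ≔ n ]))
    initially = record
      { within = λ i _ h → clash (unselected i) h
      ; positive = λ i _ h → clash (unselected i) h
      ; feasible = λ e _ → ≤-trans (≤-reflexive (sumOver-empty n d (λ i _ → cong (_∧ uses i e) (unselected i)))) z≤n
      ; ratio = λ G G⊆R _ → ≤-trans (≤-reflexive (sumOver-empty n (w inv₀) (outside G G⊆R))) z≤n }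
      where
      outside : ∀ G → _⊆_ n G (R inv₀) → ∀ i → i < n → G i ≡ false
      outside G G⊆R i i<n with G i in eq
      ... | false = refl
      ... | true = clash (empty i i<n) (G⊆R i i<n eq)
    step : Step tr selectBody n (Frame select σ) (SelectInvariant ord res)
    step q τ q<n fr inv = go (SelectInvariant.trace inv) refl (SelectInvariant.approximates inv)
      where
      k : ℕ
      k = n ∸ suc q
      next : suc k ≡ n ∸ q
      next = sym (+-∸-assoc 1 q<n)
      ctxτ : Context τ
      ctxτ = Context-frame select refl fr ctx
      σ₂ σ₃ : State
      σ₂ = sem ((task ← ORD at (nᴱ ⊟ (const 1 ⊞ ! tr))) ⨟ (ok ← RES at (nᴱ ⊟ (const 1 ⊞ ! tr)))) (τ [ tr at 0 ≔ q ])
      σ₃ = sem checkFit σ₂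
      ctx₂ : Context σ₂
      ctx₂ = Context-sem ((task ← ORD at (nᴱ ⊟ (const 1 ⊞ ! tr))) ⨟ (ok ← RES at (nᴱ ⊟ (const 1 ⊞ ! tr)))) refl
        (Context-set 0 q (m≤m+n 10 _) ctxτ)
      task-eq : σ₂ task 0 ≡ ord k
      task-eq = trans (fr refl _) (cong (λ z → ord (z ∸ suc q)) (n≡ ctxτ))
      ok-eq : σ₂ ok 0 ≡ res k
      ok-eq = trans (fr refl _) (cong (λ z → res (z ∸ suc q)) (n≡ ctxτ))
      S : PSet
      S = selected τ
      final : State
      final = sem selectBody (τ [ tr at 0 ≔ q ])
      S₃ : ∀ i → selected σ₃ i ≡ S i
      S₃ i = cong (λ z → not (z ≡ᵇ 0)) (frame checkFit σ₂ {SEL} refl i)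
      task₃ : ∀ {j} → ord k ≡ j → σ₃ task 0 ≡ j
      task₃ ord≡ = trans (frame checkFit σ₂ {task} refl 0) (trans task-eq ord≡)
      unchanged : σ₃ ok 0 ≡ 0 → ∀ i → i < n → S i ≡ selected final i
      unchanged h = when-rule (! ok) (SEL [ ! task ]≔ const 1) σ₃ (λ σ → ∀ i → i < n → S i ≡ selected σ i)
        (λ h′ → contradiction h h′) (λ _ i _ → sym (S₃ i))
      inserted : ∀ {j} → ord k ≡ j → σ₃ ok 0 ≢ 0 → ∀ i → i < n → insert j S i ≡ selected final i
      inserted {j} ord≡ h = when-rule (! ok) (SEL [ ! task ]≔ const 1) σ₃ (λ σ → ∀ i → i < n → insert j S i ≡ selected σ i)
        (λ _ i _ → if-cell (λ z → insert j S i ≡ not (z ≡ᵇ 0)) i (σ₃ task 0)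
          (λ e → ∨-introʳ (S i) (trans (cong (i ≡ᵇ_) (sym (trans e (task₃ ord≡)))) (≡ᵇ-refl i)))
          (λ ≢ → trans (cong (S i ∨_) (≡ᵇ-≢ {i} {j} λ e → ≢ (trans e (sym (task₃ ord≡))))) (trans (∨-identityʳ (S i)) (sym (S₃ i)))))
        (λ h′ → contradiction h′ h)
      advance : ∀ {w R} → Trace ord res (suc k) w R → Approximates w R (selected final) → SelectInvariant ord res q final
      advance {w} {R} tr ap = record { trace = subst (λ k → Trace ord res k w R) next tr ; approximates = ap }
      go : ∀ {k′ w R} → Trace ord res k′ w R → k′ ≡ k → Approximates w R S → SelectInvariant ord res q final
      go no-rounds eq ap = contradiction (sym eq) (<⇒≢ (∸-monoʳ-< {n} {suc q} {0} (s≤s z≤n) q<n))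
      go (skip-round tr ord≡ j<n Rj wj≡0 res≡0) refl ap = advance tr (Approximates-cong
        (unchanged (proj₁ (checkFit-correct σ₂ ctx₂ j<n (trans task-eq ord≡)) (trans ok-eq res≡0))) (skip-step j<n wj≡0 ap))
      go (reduce-round tr ord≡ j<n Rj wj≢0 res≢0 small highest) refl ap
        with proj₂ (checkFit-correct σ₂ ctx₂ j<n (trans task-eq ord≡)) (res≢0 ∘ trans (sym ok-eq))
      ... | inj₁ (ok≢0 , fits) = advance tr (Approximates-cong (inserted ord≡ ok≢0)
              (insert-step j<n Rj small highest ap fits (n≢0⇒n>0 wj≢0)))
      ... | inj₂ (ok≡0 , e , e<m , je , over) = advance tr (Approximates-cong (unchanged ok≡0)
              (blocked-step j<n Rj small highest ap e e<m je over))

  -- Correctness of the dynamic program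

  open Rectangles A using (IsLarge)
  open Intervals W

  sumSelected-correct : ∀ σ → Context σ → sem sumSelected σ total 0 ≡ sumOver n (selected σ) p
  sumSelected-correct σ ctx = trans (sym (+-identityʳ _))
    (guarded-for-rule ti 0 0 guards body σ′ (n+0 ctx) Inv refl hit miss)
    where
    guards = (SEL at ! ti) ∷ []
    body = total ← ! total ⊞ (PROFIT at ! ti)
    loop = for ti 0 0 (whenAll guards body)
    σ′ = sem (total ← const 0) σ
    f : ℕ → ℕ
    f i = on (selected σ i) (p i)
    Inv : ℕ → State → Set
    Inv k τ = τ total 0 + sumTo k f ≡ sumTo n f
    hit : Hit ti guards body n (Frame loop σ′) Inv
    hit k τ k<n fr inv (h ∷ []) = trans (+-assoc (τ total 0) _ _) (trans (cong (τ total 0 +_)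
      (trans (+-comm (τ PROFIT k) (sumTo k f)) (cong (sumTo k f +_)
        (trans (trans (fr refl k) (p≡ ctx k)) (cong (λ b → on b (p k)) (sym (≢0⇒selected (h ∘ trans (fr refl k))))))))) inv)
    miss : Miss ti guards n (Frame loop σ′) Inv
    miss k τ k<n fr inv ¬h = trans (cong (τ total 0 +_) (trans (sym (+-identityʳ _))
        (cong (λ b → sumTo k f + on b (p k)) (sym skipped)))) inv
      where
      skipped : selected σ k ≡ false
      skipped with selected σ k in eq
      ... | false = refl
      ... | true = contradiction ((selected⇒≢0 eq ∘ trans (sym (fr refl k))) ∷ []) ¬h

  N : ℕ
  N = n + 2

  n<N : n < N
  n<N = m<m+n n (s≤s z≤n)

  addr : ℕ → ℕ → ℕ
  addr P Q = P * N + Q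

  valAt : State → ℕ → ℕ → ℕ
  valAt σ P Q = σ VAL (addr P Q)

  setAt : State → ℕ → ℕ → PSet
  setAt σ P Q i = not (σ SOL (addr (addr P Q) i) ≡ᵇ 0)

  module _ {ρ : State} (ctx : Context ρ) where

    private
      P Q k : ℕ
      P = ρ tP 0
      Q = ρ tQ 0
      k = ρ tk 0

    base-eq : ∀ i → ρ TOP i ∸ ρ DEM i ≡ base i
    base-eq i = cong₂ _∸_ (top-kept ctx i) (d≡ ctx i)

    compatible-true : ∀ i j → (suc (ρ START i) ∸ ρ END j) + (suc (ρ START j) ∸ ρ END i) +
      (suc (ρ TOP j ∸ ρ DEM j) ∸ ρ TOP i) + (suc (ρ TOP i ∸ ρ DEM i) ∸ ρ TOP j) ≢ 0 → Compatible i j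
    compatible-true i j h si<tj sj<ti
      rewrite s≡ ctx i | s≡ ctx j | t≡ ctx i | t≡ ctx j | base-eq i | base-eq j | top-kept ctx i | top-kept ctx j
            | m≤n⇒m∸n≡0 si<tj | m≤n⇒m∸n≡0 sj<ti
      with +≢0 (suc (base j) ∸ top i) h
    ... | inj₁ x = inj₁ (≼-true x)
    ... | inj₂ x = inj₂ (≼-true x)

    compatible-false : ∀ i j → Compatible i j → (suc (ρ START i) ∸ ρ END j) + (suc (ρ START j) ∸ ρ END i) +
      (suc (ρ TOP j ∸ ρ DEM j) ∸ ρ TOP i) + (suc (ρ TOP i ∸ ρ DEM i) ∸ ρ TOP j) ≢ 0
    compatible-false i j comp
      rewrite s≡ ctx i | s≡ ctx j | t≡ ctx i | t≡ ctx j | base-eq i | base-eq j | top-kept ctx i | top-kept ctx j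
      with s i <? t j | s j <? t i
    ... | no q | _ = +≢0ˡ _ (+≢0ˡ _ (+≢0ˡ _ (≤⇒≼ (≮⇒≥ q))))
    ... | yes _ | no q = +≢0ˡ _ (+≢0ˡ _ (+≢0ʳ (suc (s i) ∸ t j) (≤⇒≼ (≮⇒≥ q))))
    ... | yes q₁ | yes q₂ with comp q₁ q₂
    ...   | inj₁ x = +≢0ˡ _ (+≢0ʳ (suc (s i) ∸ t j + (suc (s j) ∸ t i)) (≤⇒≼ x))
    ...   | inj₂ x = +≢0ʳ (suc (s i) ∸ t j + (suc (s j) ∸ t i) + (suc (base j) ∸ top i)) (≤⇒≼ x)

    eligible-true : k < n → All (λ e → ⟦ e ⟧ ρ ≢ 0) (eligibleᴱ (! tP) (! tQ) (! tk)) → Eligible P Q k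
    eligible-true k<n (h₁ ∷ h₂ ∷ h₃ ∷ h₄ ∷ h₅ ∷ h₆ ∷ h₇ ∷ h₈ ∷ []) = record
      { k<n = k<n
      ; large = subst₂ _<_ (top-kept ctx k) (cong (2 *_) (d≡ ctx k)) (≺-true h₁)
      ; fits = subst₂ _≤_ (d≡ ctx k) (top-kept ctx k) (≼-true h₂)
      ; P<k = subst₂ _<_ (pos-kept ctx P) (pos-kept ctx k) (≺-true h₃)
      ; k<Q = subst₂ _<_ (pos-kept ctx k) (pos-kept ctx Q) (≺-true h₄)
      ; P≤k = subst₂ _≤_ (base-eq P) (base-eq k) (≼-true h₅)
      ; Q≤k = subst₂ _≤_ (base-eq Q) (base-eq k) (≼-true h₆)
      ; compP = compatible-true k P h₇
      ; compQ = compatible-true k Q h₈ }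

    eligible-false : Eligible P Q k → All (λ e → ⟦ e ⟧ ρ ≢ 0) (eligibleᴱ (! tP) (! tQ) (! tk))
    eligible-false el =
      <⇒≺ (subst₂ _<_ (sym (top-kept ctx k)) (sym (cong (2 *_) (d≡ ctx k))) large) ∷
      ≤⇒≼ (subst₂ _≤_ (sym (d≡ ctx k)) (sym (top-kept ctx k)) fits) ∷
      <⇒≺ (subst₂ _<_ (sym (pos-kept ctx P)) (sym (pos-kept ctx k)) P<k) ∷
      <⇒≺ (subst₂ _<_ (sym (pos-kept ctx k)) (sym (pos-kept ctx Q)) k<Q) ∷
      ≤⇒≼ (subst₂ _≤_ (sym (base-eq P)) (sym (base-eq k)) P≤k) ∷
      ≤⇒≼ (subst₂ _≤_ (sym (base-eq Q)) (sym (base-eq k)) Q≤k) ∷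
      compatible-false k P compP ∷ compatible-false k Q compQ ∷ []
      where open Eligible el

  split-value : State → ℕ → ℕ → ℕ → ℕ
  split-value σ P Q k = p k + (valAt σ P k + valAt σ k Q)

  addr-eq : ∀ {τ} P Q → Context τ → P * (τ 0 0 + 2) + Q ≡ addr P Q
  addr-eq P Q ctx = cong (λ z → P * (z + 2) + Q) (n≡ ctx)

  record BestSplit (σ : State) (P Q : ℕ) (τ : State) : Set where
    field
      origin : (τ arg 0 ≡ 0 × τ val 0 ≡ valAt σ P Q) ⊎
               (Σ[ k ∈ ℕ ] τ arg 0 ≡ suc k × Eligible P Q k × τ val 0 ≡ split-value σ P Q k)
      grows : valAt σ P Q ≤ τ val 0
      best-split : ∀ k → k < n → Eligible P Q k → split-value σ P Q k ≤ τ val 0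

  findSplit-correct : ∀ σ {P Q} → Context σ → σ tP 0 ≡ P → σ tQ 0 ≡ Q → BestSplit σ P Q (sem findSplit σ)
  findSplit-correct σ {P} {Q} ctx refl refl =
    let o , g , h = guarded-for-rule tk 0 0 guards trySplit σ′ (n+0 ctx) Inv
          (inj₁ (refl , initial-val) , ≤-reflexive (sym initial-val) , λ k n≤k k<n → contradiction k<n (≤⇒≯ n≤k)) hit miss in
    record { origin = o ; grows = g ; best-split = λ k k<n → h k z≤n k<n }
    where
    guards = eligibleᴱ (! tP) (! tQ) (! tk)
    σ′ = sem ((val ← VAL at pairᴱ (! tP) (! tQ)) ⨟ (arg ← const 0)) σ
    loop = for tk 0 0 (whenAll guards trySplit)
    initial-val : σ′ val 0 ≡ valAt σ P Q
    initial-val = cong (σ VAL) (addr-eq P Q ctx)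
    Inv : ℕ → State → Set
    Inv q τ = ((τ arg 0 ≡ 0 × τ val 0 ≡ valAt σ P Q) ⊎
        (Σ[ k ∈ ℕ ] τ arg 0 ≡ suc k × Eligible P Q k × τ val 0 ≡ split-value σ P Q k)) ×
      valAt σ P Q ≤ τ val 0 × (∀ k → q ≤ k → k < n → Eligible P Q k → split-value σ P Q k ≤ τ val 0)
    module _ (k : ℕ) (τ : State) (fr : Frame loop σ′ τ) where
      ρ : State
      ρ = τ [ tk at 0 ≔ k ]
      ctxρ : Context ρ
      ctxρ = Context-set 0 k (m≤m+n 10 _) (Context-frame loop refl fr
        (Context-sem ((val ← VAL at pairᴱ (! tP) (! tQ)) ⨟ (arg ← const 0)) refl ctx))
      P-eq : τ tP 0 ≡ P
      P-eq = fr refl 0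
      Q-eq : τ tQ 0 ≡ Q
      Q-eq = fr refl 0
      value-eq : ⟦ splitᴱ ⟧ ρ ≡ split-value σ P Q k
      value-eq = cong₂ _+_ (p≡ ctxρ k) (cong₂ _+_
        (trans (cong (τ VAL) (trans (addr-eq (τ tP 0) k ctxρ) (cong (λ z → addr z k) P-eq))) (fr refl _))
        (trans (cong (τ VAL) (trans (addr-eq k (τ tQ 0) ctxρ) (cong (addr k) Q-eq))) (fr refl _)))
    hit : Hit tk guards trySplit n (Frame loop σ′) Inv
    hit k τ k<n fr (o , g , h) el = when-rule (! val ≺ splitᴱ) takeSplit (ρ k τ fr) (Inv k)
      (λ better → let val<  = subst (τ val 0 <_) value (≺-true better) in
        inj₂ (k , refl , el′ , value) , subst (valAt σ P Q ≤_) (sym value) (≤-trans g (<⇒≤ val<)) ,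
        λ k′ k≤k′ k′<n e → subst (split-value σ P Q k′ ≤_) (sym value) (case m≤n⇒m<n∨m≡n k≤k′ of λ where
          (inj₁ k<k′) → ≤-trans (h k′ k<k′ k′<n e) (<⇒≤ val<)
          (inj₂ refl) → ≤-refl))
      (λ worse → o , g , λ k′ k≤k′ k′<n e → case m≤n⇒m<n∨m≡n k≤k′ of λ where
          (inj₁ k<k′) → h k′ k<k′ k′<n e
          (inj₂ refl) → subst (_≤ τ val 0) value (≺-false {τ val 0} {⟦ splitᴱ ⟧ (ρ k τ fr)} worse))
      where
      value = value-eq k τ fr
      el′ : Eligible P Q k
      el′ = subst₂ (λ P Q → Eligible P Q k) (P-eq k τ fr) (Q-eq k τ fr) (eligible-true (ctxρ k τ fr) k<n el)
    miss : Miss tk guards n (Frame loop σ′) Inv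
    miss k τ k<n fr (o , g , h) ¬el = o , g , λ k′ k≤k′ k′<n e → case m≤n⇒m<n∨m≡n k≤k′ of λ where
          (inj₁ k<k′) → h k′ k<k′ k′<n e
          (inj₂ refl) → contradiction (eligible-false (ctxρ k τ fr)
             (subst₂ (λ P Q → Eligible P Q k) (sym (P-eq k τ fr)) (sym (Q-eq k τ fr)) e)) ¬el

  addr-injective : ∀ {P Q P′ Q′} → Q < N → Q′ < N → addr P Q ≡ addr P′ Q′ → P ≡ P′ × Q ≡ Q′
  addr-injective {P} {Q} {P′} {Q′} = radix-injective {N} {P} {Q} {P′} {Q′}

  -- As k differs from P and Q, the cells read belong to entries other than the one written, so none
  -- of them has been overwritten when it is read.
  merge-correct : ∀ σ {P Q k} → Context σ → σ tP 0 ≡ P → σ tQ 0 ≡ Q → σ tk 0 ≡ k →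
    Q < N → k < N → P ≢ k → Q ≢ k →
    (∀ i → i < n → sem merge σ SOL (addr (addr P Q) i) ≡ σ SOL (addr (addr P k) i) + σ SOL (addr (addr k Q) i)) ×
    (∀ a → (∀ i → i < n → a ≢ addr (addr P Q) i) → sem merge σ SOL a ≡ σ SOL a)
  merge-correct σ {P} {Q} {k} ctx P≡ Q≡ k≡ Q<N k<N P≢k Q≢k =
    let q₁ , q₂ = for-rule ti 0 0 mergeAt σ (n+0 ctx) Inv
          ((λ i n≤i i<n → contradiction i<n (≤⇒≯ n≤i)) , λ _ _ → refl) step in
    (λ i → q₁ i z≤n) , λ a h → q₂ a λ i _ → h i
    where
    target : ℕ → ℕ
    target i = addr (addr P Q) i
    Inv : ℕ → State → Set
    Inv q τ = (∀ i → q ≤ i → i < n → τ SOL (target i) ≡ σ SOL (addr (addr P k) i) + σ SOL (addr (addr k Q) i)) ×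
      (∀ a → (∀ i → q ≤ i → i < n → a ≢ target i) → τ SOL a ≡ σ SOL a)
    step : Step ti mergeAt n (Frame merge σ) Inv
    step q τ q<n fr (done , rest) =
      (λ i q≤i i<n → if-cell (_≡ σ SOL (addr (addr P k) i) + σ SOL (addr (addr k Q) i)) (target i) here
        (λ e → case proj₂ (addr-injective {addr P Q} {i} {addr P Q} {q} (<-trans i<n n<N) (<-trans q<n n<N) (trans e here-eq)) of λ { refl → value })
        (λ ≢ → done i (≤∧≢⇒< q≤i λ { refl → ≢ (sym here-eq) }) i<n)) ,
      (λ a h → if-cell (_≡ σ SOL a) a here (λ e → contradiction (trans e here-eq) (h q ≤-refl q<n))
        (λ _ → rest a λ i q<i → h i (<⇒≤ q<i)))
      where
      ctxτ : Context τ
      ctxτ = Context-frame merge refl fr ctx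
      P-eq : τ tP 0 ≡ P
      P-eq = trans (fr refl 0) P≡
      Q-eq : τ tQ 0 ≡ Q
      Q-eq = trans (fr refl 0) Q≡
      k-eq : τ tk 0 ≡ k
      k-eq = trans (fr refl 0) k≡
      deep : ∀ {X Y X′ Y′} → X ≡ X′ → Y ≡ Y′ → (X * (τ 0 0 + 2) + Y) * (τ 0 0 + 2) + q ≡ addr (addr X′ Y′) q
      deep {X} {Y} refl refl = trans (addr-eq (X * (τ 0 0 + 2) + Y) q ctxτ) (cong (λ z → addr z q) (addr-eq X Y ctxτ))
      here : ℕ
      here = (τ tP 0 * (τ 0 0 + 2) + τ tQ 0) * (τ 0 0 + 2) + q
      here-eq : here ≡ target q
      here-eq = deep P-eq Q-eq
      untouched : ∀ X Y → Y < N → (X ≢ P ⊎ Y ≢ Q) → τ SOL (addr (addr X Y) q) ≡ σ SOL (addr (addr X Y) q)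
      untouched X Y Y<N h = rest _ λ i q<i i<n e →
        let X≡P , Y≡Q = addr-injective {X} {Y} {P} {Q} Y<N Q<N
              (proj₁ (addr-injective {addr X Y} {q} {addr P Q} {i} (<-trans q<n n<N) (<-trans i<n n<N) e)) in
        case h of λ where
          (inj₁ x) → x X≡P
          (inj₂ y) → y Y≡Q
      value : τ SOL ((τ tP 0 * (τ 0 0 + 2) + τ tk 0) * (τ 0 0 + 2) + q) + τ SOL ((τ tk 0 * (τ 0 0 + 2) + τ tQ 0) * (τ 0 0 + 2) + q)
        ≡ σ SOL (addr (addr P k) q) + σ SOL (addr (addr k Q) q)
      value = cong₂ _+_
        (trans (cong (τ SOL) (deep P-eq k-eq)) (untouched P k k<N (inj₂ (Q≢k ∘ sym))))
        (trans (cong (τ SOL) (deep k-eq Q-eq)) (untouched k Q Q<N (inj₁ (P≢k ∘ sym))))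

  not-+ : ∀ x y → not (x + y ≡ᵇ 0) ≡ not (x ≡ᵇ 0) ∨ not (y ≡ᵇ 0)
  not-+ zero    y = refl
  not-+ (suc x) y = refl

  SameEntry : State → State → ℕ → ℕ → Set
  SameEntry σ τ P Q = valAt τ P Q ≡ valAt σ P Q × (∀ i → i < n → setAt τ P Q i ≡ setAt σ P Q i)

  store-correct : ∀ σ {P Q k} → Context σ → σ tP 0 ≡ P → σ tQ 0 ≡ Q → σ arg 0 ≡ suc k → Q < N → Eligible P Q k →
    let τ = sem store σ in
    valAt τ P Q ≡ σ val 0 ×
    (∀ i → i < n → join k (setAt σ P k) (setAt σ k Q) i ≡ setAt τ P Q i) ×
    (∀ P′ Q′ → Q′ < N → (P′ ≢ P ⊎ Q′ ≢ Q) → SameEntry σ τ P′ Q′)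
  store-correct σ {P} {Q} {k} ctx P≡ Q≡ arg≡ Q<N el = val-new , set-new , others
    where
    open Eligible el using (k<n; P<k; k<Q)
    prelude = (tk ← ! arg ⊟ const 1) ⨟ (VAL [ pairᴱ (! tP) (! tQ) ]≔ ! val)
    σ₂ σ₃ : State
    σ₂ = sem prelude σ
    σ₃ = sem merge σ₂
    ctx₂ : Context σ₂
    ctx₂ = Context-sem prelude refl ctx
    ctx₃ : Context σ₃
    ctx₃ = Context-sem merge refl ctx₂
    fr₃ : Frame merge σ₂ σ₃
    fr₃ = frame merge σ₂
    k≡ : σ₂ tk 0 ≡ k
    k≡ = cong (_∸ 1) arg≡
    k<N : k < N
    k<N = <-trans k<n n<N
    P≢k : P ≢ k
    P≢k refl = <-irrefl refl P<k
    Q≢k : Q ≢ k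
    Q≢k refl = <-irrefl refl k<Q
    merged = merge-correct σ₂ ctx₂ P≡ Q≡ k≡ Q<N k<N P≢k Q≢k
    here : ℕ
    here = (σ₃ tP 0 * (σ₃ 0 0 + 2) + σ₃ tQ 0) * (σ₃ 0 0 + 2) + σ₃ tk 0
    here-eq : here ≡ addr (addr P Q) k
    here-eq = trans (addr-eq (σ₃ tP 0 * (σ₃ 0 0 + 2) + σ₃ tQ 0) (σ₃ tk 0) ctx₃) (cong₂ addr
      (trans (addr-eq (σ₃ tP 0) (σ₃ tQ 0) ctx₃) (cong₂ addr (trans (fr₃ refl 0) P≡) (trans (fr₃ refl 0) Q≡))) (trans (fr₃ refl 0) k≡))
    there : ℕ
    there = σ tP 0 * (σ 0 0 + 2) + σ tQ 0
    there-eq : there ≡ addr P Q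
    there-eq = trans (addr-eq (σ tP 0) (σ tQ 0) ctx) (cong₂ addr P≡ Q≡)
    val-new : σ₃ VAL (addr P Q) ≡ σ val 0
    val-new = trans (fr₃ refl _) (if-cell (_≡ σ val 0) (addr P Q) there (λ _ → refl) (λ ≢ → contradiction (sym there-eq) ≢))
    set-new : ∀ i → i < n → join k (setAt σ P k) (setAt σ k Q) i ≡ setAt (sem store σ) P Q i
    set-new i i<n = if-cell (λ z → join k (setAt σ P k) (setAt σ k Q) i ≡ not (z ≡ᵇ 0)) (addr (addr P Q) i) here
      (λ e → ∨-introʳ (setAt σ P k i ∨ setAt σ k Q i) (trans (cong (i ≡ᵇ_) (sym (i≡k e))) (≡ᵇ-refl i)))
      (λ ≢ → trans (cong ((setAt σ P k i ∨ setAt σ k Q i) ∨_) (≡ᵇ-≢ {i} {k} λ { refl → ≢ (sym here-eq) }))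
        (trans (∨-identityʳ _) (trans (sym (not-+ (σ SOL (addr (addr P k) i)) _)) (cong (λ z → not (z ≡ᵇ 0)) (sym (proj₁ merged i i<n))))))
      where
      i≡k : addr (addr P Q) i ≡ here → i ≡ k
      i≡k e = proj₂ (addr-injective {addr P Q} {i} {addr P Q} {k} (<-trans i<n n<N) k<N (trans e here-eq))
    others : ∀ P′ Q′ → Q′ < N → (P′ ≢ P ⊎ Q′ ≢ Q) → SameEntry σ (sem store σ) P′ Q′
    others P′ Q′ Q′<N differ =
      trans (fr₃ refl _) (if-cell (_≡ valAt σ P′ Q′) (addr P′ Q′) there
        (λ e → contradiction (addr-injective Q′<N Q<N (trans e there-eq)) distinct) (λ _ → refl)) ,
      λ i i<n → cong (λ z → not (z ≡ᵇ 0)) (if-cell (_≡ σ SOL (addr (addr P′ Q′) i)) (addr (addr P′ Q′) i) here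
        (λ e → contradiction (addr-injective Q′<N Q<N (proj₁ (addr-injective {addr P′ Q′} {i} {addr P Q} {k} (<-trans i<n n<N) k<N (trans e here-eq)))) distinct)
        (λ _ → proj₂ merged _ λ i′ i′<n e →
          distinct (addr-injective Q′<N Q<N (proj₁ (addr-injective {addr P′ Q′} {i} {addr P Q} {i′} (<-trans i<n n<N) (<-trans i′<n n<N) e)))))
      where
      distinct : ¬ (P′ ≡ P × Q′ ≡ Q)
      distinct (p , q) = case differ of λ where
        (inj₁ x) → x p
        (inj₂ y) → y q

  Valid-cong : ∀ {P Q H K} → (∀ i → i < n → H i ≡ K i) → Valid P Q H → Valid P Q K
  Valid-cong h v = record
    { eligible = λ i i<n Ki → eligible i i<n (trans (h i i<n) Ki)
    ; compatible = λ i j i<n j<n Ki Kj → compatible i j i<n j<n (trans (h i i<n) Ki) (trans (h j j<n) Kj) }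
    where open Valid v

  weight-cong : ∀ {H K} → (∀ i → i < n → H i ≡ K i) → sumOver n H p ≡ sumOver n K p
  weight-cong h = sumTo-cong n λ i i<n → cong (λ z → on z (p i)) (h i i<n)

  -- The stored value need only be a lower bound on the profit of the stored set. Because `merge`
  -- copies sets, an entry remains sound when the entries it was built from change later.
  SoundAt : State → ℕ → ℕ → Set
  SoundAt σ P Q = Valid P Q (setAt σ P Q) × valAt σ P Q ≤ sumOver n (setAt σ P Q) p

  Sound : State → Set
  Sound σ = ∀ P Q → P < N → Q < N → SoundAt σ P Q

  -- The size of the competing sets is the induction measure: both parts produced by `split` are
  -- strictly smaller than the whole.
  CompleteAt : ℕ → State → ℕ → ℕ → Set
  CompleteAt r σ P Q = ∀ H → Valid P Q H → size n H ≤ r → sumOver n H p ≤ valAt σ P Q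

  Complete : ℕ → State → Set
  Complete r σ = ∀ P Q → P < N → Q < N → CompleteAt r σ P Q

  -- A sweep updates the table in place, so an entry may be read after it was changed in the same
  -- sweep. Since values never decrease, completeness from the previous sweep survives.
  Grows : State → State → Set
  Grows σ τ = ∀ P Q → P < N → Q < N → valAt σ P Q ≤ valAt τ P Q

  Same⇒Sound : ∀ {σ τ P Q} → SameEntry σ τ P Q → SoundAt σ P Q → SoundAt τ P Q
  Same⇒Sound (v , h) (valid , le) = Valid-cong (λ i i<n → sym (h i i<n)) valid ,
    subst₂ _≤_ (sym v) (sym (weight-cong h)) le

  -- Soundness comes from joining the two stored sets at k. Completeness comes from splitting a
  -- competing set: its parts are dominated by the entries read, and the chosen split is at least as
  -- good as this one.
  entry-correct : ∀ σ {P Q r} → Context σ → σ tP 0 ≡ P → σ tQ 0 ≡ Q → P < N → Q < N → Sound σ → Complete r σ →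
    let τ = sem entry σ in Sound τ × Grows σ τ × CompleteAt (suc r) τ P Q
  entry-correct σ {P} {Q} {r} ctx P≡ Q≡ P<N Q<N sound complete =
    when-rule (! arg) store σ₁ (λ τ → Sound τ × Grows σ τ × CompleteAt (suc r) τ P Q) stored kept
    where
    σ₁ : State
    σ₁ = sem findSplit σ
    fr₁ : Frame findSplit σ σ₁
    fr₁ = frame findSplit σ
    open BestSplit (findSplit-correct σ ctx P≡ Q≡)
    val₁ : ∀ P Q → valAt σ₁ P Q ≡ valAt σ P Q
    val₁ P Q = fr₁ refl _
    set₁ : ∀ P Q i → setAt σ₁ P Q i ≡ setAt σ P Q i
    set₁ P Q i = cong (λ z → not (z ≡ᵇ 0)) (fr₁ refl _)
    sound₁ : Sound σ₁
    sound₁ P Q P<N Q<N = Same⇒Sound {σ} {σ₁} (val₁ P Q , λ i _ → set₁ P Q i) (sound P Q P<N Q<N)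
    reaches : ∀ H → Valid P Q H → size n H ≤ suc r → sumOver n H p ≤ σ₁ val 0
    reaches H v size≤ with split v
    ... | inj₂ none = ≤-trans (≤-reflexive (sumOver-empty n p none)) z≤n
    ... | inj₁ (k , el , L , R , vL , vR , sL , sR , weight) = begin
      sumOver n H p                               ≤⟨ weight p ⟩
      p k + (sumOver n L p + sumOver n R p)       ≤⟨ +-monoʳ-≤ (p k) (+-mono-≤
          (complete P k P<N k<N L vL (s≤s⁻¹ (≤-trans sL size≤))) (complete k Q k<N Q<N R vR (s≤s⁻¹ (≤-trans sR size≤)))) ⟩
      split-value σ P Q k                         ≤⟨ best-split k (Eligible.k<n el) el ⟩
      σ₁ val 0                                    ∎
      where
      open ≤-Reasoning
      k<N : k < N
      k<N = <-trans (Eligible.k<n el) n<N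
    kept : σ₁ arg 0 ≡ 0 → Sound σ₁ × Grows σ σ₁ × CompleteAt (suc r) σ₁ P Q
    kept arg≡0 = sound₁ , (λ P Q _ _ → ≤-reflexive (sym (val₁ P Q))) , λ H v size≤ →
      subst (sumOver n H p ≤_) (unimproved origin) (reaches H v size≤)
      where
      unimproved : _ → σ₁ val 0 ≡ valAt σ₁ P Q
      unimproved (inj₁ (_ , e)) = trans e (sym (val₁ P Q))
      unimproved (inj₂ (k , e , _)) = case trans (sym arg≡0) e of λ ()
    stored : σ₁ arg 0 ≢ 0 → Sound (sem store σ₁) × Grows σ (sem store σ₁) × CompleteAt (suc r) (sem store σ₁) P Q
    stored arg≢0 = go origin
      where
      τ = sem store σ₁
      Goal = Sound τ × Grows σ τ × CompleteAt (suc r) τ P Q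
      go : ((σ₁ arg 0 ≡ 0 × σ₁ val 0 ≡ valAt σ P Q) ⊎
           (Σ[ k ∈ ℕ ] σ₁ arg 0 ≡ suc k × Eligible P Q k × σ₁ val 0 ≡ split-value σ P Q k)) → Goal
      go (inj₁ (e , _)) = contradiction e arg≢0
      go (inj₂ (k , arg≡ , el , val≡)) = sound′ , grows′ , λ H v size≤ → subst (sumOver n H p ≤_) (sym val-new) (reaches H v size≤)
        where
        k<N : k < N
        k<N = <-trans (Eligible.k<n el) n<N
        stored-all = store-correct σ₁ (Context-sem findSplit refl ctx)
          (trans (fr₁ refl 0) P≡) (trans (fr₁ refl 0) Q≡) arg≡ Q<N el
        val-new = proj₁ stored-all
        set-new = proj₁ (proj₂ stored-all)
        others = proj₂ (proj₂ stored-all)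
        H K : PSet
        H = setAt σ₁ P k
        K = setAt σ₁ k Q
        sH = sound₁ P k P<N k<N
        sK = sound₁ k Q k<N Q<N
        here : SoundAt τ P Q
        here = Valid-cong set-new (join-valid el (proj₁ sH) (proj₁ sK)) , (begin
          valAt τ P Q                                    ≡⟨ trans val-new val≡ ⟩
          p k + (valAt σ P k + valAt σ k Q)              ≡⟨ cong₂ (λ x y → p k + (x + y)) (val₁ P k) (val₁ k Q) ⟨
          p k + (valAt σ₁ P k + valAt σ₁ k Q)            ≤⟨ +-monoʳ-≤ (p k) (+-mono-≤ (proj₂ sH) (proj₂ sK)) ⟩
          p k + (sumOver n H p + sumOver n K p)          ≤⟨ join-weight el (proj₁ sH) (proj₁ sK) p ⟩
          sumOver n (join k H K) p                       ≡⟨ weight-cong set-new ⟩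
          sumOver n (setAt τ P Q) p                      ∎)
          where open ≤-Reasoning
        sound′ : Sound τ
        sound′ P′ Q′ P′<N Q′<N with P′ ≟ P | Q′ ≟ Q
        ... | yes refl | yes refl = here
        ... | no P≢ | _ = Same⇒Sound {σ₁} {τ} (others P′ Q′ Q′<N (inj₁ P≢)) (sound₁ P′ Q′ P′<N Q′<N)
        ... | yes _ | no Q≢ = Same⇒Sound {σ₁} {τ} (others P′ Q′ Q′<N (inj₂ Q≢)) (sound₁ P′ Q′ P′<N Q′<N)
        grows′ : Grows σ τ
        grows′ P′ Q′ P′<N Q′<N with P′ ≟ P | Q′ ≟ Q
        ... | yes refl | yes refl = subst (valAt σ P Q ≤_) (sym val-new) grows
        ... | no P≢ | _ = ≤-reflexive (sym (trans (proj₁ (others P′ Q′ Q′<N (inj₁ P≢))) (val₁ P′ Q′)))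
        ... | yes _ | no Q≢ = ≤-reflexive (sym (trans (proj₁ (others P′ Q′ Q′<N (inj₂ Q≢))) (val₁ P′ Q′)))

  Complete-grows : ∀ {r σ τ P Q} → valAt σ P Q ≤ valAt τ P Q → CompleteAt r σ P Q → CompleteAt r τ P Q
  Complete-grows le h H v size≤ = ≤-trans (h H v size≤) le

  row-correct : ∀ σ {P r} → Context σ → σ tP 0 ≡ P → P < N → Sound σ → Complete r σ →
    let τ = sem row σ in Sound τ × Grows σ τ × (∀ Q → Q < N → CompleteAt (suc r) τ P Q)
  row-correct σ {P} {r} ctx P≡ P<N sound complete =
    let q₁ , q₂ , q₃ = for-rule tQ 0 2 entry σ (n+ ctx) Inv
          (sound , (λ _ _ _ _ → ≤-refl) , λ Q N≤Q Q<N → contradiction Q<N (≤⇒≯ N≤Q)) step in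
    q₁ , q₂ , λ Q → q₃ Q z≤n
    where
    Inv : ℕ → State → Set
    Inv q τ = Sound τ × Grows σ τ × (∀ Q → q ≤ Q → Q < N → CompleteAt (suc r) τ P Q)
    step : Step tQ entry N (Frame row σ) Inv
    step q τ q<N fr (s , g , h) =
      let s′ , g′ , h′ = entry-correct (τ [ tQ at 0 ≔ q ]) {P} {q} {r}
            (Context-set 0 q (m≤m+n 10 _) (Context-frame row refl fr ctx))
            (trans (fr refl 0) P≡) refl P<N q<N s
            (λ P′ Q′ P′<N Q′<N → Complete-grows {r} {σ} {τ} {P′} {Q′} (g P′ Q′ P′<N Q′<N) (complete P′ Q′ P′<N Q′<N)) in
      s′ , (λ P′ Q′ P′<N Q′<N → ≤-trans (g P′ Q′ P′<N Q′<N) (g′ P′ Q′ P′<N Q′<N)) ,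
      λ Q q≤Q Q<N → case m≤n⇒m<n∨m≡n q≤Q of λ where
        (inj₁ q<Q) → λ H v size≤ → ≤-trans (h Q q<Q Q<N H v size≤) (g′ P Q P<N Q<N)
        (inj₂ refl) → h′

  sweep-correct : ∀ σ {r} → Context σ → Sound σ → Complete r σ →
    let τ = sem sweep σ in Sound τ × Complete (suc r) τ
  sweep-correct σ {r} ctx sound complete =
    let q₁ , _ , q₃ = for-rule tP 0 2 row σ (n+ ctx) Inv
          (sound , (λ _ _ _ _ → ≤-refl) , λ P N≤P P<N → contradiction P<N (≤⇒≯ N≤P)) step in
    q₁ , λ P Q P<N Q<N → q₃ P z≤n P<N Q Q<N
    where
    Inv : ℕ → State → Set
    Inv q τ = Sound τ × Grows σ τ × (∀ P → q ≤ P → P < N → ∀ Q → Q < N → CompleteAt (suc r) τ P Q)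
    step : Step tP row N (Frame sweep σ) Inv
    step q τ q<N fr (s , g , h) =
      let s′ , g′ , h′ = row-correct (τ [ tP at 0 ≔ q ]) {q} {r}
            (Context-set 0 q (m≤m+n 10 _) (Context-frame sweep refl fr ctx))
            refl q<N s
            (λ P′ Q′ P′<N Q′<N → Complete-grows {r} {σ} {τ} {P′} {Q′} (g P′ Q′ P′<N Q′<N) (complete P′ Q′ P′<N Q′<N)) in
      s′ , (λ P′ Q′ P′<N Q′<N → ≤-trans (g P′ Q′ P′<N Q′<N) (g′ P′ Q′ P′<N Q′<N)) ,
      λ P q≤P P<N Q Q<N → case m≤n⇒m<n∨m≡n q≤P of λ where
        (inj₁ q<P) → λ H v size≤ → ≤-trans (h P q<P P<N Q Q<N H v size≤) (g′ P Q P<N Q<N)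
        (inj₂ refl) → h′ Q Q<N

  table-correct : ∀ σ → Context σ → (∀ a → σ VAL a ≡ 0) → (∀ a → σ SOL a ≡ 0) →
    let τ = sem table σ in Sound τ × Complete n τ
  table-correct σ ctx noVal noSol = for-rule tr 0 0 sweep σ (n+0 ctx) Inv
      (sound₀ , subst (λ r → Complete r σ) (sym (n∸n≡0 n)) complete₀) step
    where
    Inv : ℕ → State → Set
    Inv k τ = Sound τ × Complete (n ∸ k) τ
    nothing : ∀ P Q i → setAt σ P Q i ≡ false
    nothing P Q i = cong (λ z → not (z ≡ᵇ 0)) (noSol _)
    sound₀ : Sound σ
    sound₀ P Q _ _ = record { eligible = λ i _ h → clash (nothing P Q i) h ; compatible = λ i _ _ _ h → clash (nothing P Q i) h } ,
      ≤-trans (≤-reflexive (noVal _)) z≤n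
    complete₀ : Complete 0 σ
    complete₀ P Q _ _ H _ size≤0 = ≤-trans (≤-reflexive (sumOver-empty n p empty)) z≤n
      where
      empty : ∀ i → i < n → H i ≡ false
      empty i i<n with H i in eq
      ... | false = refl
      ... | true = contradiction (≤-trans (member≤sumOver (λ _ → 1) i<n eq) size≤0) λ ()
    step : Step tr sweep n (Frame table σ) Inv
    step k τ k<n fr (s , h) =
      let s′ , h′ = sweep-correct (τ [ tr at 0 ≔ k ]) {n ∸ suc k}
            (Context-set 0 k (m≤m+n 10 _) (Context-frame table refl fr ctx)) s h in
      s′ , subst (λ r → Complete r (sem sweep (τ [ tr at 0 ≔ k ]))) (sym (+-∸-assoc 1 k<n)) h′

  -- The better of the two solutions

  copy-correct : ∀ σ → Context σ → ∀ i → i < n → selected (sem copy σ) i ≡ setAt σ n (suc n) i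
  copy-correct σ ctx i i<n = cong (λ z → not (z ≡ᵇ 0)) (for-rule ti 0 0 (SEL [ ! ti ]≔ SOL at pairᴱ wallsᴱ (! ti)) σ (n+0 ctx) Inv
      (λ i n≤i i<n → contradiction i<n (≤⇒≯ n≤i)) step i z≤n i<n)
    where
    Inv : ℕ → State → Set
    Inv k τ = ∀ i → k ≤ i → i < n → τ SEL i ≡ σ SOL (addr (addr n (suc n)) i)
    step : Step ti (SEL [ ! ti ]≔ SOL at pairᴱ wallsᴱ (! ti)) n (Frame copy σ) Inv
    step k τ k<n fr h i k≤i i<n = if-cell (_≡ σ SOL (addr (addr n (suc n)) i)) i k
      (λ { refl → trans (fr refl _) (cong (σ SOL) (trans (cong (λ z → (z * (z + 2) + (z + 1)) * (z + 2) + k)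
           (n≡ (Context-frame copy refl fr ctx))) (cong (λ z → addr (n * N + z) k) (+-comm n 1)))) })
      (λ i≢k → h i (≤∧≢⇒< k≤i (i≢k ∘ sym)) i<n)

  walls-eq : ∀ σ → Context σ → ⟦ VAL at wallsᴱ ⟧ σ ≡ valAt σ n (suc n)
  walls-eq σ ctx = cong (σ VAL) (trans (cong (λ z → z * (z + 2) + (z + 1)) (n≡ ctx)) (cong (n * N +_) (+-comm n 1)))

  afterAnchors-correct : ∀ σ → Context σ → Fresh σ →
    let F = selected (sem afterAnchors σ) in
    Feas F × (∀ G → Feas G → sumOver n G p ≤ 16 * sumOver n F p)
  afterAnchors-correct σ ctx fresh = when-rule (! total ≺ VAL at wallsᴱ) copy σ₅
      (λ τ → Feas (selected τ) × (∀ G → Feas G → sumOver n G p ≤ 16 * sumOver n (selected τ) p)) copied kept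
    where
    open Fresh fresh
    σ₁ σ₂ σ₃ σ₄ σ₅ : State
    σ₁ = sem weights σ
    σ₂ = sem rounds σ₁
    σ₃ = sem select σ₂
    σ₄ = sem sumSelected σ₃
    σ₅ = sem table σ₄
    ctx₁ : Context σ₁
    ctx₁ = Context-sem weights refl ctx
    ctx₂ : Context σ₂
    ctx₂ = Context-sem rounds refl ctx₁
    ctx₃ : Context σ₃
    ctx₃ = Context-sem select refl ctx₂
    ctx₄ : Context σ₄
    ctx₄ = Context-sem sumSelected refl ctx₃
    ctx₅ : Context σ₅
    ctx₅ = Context-sem table refl ctx₄
    first-four : Frame (weights ⨟ rounds ⨟ select ⨟ sumSelected) σ σ₄
    first-four = frame (weights ⨟ rounds ⨟ select ⨟ sumSelected) σ
    first-two : Frame (weights ⨟ rounds) σ σ₂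
    first-two = frame (weights ⨟ rounds) σ
    S : PSet
    S = selected σ₃
    approx : LocalRatio.Approximates A w₀ all S
    approx = select-correct σ₂ ctx₂
      (rounds-correct σ₁ ctx₁ (weights-correct σ ctx weight≡0)
        (λ i → trans (frame weights σ {DONE} refl i) (done≡0 i)))
      (λ i → trans (first-two {SEL} refl i) (sel≡0 i))
    open LocalRatio.Approximates approx
    S₅ : ∀ i → i < n → S i ≡ selected σ₅ i
    S₅ i _ = cong (λ z → not (z ≡ᵇ 0)) (sym (frame (sumSelected ⨟ table) σ₃ {SEL} refl i))
    total-eq : σ₅ total 0 ≡ sumOver n S p
    total-eq = trans (frame table σ₄ {total} refl 0) (sumSelected-correct σ₃ ctx₃)
    tabled = table-correct σ₄ ctx₄
      (λ a → trans (first-four {VAL} refl a) (val≡0 a))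
      (λ a → trans (first-four {SOL} refl a) (sol≡0 a))
    n+1<N : suc n < N
    n+1<N = subst (_< N) (+-comm n 1) (+-monoʳ-< n ≤-refl)
    V : ℕ
    V = valAt σ₅ n (suc n)
    sound = proj₁ tabled n (suc n) n<N n+1<N
    -- x will be the profit of the output. The small members of G earn at most 6 x by the local
    -- ratio and the large ones at most 10 x by the table.
    weigh : ∀ {x} G → Feas G → sumOver n S p ≤ x → V ≤ x → sumOver n G p ≤ 16 * x
    weigh {x} G feas S≤ V≤ = begin
      sumOver n G p                                                    ≡⟨ sumOver-cong n (λ i _ _ → partition i) ⟩
      sumOver n G (λ i → w₀ i + on (not (isSmall i)) (p i))            ≡⟨ sumOver-+ n G w₀ _ ⟩
      sumOver n G w₀ + sumOver n G (λ i → on (not (isSmall i)) (p i))  ≡⟨ cong (sumOver n G w₀ +_) (sumOver-∩ n G _ p) ⟨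
      sumOver n G w₀ + sumOver n L p                                   ≤⟨ +-mono-≤ small≤ large≤ ⟩
      6 * x + 10 * x                                                   ≡⟨ *-distribʳ-+ x 6 10 ⟨
      16 * x                                                           ∎
      where
      open ≤-Reasoning
      L : PSet
      L = G ∩ (λ i → not (isSmall i))
      partition : ∀ i → p i ≡ w₀ i + on (not (isSmall i)) (p i)
      partition i with isSmall i
      ... | true  = sym (+-identityʳ (p i))
      ... | false = refl
      small≤ : sumOver n G w₀ ≤ 6 * x
      small≤ = ≤-trans (ratio G (λ _ _ _ → refl) feas) (*-monoʳ-≤ 6
        (≤-trans (sumOver-mono n {S} {w₀} {p} λ i _ _ → on≤ (isSmall i) (p i)) S≤))
      isLarge : ∀ i → i < n → L i ≡ true → IsLarge i
      isLarge i _ h = ≰⇒> λ le → clash (not-true (proj₂ (∧-split {G i} h))) (≤ᵇ-complete le)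
      heavy = heavy-Valid-part p (Tasks.Feas-⊆ A {L} {G} (λ i _ h → proj₁ (∧-split {G i} h)) feas) isLarge
      large≤ : sumOver n L p ≤ 10 * x
      large≤ = ≤-trans (proj₂ (proj₂ heavy)) (*-monoʳ-≤ 10 (≤-trans
        (proj₂ tabled n (suc n) n<N n+1<N (proj₁ heavy) (proj₁ (proj₂ heavy))
          (≤-trans (sumTo-mono n λ i _ → on≤ (proj₁ heavy i) 1) (≤-reflexive (trans (sumTo-const n 1) (*-identityʳ n))))) V≤))
    Feas-cong : ∀ {H K} → (∀ i → i < n → H i ≡ K i) → Feas H → Feas K
    Feas-cong {H} {K} h = Tasks.Feas-⊆ A {K} {H} λ i i<n Ki → trans (h i i<n) Ki
    copied : ⟦ ! total ≺ VAL at wallsᴱ ⟧ σ₅ ≢ 0 → Feas (selected (sem copy σ₅)) ×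
      (∀ G → Feas G → sumOver n G p ≤ 16 * sumOver n (selected (sem copy σ₅)) p)
    copied h = Feas-cong (λ i i<n → sym (copy-correct σ₅ ctx₅ i i<n)) (Valid⇒Feas (proj₁ sound)) ,
      λ G feas → weigh G feas (≤-trans (<⇒≤ better) V≤) V≤
      where
      better : sumOver n S p < V
      better = subst₂ _<_ total-eq (walls-eq σ₅ ctx₅) (≺-true h)
      V≤ : V ≤ sumOver n (selected (sem copy σ₅)) p
      V≤ = ≤-trans (proj₂ sound) (≤-reflexive (sym (weight-cong (copy-correct σ₅ ctx₅))))
    kept : ⟦ ! total ≺ VAL at wallsᴱ ⟧ σ₅ ≡ 0 → Feas (selected σ₅) ×
      (∀ G → Feas G → sumOver n G p ≤ 16 * sumOver n (selected σ₅) p)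
    kept h = Feas-cong S₅ feasible , λ G feas → weigh G feas (≤-reflexive (weight-cong S₅))
      (≤-trans (subst₂ _≤_ (walls-eq σ₅ ctx₅) total-eq (≺-false {σ₅ total 0} h)) (≤-reflexive (weight-cong S₅)))

-- Running time and word length

depth : Prog → ℕ
depth (a [ e ]≔ f)  = 0
depth (p ⨟ q)       = depth p ⊔ depth q
depth (when e p)    = depth p
depth (for v i c p) = suc (depth p)

coefficient : Prog → ℕ
coefficient (a [ e ]≔ f)  = 1 + cost e + cost f
coefficient (p ⨟ q)       = coefficient p + coefficient q
coefficient (when e p)    = 2 + cost e + coefficient p
coefficient (for v i c p) = 18 + coefficient p

-- As N is at least 1, every constant can be padded with powers of N up to the nesting depth. The 18
-- of a loop collects its entry cost 9 and its cost 9 per iteration.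
maxTime≤ : ∀ p N → 1 ≤ N → maxTime p N ≤ coefficient p * N ^ depth p
maxTime≤ p (suc N′) _ = go p
  where
  N = suc N′
  open ≤-Reasoning
  pad : ∀ c k → c ≤ c * N ^ k
  pad c k = m≤m*n c (N ^ k) {{m^n≢0 N k}}
  go : ∀ p → maxTime p N ≤ coefficient p * N ^ depth p
  go (a [ e ]≔ f) = pad _ 0
  go (p ⨟ q) = ≤-trans
    (+-mono-≤ (≤-trans (go p) (*-monoʳ-≤ (coefficient p) (^-monoʳ-≤ N (m≤m⊔n (depth p) (depth q)))))
              (≤-trans (go q) (*-monoʳ-≤ (coefficient q) (^-monoʳ-≤ N (m≤n⊔m (depth p) (depth q))))))
    (≤-reflexive (sym (*-distribʳ-+ _ (coefficient p) (coefficient q))))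
  go (when e p) = ≤-trans (+-mono-≤ (pad (2 + cost e) (depth p)) (go p))
    (≤-reflexive (sym (*-distribʳ-+ (N ^ depth p) (2 + cost e) (coefficient p))))
  go (for v i c p) = begin
    9 + N * (9 + maxTime p N)                  ≤⟨ +-mono-≤ (pad 9 (suc (depth p))) (*-monoʳ-≤ N (+-mono-≤ (pad 9 (depth p)) (go p))) ⟩
    9 * (N * N ^ depth p) + N * (9 * N ^ depth p + coefficient p * N ^ depth p)
      ≡⟨ solve 3 (λ x y z → con 9 :* (x :* y) :+ x :* (con 9 :* y :+ z :* y) := (con 18 :+ z) :* (x :* y)) refl N (N ^ depth p) (coefficient p) ⟩
    (18 + coefficient p) * (N * N ^ depth p)   ∎
    where open +-*-Solver

<2^bits : ∀ x → x < 2 ^ bits x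
<2^bits x = ≰⇒> λ le → <-irrefl refl
  (≤-trans (≤-reflexive (sym (⌊log₂[2^n]⌋≡n (bits x)))) (⌊log₂⌋-mono-≤ le))

∑≡sumTo : ∀ {k} {g : Fin k → ℕ} {f : ℕ → ℕ} → (∀ i → g i ≡ f (toℕ i)) → ∑ g ≡ sumTo k f
∑≡sumTo {zero}  h = refl
∑≡sumTo {suc k} {g} {f} h = trans (cong₂ _+_ (h Fin.zero) (∑≡sumTo {k} (h ∘ Fin.suc))) (sym (sumTo-head k f))

term≤∑ : ∀ {k} (f : Fin k → ℕ) i → f i ≤ ∑ f
term≤∑ f Fin.zero    = m≤m+n _ _
term≤∑ f (Fin.suc i) = ≤-trans (term≤∑ (f ∘ Fin.suc) i) (m≤n+m _ (f Fin.zero))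

k≤∑ : ∀ {k} (f : Fin k → ℕ) → (∀ i → 1 ≤ f i) → k ≤ ∑ f
k≤∑ {zero}  f h = z≤n
k≤∑ {suc k} f h = +-mono-≤ (h Fin.zero) (k≤∑ (f ∘ Fin.suc) (h ∘ Fin.suc))

module InstanceSize (I : UFPP) where
  open UFPP I

  -- Each vertex picks a task and a side on which it is an endpoint of that task. The choice is
  -- injective, because task and side determine the vertex.
  vertices≤ : suc m ≤ n + n
  vertices≤ = injective⇒≤ {f = code} injective
    where
    side : Fin (suc m) → Fin n ⊎ Fin n
    side v with endpoints v
    ... | i , inj₁ _ = inj₁ i
    ... | i , inj₂ _ = inj₂ i
    vertex : Fin n ⊎ Fin n → Fin (suc m)
    vertex (inj₁ i) = start i
    vertex (inj₂ i) = end i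
    vertex-side : ∀ v → vertex (side v) ≡ v
    vertex-side v with endpoints v
    ... | i , inj₁ e = e
    ... | i , inj₂ e = e
    code : Fin (suc m) → Fin (n + n)
    code = Fin.join n n ∘ side
    injective : ∀ {u v} → code u ≡ code v → u ≡ v
    injective {u} {v} e = trans (sym (vertex-side u)) (trans (cong vertex
      (trans (sym (splitAt-join n n (side u))) (trans (cong (Fin.splitAt n) e) (splitAt-join n n (side v))))) (vertex-side v))

  1≤n : 1 ≤ n
  1≤n = n≢0⇒n>0 λ n≡0 → case subst (λ k → suc m ≤ k + k) n≡0 vertices≤ of λ ()

  -- A multiple of n above all loop limits n, m and n + 2; that m is covered relies on `vertices≤`.
  N : ℕ
  N = 4 * n

  n+2≤N : n + 2 ≤ N
  n+2≤N = +-monoʳ-≤ n (≤-trans (+-mono-≤ 1≤n 1≤n) (+-monoʳ-≤ n (m≤m+n n _)))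

  m+2≤N : m + 2 ≤ N
  m+2≤N = begin
    m + 2           ≡⟨ +-suc m 1 ⟩
    suc m + 1       ≤⟨ +-mono-≤ vertices≤ 1≤n ⟩
    (n + n) + n     ≤⟨ +-monoʳ-≤ (n + n) (m≤m+n n (n + 0)) ⟩
    (n + n) + (n + (n + 0))  ≡⟨ +-assoc n n _ ⟩
    N               ∎
    where open ≤-Reasoning

  len : ℕ
  len = inputLength I

  taskBits : Fin n → ℕ
  taskBits i = bits (toℕ (start i)) + bits (toℕ (end i)) + bits (demand i) + bits (profit i)

  n≤len : n ≤ len
  n≤len = ≤-trans (k≤∑ taskBits λ i → s≤s z≤n) (m≤n+m _ _)

  1≤len : 1 ≤ len
  1≤len = ≤-trans 1≤n n≤len

  short : ∀ x → bits x ≤ len → x ≤ 2 ^ len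
  short x le = ≤-trans (<⇒≤ (<2^bits x)) (^-monoʳ-≤ 2 le)

  task-short : ∀ i x → bits x ≤ taskBits i → x ≤ 2 ^ len
  task-short i x le = short x (≤-trans le (≤-trans (term≤∑ taskBits i) (m≤n+m _ _)))

  array-short : ∀ {k} (f : Fin k → ℕ) → (∀ i → f i ≤ 2 ^ len) → ∀ j → array f j ≤ 2 ^ len
  array-short {k} f h j with j <? k
  ... | yes lt = h (fromℕ< lt)
  ... | no _   = z≤n

  initial-short : ∀ a i → initial I a i ≤ 2 ^ len
  initial-short 0 0 = short n (≤-trans (m≤m+n (bits n) (bits m)) (≤-trans (m≤m+n _ _) (m≤m+n _ _)))
  initial-short 0 1 = short m (≤-trans (m≤n+m (bits m) (bits n)) (≤-trans (m≤m+n _ _) (m≤m+n _ _)))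
  initial-short 0 (suc (suc _)) = z≤n
  initial-short 1 i = array-short capacity (λ e → short _ (≤-trans (term≤∑ (λ e → bits (capacity e)) e)
    (≤-trans (m≤n+m _ (bits n + bits m)) (m≤m+n _ _)))) i
  initial-short 2 i = array-short _ (λ j → task-short j _ (≤-trans (m≤m+n _ _) (≤-trans (m≤m+n _ _) (m≤m+n _ _)))) i
  initial-short 3 i = array-short _ (λ j → task-short j _ (≤-trans (m≤n+m _ (bits (toℕ (start j)))) (≤-trans (m≤m+n _ _) (m≤m+n _ _)))) i
  initial-short 4 i = array-short demand (λ j → task-short j _ (≤-trans (m≤n+m _ (bits (toℕ (start j)) + bits (toℕ (end j)))) (m≤m+n _ _))) i
  initial-short 5 i = array-short profit (λ j → task-short j _ (m≤n+m _ (bits (toℕ (start j)) + bits (toℕ (end j)) + bits (demand j)))) i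
  initial-short (suc (suc (suc (suc (suc (suc _)))))) i = z≤n

  initial-bounds : ∀ i → initial I 0 i + 2 ≤ N
  initial-bounds 0 = n+2≤N
  initial-bounds 1 = m+2≤N
  initial-bounds (suc (suc i)) = ≤-trans (m≤n+m 2 n) n+2≤N

-- The left side is at most (1 + 4 (1 + 256 K)) L ^ 5, where 256 is 4 ^ 4. The running-time
-- definition uses one number as factor and as exponent, so both are raised to a common value.
word-bound : ∀ {L n M K} → 1 ≤ L → n ≤ L → M ≤ K * (4 * n) ^ 4 →
  1 + (3 + L) * (1 + M) ≤ (5 + 4 * suc (K * 256)) * L ^ (5 + 4 * suc (K * 256))
word-bound {L} {n} {M} {K} 1≤L n≤L M≤ = begin
  1 + (3 + L) * (1 + M)                    ≤⟨ +-monoʳ-≤ 1 (*-mono-≤ (+-monoˡ-≤ L (*-monoʳ-≤ 3 1≤L)) (+-monoʳ-≤ 1 M≤)) ⟩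
  1 + (3 * L + L) * (1 + K * (4 * n) ^ 4)  ≤⟨ +-mono-≤ (m^n>0 L 5) (*-monoʳ-≤ (3 * L + L)
      (+-mono-≤ (m^n>0 L 4) (*-monoʳ-≤ K (^-monoˡ-≤ 4 (*-monoʳ-≤ 4 n≤L))))) ⟩
  L ^ 5 + (3 * L + L) * (L ^ 4 + K * (4 * L) ^ 4)
    ≡⟨ solve 2 (λ l k → l :^ 5 :+ (con 3 :* l :+ l) :* (l :^ 4 :+ k :* (con 4 :* l) :^ 4) := (con 1 :+ con 4 :* (con 1 :+ k :* con 256)) :* l :^ 5) refl L K ⟩
  (1 + 4 * suc (K * 256)) * L ^ 5          ≤⟨ *-mono-≤ (+-monoˡ-≤ (4 * suc (K * 256)) {1} {5} (s≤s z≤n)) (^-monoʳ-≤ L {5} (m≤m+n 5 (4 * suc (K * 256)))) ⟩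
  (5 + 4 * suc (K * 256)) * L ^ (5 + 4 * suc (K * 256)) ∎
  where
  open ≤-Reasoning
  open +-*-Solver
  instance
    L≢0 : NonZero L
    L≢0 = >-nonZero 1≤L

execute-within : ∀ p → wellFormed p ≡ true → ∀ {N L σ} →
  (∀ a i → σ a i ≤ 2 ^ L) → (∀ i → σ 0 i + 2 ≤ N) →
  Σ[ t ∈ ℕ ] t ≤ maxTime p N × 1 + (3 + L) * (1 + maxTime p N) ⊢⟨ compile p , σ ⟩⇓⟨ sem p σ , t ⟩
execute-within p p-wellFormed {N} {L} {σ} short bounds =
  let executes t t≤ ex _ = execute p p-wellFormed ((λ a i _ → cell≤ a i) , bounds) ≤-refl
        (bounded λ a i → ≤-trans (cell≤ a i) (≤-reflexive (sym (*-identityʳ (2 ^ y))))) ≤-refl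
  in t , t≤ , ex
  where
  -- The base `2 ^ (3 + L)` dominates the constants, being at least 8, and the inputs. The exponent
  -- starts at 1 and grows by at most the time bound.
  y E : ℕ
  y = 3 + L
  E = 1 + maxTime p N
  word : ∀ y E → (2 ^ y) ^ E < 2 ^ (1 + y * E)
  word y E = subst (_< 2 ^ (1 + y * E)) (sym (^-*-assoc 2 y E)) (^-monoʳ-< 2 ≤-refl {y * E} {1 + y * E} ≤-refl)
  open Execution (2 ^ y) N (1 + y * E) E (^-monoʳ-≤ 2 {3} {y} (m≤m+n 3 L)) (word y E)
  cell≤ : ∀ a i → σ a i ≤ 2 ^ y
  cell≤ a i = ≤-trans (short a i) (^-monoʳ-≤ 2 (m≤n+m L 3))

module Resources (p : Prog) (p-wellFormed : wellFormed p ≡ true) (K : ℕ)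
  (time-bound : ∀ N → 1 ≤ N → maxTime p N ≤ K * N ^ 4) where

  timeBound : ℕ → ℕ
  timeBound n = K * (4 * n) ^ 4

  k : ℕ
  k = 5 + 4 * suc (K * 256)

  record Resourceful (I : UFPP) : Set where
    field
      run : Run (compile p) I
      final≡ : Run.final run ≡ sem p (initial I)
      time≤T : Run.time run ≤ timeBound (UFPP.n I)
      word≤ : Run.wordLength run ≤ k * inputLength I ^ k

  resourceful : ∀ I → Resourceful I
  resourceful I =
    let t , t≤ , ex = execute-within p p-wellFormed {N} {len} initial-short initial-bounds in record
    { run = record { wordLength = 1 + (3 + len) * (1 + maxTime p N) ; final = sem p (initial I) ; time = t ; execution = ex }
    ; final≡ = refl
    ; time≤T = ≤-trans t≤ maxTime≤T
    ; word≤ = word-bound {len} {n} {maxTime p N} {K} 1≤len n≤len maxTime≤T }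
    where
    open UFPP I using (n)
    open InstanceSize I
    maxTime≤T : maxTime p N ≤ timeBound n
    maxTime≤T = time-bound N (≤-trans 1≤n (m≤m+n n _))

  running-time : HasRunningTimeO (λ n → n ^ 4 * ⌈log₂ n ⌉) (compile p)
  running-time = timeBound , k , (K * 256 , 2 , bound) , λ I →
    let open Resourceful (resourceful I) in run , time≤T , word≤
    where
    -- The logarithm is at least 1 from n = 2 on; at n = 1 it is 0, whence the threshold 2.
    bound : ∀ n → 2 ≤ n → timeBound n ≤ K * 256 * (n ^ 4 * ⌈log₂ n ⌉)
    bound n 2≤n = begin
      K * (4 * n) ^ 4                 ≡⟨ solve 2 (λ k n → k :* (con 4 :* n) :^ 4 := k :* con 256 :* (n :^ 4 :* con 1)) refl K n ⟩
      K * 256 * (n ^ 4 * 1)           ≤⟨ *-monoʳ-≤ (K * 256) (*-monoʳ-≤ (n ^ 4) (≤-trans (≤-reflexive (sym (⌈log₂2^n⌉≡n 1))) (⌈log₂⌉-mono-≤ 2≤n))) ⟩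
      K * 256 * (n ^ 4 * ⌈log₂ n ⌉)   ∎
      where
      open ≤-Reasoning
      open +-*-Solver

-- The approximation guarantee

on-if : ∀ b x → (if b then x else 0) ≡ on b x
on-if true  x = refl
on-if false x = refl

module Approximation (I : UFPP) (σA : State) (anchors-found : Anchoring.AnchorsFound I σA)
  (contextA : Correctness.Context I σA anchors-found σA)
  (fresh : Fresh σA) where
  open UFPP I
  open Anchoring I hiding (t≤m; s<t)

  module Outcome = Correctness I σA anchors-found
  open Tasks Outcome.A using (load; Feas)

  final : State
  final = sem afterAnchors σA

  final-correct : Feas (Outcome.selected final) ×
    (∀ G → Feas G → sumOver n G p ≤ 16 * sumOver n (Outcome.selected final) p)
  final-correct = Outcome.afterAnchors-correct σA contextA fresh

  _represents_ : PSet → Subset n → Set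
  H represents F = ∀ i → lookup F i ≡ H (toℕ i)

  members : Subset n → PSet
  members G j = not (array (λ i → if lookup G i then 1 else 0) j ≡ᵇ 0)

  members-represents : ∀ G → members G represents G
  members-represents G i = trans (bit (lookup G i)) (cong (λ x → not (x ≡ᵇ 0)) (sym (array-toℕ (λ i → if lookup G i then 1 else 0) i)))
    where
    bit : ∀ b → b ≡ not ((if b then 1 else 0) ≡ᵇ 0)
    bit true  = refl
    bit false = refl

  selected-represents : ∀ σ → Outcome.selected σ represents output I σ
  selected-represents σ = lookup∘tabulate (λ i → not (σ 6 (toℕ i) ≡ᵇ 0))

  module _ {H : PSet} {F : Subset n} (rep : H represents F) where

    load≡ : ∀ e → ∑[ F Subset.∩ tasksUsing e ] demand ≡ load H (toℕ e)
    load≡ e = ∑≡sumTo λ i → trans (on-if (lookup (F Subset.∩ tasksUsing e) i) (demand i)) (cong₂ on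
      (trans (lookup-zipWith _∧_ i F (tasksUsing e)) (cong₂ _∧_ (rep i)
        (trans (lookup∘tabulate _ i) (cong₂ (λ x y → (x ≤ᵇ toℕ e) ∧ (toℕ e <ᵇ y)) (sym (array-toℕ _ i)) (sym (array-toℕ _ i))))))
      (sym (array-toℕ demand i)))

    w≡ : w F ≡ sumOver n H p
    w≡ = ∑≡sumTo λ i → trans (on-if (lookup F i) (profit i)) (cong₂ on (rep i) (sym (array-toℕ profit i)))

    Feas⇒Feasible : Feas H → Feasible F
    Feas⇒Feasible feas e = subst₂ _≤_ (sym (load≡ e)) (array-toℕ capacity e) (feas (toℕ e) (toℕ<n e))

    Feasible⇒Feas : Feasible F → Feas H
    Feasible⇒Feas feas e e<m = subst (λ e → load H e ≤ c e) (toℕ-fromℕ< e<m)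
      (subst₂ _≤_ (load≡ _) (sym (array-toℕ capacity _)) (feas (fromℕ< e<m)))

  F : Subset n
  F = output I final

  S : PSet
  S = Outcome.selected final

  output-feasible : Feasible F
  output-feasible = Feas⇒Feasible {S} {F} (selected-represents final) (proj₁ final-correct)

  output-weight : ∀ G → Feasible G → w G ≤ 16 * w F
  output-weight G feas = subst₂ (λ x y → x ≤ 16 * y)
    (sym (w≡ {members G} {G} (members-represents G))) (sym (w≡ {S} {F} (selected-represents final)))
    (proj₂ final-correct (members G) (Feasible⇒Feas {members G} {G} (members-represents G) feas))

open import Data.Integer.Base using (+_)

ratio≤ : ∀ x y → x ≤ 16 * y → ℚ.1/ (+ 2512 / 100) ℚ.* (+ x / 1) ℚ.≤ + y / 1
ratio≤ x y x≤16y = ℚ.toℚᵘ-cancel-≤ (begin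
  ℚ.toℚᵘ (ℚ.1/ (+ 2512 / 100) ℚ.* (+ x / 1))            ≃⟨ ℚ.toℚᵘ-homo-* (ℚ.1/ (+ 2512 / 100)) (+ x / 1) ⟩
  -- In lowest terms 25.12 is 628 / 25, so its inverse is 25 / 628; `mkℚᵘ` stores the denominator
  -- minus one. What remains is 25 · 16 = 400 ≤ 628.
  ℚᵘ.mkℚᵘ (+ 25) 627 ℚᵘ.* ℚ.toℚᵘ (+ x / 1)              ≃⟨ ℚᵘ.*-congˡ {ℚᵘ.mkℚᵘ (+ 25) 627} (ℚ.toℚᵘ-fromℚᵘ (ℚᵘ.mkℚᵘ (+ x) 0)) ⟩
  ℚᵘ.mkℚᵘ (+ 25) 627 ℚᵘ.* ℚᵘ.mkℚᵘ (+ x) 0               ≤⟨ ℚᵘ.*≤* cross ⟩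
  ℚᵘ.mkℚᵘ (+ y) 0                                       ≃⟨ ℚ.toℚᵘ-fromℚᵘ (ℚᵘ.mkℚᵘ (+ y) 0) ⟨
  ℚ.toℚᵘ (+ y / 1)                                      ∎)
  where
  open ℚᵘ.≤-Reasoning
  25x≤628y : 25 * x ≤ y * 628
  25x≤628y = ≤-trans (*-monoʳ-≤ 25 x≤16y) (≤-trans (≤-reflexive (sym (*-assoc 25 16 y)))
    (≤-trans (*-monoˡ-≤ y (m≤m+n 400 228)) (≤-reflexive (*-comm 628 y))))
  cross : (+ 25 ℤ.* + x) ℤ.* + 1 ℤ.≤ + y ℤ.* + 628
  cross = subst₂ ℤ._≤_ (trans (ℤ.pos-* 25 x) (sym (ℤ.*-identityʳ (+ 25 ℤ.* + x)))) (ℤ.pos-* y 628) (ℤ.+≤+ 25x≤628y)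

Approximates₁₆ : Prog → Set
Approximates₁₆ p = ∀ I → Σ[ F ∈ Subset (UFPP.n I) ] F ≡ output I (sem p (initial I)) ×
  UFPP.Feasible I F × (∀ G → UFPP.Feasible I G → UFPP.w I G ≤ 16 * UFPP.w I F)

module _ (α : ℚ.ℚ) .{{α≢0 : ℚ.NonZero α}}
  (ratio : ∀ x y → x ≤ 16 * y → ℚ.1/ α ℚ.* (+ x / 1) ℚ.≤ + y / 1) where

  is-approximation : ∀ p (r : ∀ I → Run (compile p) I) → (∀ I → Run.final (r I) ≡ sem p (initial I)) →
    Approximates₁₆ p → IsApproximationAlgorithm α (compile p)
  is-approximation p r final≡ correct I =
    let F , F≡ , feasible , heavy = correct I in
    r I , subst Good (trans F≡ (cong (output I) (sym (final≡ I))))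
      (feasible , λ G opt → ratio (w G) (w F) (heavy G (proj₁ opt)))
    where
    open UFPP I using (w; Feasible; Optimal)
    Good : Subset (UFPP.n I) → Set
    Good F = Feasible F × (∀ G → Optimal G → ℚ.1/ α ℚ.* (+ w G / 1) ℚ.≤ + w F / 1)

algorithm-approximates : Approximates₁₆ algorithm
algorithm-approximates I = output I (sem afterAnchors σA) , cong (output I) (sym (sem-⨟ anchors afterAnchors (initial I))) , output-feasible , output-weight
  where
  σA : State
  σA = sem anchors (initial I)
  sem-⨟ : ∀ p q σ → sem (p ⨟ q) σ ≡ sem q (sem p σ)
  sem-⨟ p q σ = refl
  frA : ∀ {a} → writes a anchors ≡ false → ∀ i → σA a i ≡ initial I a i
  frA {a} h = frame anchors (initial I) {a} h
  contextA : Correctness.Context I σA (Anchoring.anchors-correct I) σA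
  contextA = record
    { input = Anchoring.Input-frame I anchors refl frA (λ a _ i → refl)
    ; pos-kept = λ _ → refl ; top-kept = λ _ → refl ; key-kept = λ _ → refl }
  freshA : Fresh σA
  freshA = record
    { weight≡0 = frA {WEIGHT} refl ; done≡0 = frA {DONE} refl ; sel≡0 = frA {SEL} refl
    ; val≡0 = frA {VAL} refl ; sol≡0 = frA {SOL} refl }
  open Approximation I σA (Anchoring.anchors-correct I) contextA freshA

theorem5p2 : ∃[ c ] IsApproximationAlgorithm (+ 2512 / 100) c × HasRunningTimeO (λ n → n ^ 4 * ⌈log₂ n ⌉) c
theorem5p2 = compile algorithm ,
  is-approximation (+ 2512 / 100) ratio≤ algorithm
    (λ I → Resourceful.run (resourceful I)) (λ I → Resourceful.final≡ (resourceful I)) algorithm-approximates ,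
  running-time
  where
  -- `depth algorithm` evaluates to 4: the sweeps, the two loops over pairs, and the innermost loop
  -- over tasks.
  open Resources algorithm algorithm-wellFormed (coefficient algorithm) (maxTime≤ algorithm)
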